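{- Let $\mathbb{F}_q$ be a finite field with $q\equiv 1\pmod 3$, let $b_0\in\mathbb{F}_q$ be such that $\chi(b_0)=\rho$, and let $t\in\mathbb{F}_q$ be a non quadratic residue. There exist $(2q+4)/3$ isomorphism classes of elliptic curves over $\mathbb{F}_q$ with only one rational subgroup of order three, whose points are defined over $\mathbb{F}_{q^2}\setminus\mathbb{F}_q$. A family of representatives is given by the curves $y^2=x^3+t^2A_a\,x+t^3B_a$ with $$A_a=-\frac{a^3(a^9-24b_0^i)}{48},\qquad B_a=\frac{b_0^{2i}}{4}+\frac{a^{18}}{864}-\frac{a^9b_0^i}{24},$$ where $i=0,1,2$ and $\chi(a^3-27b_0^i)\neq 1$.
   Context: Here $\chi$ is a cubic character over $\mathbb{F}_q$ and $\rho$ is a primitive cube root of unity, so that $\chi(b_0)=\rho$ means in particular that $b_0$ is not a cube; the parameter $a$ ranges over elements of $\mathbb{F}_q$. A subgroup of the group of points of an elliptic curve $E$ over the algebraic closure of $\mathbb{F}_q$ is called rational if it is stable, as a set, under the Frobenius map $(x,y)\mapsto(x^q,y^q)$; its individual points need not be defined over $\mathbb{F}_q$. The statement about the points of the subgroup refers to its points other than the point at infinity. Isomorphism classes are over $\mathbb{F}_q$.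
   Formalization: The printed A_a, B_a fail (q=13, b₀=2, i=2, a=2); proved with a, a³, a⁶ in place of a³, a⁹, a¹⁸: A_a=−a(a³−24b₀^i)/48, B_a=b₀^{2i}/4+a⁶/864−a³b₀^i/24. Singular i=0, a³=27 is excluded; curves with equal i and a³ are isomorphic. -}

module Defs where

open import Level using (Level; _⊔_) renaming (suc to lsuc)
open import Algebra.Apartness.Bundles using (HeytingField; HeytingCommutativeRing)
open import Algebra.Bundles using (CommutativeRing; Semiring)
open import Algebra.Morphism.Structures using (IsRingHomomorphism)
import Algebra.Definitions.RawSemiring as RawSemiringDefs
open import Data.Fin using (Fin; toℕ)
open import Data.Nat as ℕ using (ℕ; suc)
open import Data.Product using (Σ-syntax; ∃-syntax; _×_; proj₁)
open import Data.Vec using (Vec; []; _∷_; map)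
open import Function.Bundles using (Inverse; _⇔_)
open import Relation.Binary.Definitions using (Decidable)
open import Relation.Binary.PropositionalEquality as ≡ using (_≡_)
open import Relation.Nullary using (¬_; yes; no)
open import Relation.Unary using (Pred; _∈_; _⊆_; _≐_)

-- A discrete field: `_#_` is tight, so deciding it also decides `_≈_`.
record Field c ℓ₁ ℓ₂ : Set (lsuc (c ⊔ ℓ₁ ⊔ ℓ₂)) where
  infix 4 _#?_
  infix 8 _⁻¹
  infixl 7 _/_
  field
    heytingField : HeytingField c ℓ₁ ℓ₂

  open HeytingField heytingField public
    using (_#_; #⇒invertible; heytingCommutativeRing)
  open HeytingCommutativeRing heytingCommutativeRing public
    using (commutativeRing)
  open CommutativeRing commutativeRing public

  field
    _#?_ : Decidable _#_

  open RawSemiringDefs (Semiring.rawSemiring semiring) public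
    using (_^_) renaming (_×_ to infixr 8 _·_)

  -- By convention 0# ⁻¹ is 0#.
  _⁻¹ : Carrier → Carrier
  x ⁻¹ with x #? 0#
  ... | yes x#0 = proj₁ (#⇒invertible x#0)
  ... | no  _   = 0#

  _/_ : Carrier → Carrier → Carrier
  x / y = x * y ⁻¹

record FiniteField c ℓ₁ ℓ₂ : Set (lsuc (c ⊔ ℓ₁ ⊔ ℓ₂)) where
  field
    fld : Field c ℓ₁ ℓ₂
  open Field fld public
  field
    size        : ℕ
    enumeration : Inverse (≡.setoid (Fin size)) setoid

module _ {c ℓ₁ ℓ₂} (F : Field c ℓ₁ ℓ₂) where
  open Field F

  -- The value at x of the monic polynomial of degree n with lower
  -- coefficients c₀, …, cₙ₋₁.
  monicEval : ∀ {n} → Vec Carrier n → Carrier → Carrier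
  monicEval []       x = 1#
  monicEval (a ∷ as) x = a + x * monicEval as x

  IsAlgebraicallyClosed : Set (c ⊔ ℓ₁)
  IsAlgebraicallyClosed =
    ∀ n (as : Vec Carrier (suc n)) → ∃[ x ] monicEval as x ≈ 0#

  IsQuadraticNonResidue : Carrier → Set (c ⊔ ℓ₁)
  IsQuadraticNonResidue t = ∀ s → ¬ (s * s ≈ t)

record AlgebraicClosure {c ℓ₁ ℓ₂} (F : Field c ℓ₁ ℓ₂) (c′ ℓ₁′ ℓ₂′ : Level) :
                        Set (c ⊔ ℓ₁ ⊔ ℓ₂ ⊔ lsuc (c′ ⊔ ℓ₁′ ⊔ ℓ₂′)) where
  private module F = Field F
  field
    closure : Field c′ ℓ₁′ ℓ₂′
  open Field closure public
  field
    embed          : F.Carrier → Carrier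
    isHomomorphism : IsRingHomomorphism F.rawRing rawRing embed
    algebraic      : ∀ z → ∃[ n ] Σ[ as ∈ Vec F.Carrier n ]
                       monicEval closure (map embed as) z ≈ 0#
    closed         : IsAlgebraicallyClosed closure

-- The field of values C is arbitrary (for instance ℂ, which is why
-- apartness in C is not required to be decidable).
module _ {c ℓ₁ ℓ₂ d m₁ m₂} (F : Field c ℓ₁ ℓ₂) (C : HeytingField d m₁ m₂) where
  private
    module F = Field F
    module C where
      open HeytingField C public using (_#_; heytingCommutativeRing)
      open HeytingCommutativeRing heytingCommutativeRing public using (commutativeRing)
      open CommutativeRing commutativeRing public
      open RawSemiringDefs (Semiring.rawSemiring semiring) public using (_^_)

  record CubicCharacter : Set (c ⊔ ℓ₁ ⊔ ℓ₂ ⊔ d ⊔ m₁ ⊔ m₂) where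
    field
      χ          : F.Carrier → C.Carrier
      χ-cong     : ∀ {x y} → x F.≈ y → χ x C.≈ χ y
      χ-homo-*   : ∀ x y → χ (x F.* y) C.≈ χ x C.* χ y
      χ-zero     : χ F.0# C.≈ C.0#
      χ-one      : χ F.1# C.≈ C.1#
      χ-cubic    : ∀ x → x F.# F.0# → χ x C.^ 3 C.≈ C.1#
      nontrivial : ∃[ x ] (x F.# F.0#) × (χ x C.# C.1#)

IsPrimitiveCubeRoot : ∀ {d m₁ m₂} (C : HeytingField d m₁ m₂) →
                      HeytingField.Carrier C → Set (m₁ ⊔ m₂)
IsPrimitiveCubeRoot C ρ = (ρ * (ρ * ρ) ≈ 1#) × (ρ # 1#)
  where open HeytingField C

-- y² + a₁xy + a₃y = x³ + a₂x² + a₄x + a₆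
record Weierstrass {c} (A : Set c) : Set c where
  constructor weierstrass
  field
    a₁ a₂ a₃ a₄ a₆ : A

mapCoefficients : ∀ {c d} {A : Set c} {B : Set d} →
                  (A → B) → Weierstrass A → Weierstrass B
mapCoefficients f (weierstrass a₁ a₂ a₃ a₄ a₆) =
  weierstrass (f a₁) (f a₂) (f a₃) (f a₄) (f a₆)

module _ {c ℓ₁ ℓ₂} (F : Field c ℓ₁ ℓ₂) where
  open Field F
  open Weierstrass

  discriminant : Weierstrass Carrier → Carrier
  discriminant (weierstrass a₁ a₂ a₃ a₄ a₆) =
    - (b₂ ^ 2 * b₈) - 8 · b₄ ^ 3 - 27 · b₆ ^ 2 + 9 · (b₂ * b₄ * b₆)
    where
    b₂ = a₁ ^ 2 + 4 · a₂
    b₄ = 2 · a₄ + a₁ * a₃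
    b₆ = a₃ ^ 2 + 4 · a₆
    b₈ = a₁ ^ 2 * a₆ + 4 · (a₂ * a₆) - a₁ * a₃ * a₄ + a₂ * a₃ ^ 2 - a₄ ^ 2

  record EllipticCurve : Set (c ⊔ ℓ₂) where
    constructor ellipticCurve
    field
      equation    : Weierstrass Carrier
      nonsingular : discriminant equation # 0#

  -- The isomorphisms defined over F are the changes of variables
  -- x = u²x′ + r, y = u³y′ + su²x′ + t with u nonzero.
  Isomorphic : EllipticCurve → EllipticCurve → Set (c ⊔ ℓ₁ ⊔ ℓ₂)
  Isomorphic E E′ = ∃[ u ] ∃[ r ] ∃[ s ] ∃[ t ]
      (u # 0#)
    × (u     * a₁ W′ ≈ a₁ W + 2 · s)
    × (u ^ 2 * a₂ W′ ≈ a₂ W - s * a₁ W + 3 · r - s ^ 2)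
    × (u ^ 3 * a₃ W′ ≈ a₃ W + r * a₁ W + 2 · t)
    × (u ^ 4 * a₄ W′ ≈ a₄ W - s * a₃ W + 2 · (r * a₂ W)
                         - (t + r * s) * a₁ W + 3 · r ^ 2 - 2 · (s * t))
    × (u ^ 6 * a₆ W′ ≈ a₆ W + r * a₄ W + r ^ 2 * a₂ W + r ^ 3
                         - t * a₃ W - t ^ 2 - r * t * a₁ W)
    where
    W  = EllipticCurve.equation E
    W′ = EllipticCurve.equation E′

  HasNumberOfClasses : ∀ {p} → Pred EllipticCurve p → ℕ → Set (c ⊔ ℓ₁ ⊔ ℓ₂ ⊔ p)
  HasNumberOfClasses P n = Σ[ E ∈ (Fin n → EllipticCurve) ]
      (∀ k → E k ∈ P)
    × (∀ k l → Isomorphic (E k) (E l) → k ≡ l)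
    × (∀ E′ → E′ ∈ P → ∃[ k ] Isomorphic E′ (E k))

-- Points are the point at infinity and all pairs of coordinates; lying on
-- the curve is the separate predicate OnCurve.
module Points {c ℓ₁ ℓ₂} (F : Field c ℓ₁ ℓ₂)
              (W : Weierstrass (Field.Carrier F)) where
  open Field F
  open Weierstrass W

  data Point : Set c where
    ∞   : Point
    aff : (x y : Carrier) → Point

  infix 4 _≋_
  data _≋_ : Point → Point → Set (c ⊔ ℓ₁) where
    ∞   : ∞ ≋ ∞
    aff : ∀ {x y x′ y′} → x ≈ x′ → y ≈ y′ → aff x y ≋ aff x′ y′

  data OnCurve : Point → Set (c ⊔ ℓ₁) where
    ∞   : OnCurve ∞
    aff : ∀ {x y} →
          y ^ 2 + a₁ * x * y + a₃ * y ≈ x ^ 3 + a₂ * x ^ 2 + a₄ * x + a₆ →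
          OnCurve (aff x y)

  infix  8 ⊖_
  infixl 6 _⊕_

  ⊖_ : Point → Point
  ⊖ ∞       = ∞
  ⊖ aff x y = aff x (- y - a₁ * x - a₃)

  -- The third intersection point with the line of slope m through
  -- (x₁ , y₁), reflected.
  thirdPoint : (m x₁ y₁ x₂ : Carrier) → Point
  thirdPoint m x₁ y₁ x₂ = ⊖ aff x₃ (y₁ + m * (x₃ - x₁))
    where x₃ = m ^ 2 + a₁ * m - a₂ - x₁ - x₂

  _⊕_ : Point → Point → Point
  ∞         ⊕ Q         = Q
  aff x y   ⊕ ∞         = aff x y
  aff x₁ y₁ ⊕ aff x₂ y₂ with x₁ #? x₂ | y₁ + y₂ + a₁ * x₂ + a₃ #? 0#
  ... | yes _ | _     = thirdPoint ((y₂ - y₁) / (x₂ - x₁)) x₁ y₁ x₂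
  ... | no  _ | no  _ = ∞
  ... | no  _ | yes _ = thirdPoint
    ((3 · x₁ ^ 2 + 2 · (a₂ * x₁) + a₄ - a₁ * y₁) / (2 · y₁ + a₁ * x₁ + a₃))
    x₁ y₁ x₂

  record Subgroup : Set (lsuc (c ⊔ ℓ₁)) where
    field
      members  : Pred Point (c ⊔ ℓ₁)
      onCurve  : members ⊆ OnCurve
      resp-≋   : ∀ {P Q} → P ≋ Q → P ∈ members → Q ∈ members
      ∞-closed : ∞ ∈ members
      ⊕-closed : ∀ {P Q} → P ∈ members → Q ∈ members → P ⊕ Q ∈ members
      ⊖-closed : ∀ {P} → P ∈ members → ⊖ P ∈ members

  open Subgroup public

  HasOrder : Subgroup → ℕ → Set (c ⊔ ℓ₁)
  HasOrder H n = Σ[ e ∈ (Fin n → Point) ]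
      (∀ k l → e k ≋ e l → k ≡ l)
    × (∀ P → P ∈ members H ⇔ (∃[ k ] e k ≋ P))

module _ {c ℓ₁ ℓ₂ c′ ℓ₁′ ℓ₂′} (𝔽 : FiniteField c ℓ₁ ℓ₂)
         (𝔽̄ : AlgebraicClosure (FiniteField.fld 𝔽) c′ ℓ₁′ ℓ₂′)
         (E : EllipticCurve (FiniteField.fld 𝔽)) where
  private
    module K = FiniteField 𝔽
    module L = AlgebraicClosure 𝔽̄
    q = K.size

  open Points L.closure (mapCoefficients L.embed (EllipticCurve.equation E))

  frobenius : Point → Point
  frobenius ∞         = ∞
  frobenius (aff x y) = aff (x L.^ q) (y L.^ q)

  IsRational : Subgroup → Set (c′ ⊔ ℓ₁′)
  IsRational H = ∀ {P} → P ∈ members H → frobenius P ∈ members H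

  In𝔽q : Pred L.Carrier (c ⊔ ℓ₁′)
  In𝔽q z = ∃[ k ] L.embed k L.≈ z

  -- The subfield with q² elements of the algebraic closure is the set of
  -- roots of z^(q²) − z.
  In𝔽q² : Pred L.Carrier ℓ₁′
  In𝔽q² z = z L.^ (q ℕ.^ 2) L.≈ z

  -- The affine points of H have coordinates in 𝔽_{q²}, but not both in 𝔽_q.
  PointsDefinedOver𝔽q²∖𝔽q : Subgroup → Set (c ⊔ c′ ⊔ ℓ₁′)
  PointsDefinedOver𝔽q²∖𝔽q H = ∀ {x y} → aff x y ∈ members H →
    (x ∈ In𝔽q² × y ∈ In𝔽q²) × ¬ (x ∈ In𝔽q × y ∈ In𝔽q)

  OnlyOneRationalSubgroupOfOrder3 : Set (c ⊔ lsuc (c′ ⊔ ℓ₁′))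
  OnlyOneRationalSubgroupOfOrder3 = Σ[ H ∈ Subgroup ]
      HasOrder H 3
    × IsRational H
    × (∀ H′ → HasOrder H′ 3 → IsRational H′ → members H′ ≐ members H)
    × PointsDefinedOver𝔽q²∖𝔽q H

module Family {c ℓ₁ ℓ₂ d m₁ m₂} (F : Field c ℓ₁ ℓ₂) (C : HeytingField d m₁ m₂)
              (character : CubicCharacter F C)
              (b₀ t : Field.Carrier F) where
  open Field F
  open CubicCharacter character
  private module C = HeytingField C

  -- y² + axy + by = x³ has c₄ = a(a³ − 24b), c₆ = −(a⁶ − 36a³b + 216b²) and
  -- discriminant b³(a³ − 27b); here A = −c₄/48 and B = −c₆/864.  The
  -- published formulas have a³ in place of a in A and B, but not in the
  -- condition on χ; that version is false, e.g. for the field with 13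
  -- elements.
  A B : Carrier → Carrier → Carrier
  A a b = - (a * (a ^ 3 - 24 · b)) / (48 · 1#)
  B a b = b ^ 2 / (4 · 1#) + a ^ 6 / (864 · 1#) - (a ^ 3 * b) / (24 · 1#)

  equationOf : Fin 3 → Carrier → Weierstrass Carrier
  equationOf i a = weierstrass 0# 0# 0# (t ^ 2 * A a b) (t ^ 3 * B a b)
    where b = b₀ ^ toℕ i

  record Index : Set (c ⊔ ℓ₂ ⊔ m₁) where
    field
      i           : Fin 3
      a           : Carrier
      condition   : ¬ (χ (a ^ 3 - 27 · b₀ ^ toℕ i) C.≈ C.1#)
      -- Excludes i = 0, a³ = 27: there χ takes the value 0.
      nonsingular : discriminant F (equationOf i a) # 0#

  open Index public

  curve : Index → EllipticCurve F
  curve j = ellipticCurve (equationOf (i j) (a j)) (nonsingular j)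

  -- The curves represent all classes in P, a class being represented once
  -- for each a with a given cube.
  IsFamilyOfRepresentatives : ∀ {p} → Pred (EllipticCurve F) p →
                              Set (c ⊔ ℓ₁ ⊔ ℓ₂ ⊔ m₁ ⊔ p)
  IsFamilyOfRepresentatives P =
      (∀ j → curve j ∈ P)
    × (∀ E → E ∈ P → ∃[ j ] Isomorphic F E (curve j))
    × (∀ j k → Isomorphic F (curve j) (curve k) ⇔
                 (i j ≡ i k × a j ^ 3 ≈ a k ^ 3))

{-# OPTIONS --safe #-}

-- A subgroup of order 3 consists of ∞ and two points ± P, where x(P) is a
-- root of the 3-division polynomial ψ, and it is rational if and only if x(P)
-- lies in 𝔽_q. Hence, for a curve Y² = f(X), the condition on E means that ψ
-- has exactly one root X₀ in 𝔽_q and that f(X₀) is not a square there.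
--
-- Such a curve is the twist by t of a curve y² + axy + by = x³, with (0 , 0)
-- as the given point of order 3. A change of variables replaces (a , b) by
-- (ua , u³b), so b may be taken in {1 , b₀ , b₀²}, and then a³ is an invariant.
-- The other roots x of ψ correspond to the cube roots a + 3b/x of a³ − 27b.
--
-- For a ≠ 0 the ratio s = a³ / (a³ − 27b) is a noncube. It determines b and
-- a³, since scaling a³ and b by a common cube is all that s leaves open, and
-- every noncube occurs. Together with a = 0, b ∈ {b₀ , b₀²}, this makes
-- 2 (q − 1) / 3 + 2 = (2q + 4) / 3 classes.

module Submission where

open import Defs
open import Algebra.Apartness.Bundles using (HeytingField; HeytingCommutativeRing)
import Algebra.Apartness.Properties.HeytingCommutativeRing as HeytingProperties
open import Algebra.Bundles using (CommutativeRing; Semiring)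
import Algebra.Definitions.RawSemiring
open import Algebra.Morphism.Structures using (IsRingHomomorphism)
import Algebra.Properties.AbelianGroup
import Algebra.Properties.CommutativeMonoid.Sum
import Algebra.Properties.CommutativeSemiring.Exp
import Algebra.Properties.Group
import Algebra.Properties.Ring
import Algebra.Properties.Semiring.Exp
import Algebra.Properties.Semiring.Mult
import Algebra.Solver.Ring
open import Algebra.Solver.Ring.AlmostCommutativeRing
  using (fromCommutativeRing; Induced-equivalence; _-Raw-AlmostCommutative⟶_)
open import Data.Bool using (T)
open import Data.Fin as Fin using (Fin; zero; suc; toℕ; punchIn; punchOut; combine; remQuot)
open import Data.Fin.Permutation using (permutation)
open import Data.Fin.Properties
  using (any?; pigeonhole; suc-injective; 0≢1+n; punchInᵢ≢i; punchIn-injective; punchIn-punchOut;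
         punchOut-injective; injective⇒≤; combine-injective; remQuot-combine; combine-remQuot)
open import Data.Integer as ℤ using (ℤ; -[1+_])
import Data.Integer.Properties as ℤ
open import Data.Maybe using (just; is-just; map)
open import Data.Nat as ℕ using (ℕ; zero; suc)
import Data.Nat.DivMod as ℕ
import Data.Nat.Properties as ℕ
open import Data.Nat.Tactic.RingSolver using (solve-∀)
open import Data.Product using (Σ-syntax; ∃-syntax; _×_; _,_; proj₁; proj₂; map₂)
open import Data.Sum using (_⊎_; inj₁; inj₂; [_,_]′)
open import Data.Vec using (Vec; []; _∷_; lookup; allFin; replicate) renaming (map to mapᵛ)
open import Data.Vec.N-ary using (N-ary; _$ⁿ_)
open import Data.Vec.Properties using (lookup-map)
open import Data.Vec.Relation.Binary.Pointwise.Inductive as Pointwise using (Pointwise; []; _∷_)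
open import Function.Bundles using (Inverse; mk⇔; Equivalence)
open import Function.Definitions using (Injective)
open import Level using (_⊔_)
open import Relation.Binary.Core using (Rel)
open import Relation.Binary.Definitions using (Decidable; WeaklyDecidable)
open import Relation.Binary.PropositionalEquality as ≡ using (_≡_; _≢_)
import Relation.Binary.Reasoning.Setoid as SetoidReasoning
open import Relation.Binary.Structures using (IsDecEquivalence)
open import Relation.Nullary using (¬_; Dec; yes; no; contradiction; ¬?; _×-dec_)
open import Relation.Nullary.Decidable using (map′; dec⇒maybe)
open import Relation.Unary using (Pred; _∈_; _⊆_; _≐_)

-- Subgroups live over the closure, but every condition on them is brought down to 𝔽_q. A subgroup
-- of order 3 is described as a vertical line together with ∞; it depends only on an abscissa, so
-- rationality and uniqueness become statements about one root of ψ. The Frobenius map is controlled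
-- through (z + c)^q = z^q + c for c in 𝔽_q: with Y = y - s x + w, the square Y² lies in 𝔽_q, whence
-- Y^q = ± Y.
--
-- The count rests on the cubes having index exactly 3 among the units. The character bounds the
-- index from below, by separating the cosets of 1, b₀, b₀²; the three cube roots of unity bound it
-- from above. The same argument with t and ± 1 gives index 2 for the squares. Characteristics 2 and
-- 3 are excluded because squaring or cubing would be injective there, hence onto.
--
-- For f(X) = X³ + A X + B one has ψ = 12 X f - f′². At a root of ψ with f ≠ 0, the values of f and
-- f′ therefore determine X, then A and B. This is why a curve is matched with a model by
-- prescribing f(X₀) = l³β² and f′(X₀) = 6 l²αβ alone, and why isomorphisms can be read off from
-- these two values.

infixl 6 _:+_ _:-_
infixl 7 _:*_
infixr 8 _:·_ _:^_
infix  8 :-_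

-- Certified linear combinations of polynomial equations.

data Expr (n : ℕ) : Set where
  var       : Fin n → Expr n
  :0 :1     : Expr n
  _:+_ _:*_ : Expr n → Expr n → Expr n
  :-_       : Expr n → Expr n
  _:·_      : ℕ → Expr n → Expr n
  _:^_      : Expr n → ℕ → Expr n

_:-_ : ∀ {n} → Expr n → Expr n → Expr n
e :- e′ = e :+ :- e′

infix  5 _:=_
infix  4 _:×_
infix  3 ⊢_
infixr 3 _⊢_

data Equation (n : ℕ) : Set where
  _:=_ : Expr n → Expr n → Equation n

-- In c :× e := e′, the expression c is the cofactor of the hypothesis
-- e := e′: a sequent certifies that the difference of the two sides of its
-- conclusion is identically the sum of all c (e − e′).
data Hypothesis (n : ℕ) : Set where
  _:×_ : Expr n → Equation n → Hypothesis n

data Sequent (n : ℕ) : Set where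
  ⊢_  : Equation n → Sequent n
  _⊢_ : Hypothesis n → Sequent n → Sequent n

sequent : ∀ {n} → N-ary n (Expr n) (Sequent n) → Sequent n
sequent {n} f = f $ⁿ mapᵛ var (allFin n)

module LinearCombination {c ℓ} (R : CommutativeRing c ℓ) where
  open CommutativeRing R
  open Algebra.Definitions.RawSemiring (Semiring.rawSemiring semiring) using (_^_) renaming (_×_ to infixr 8 _·_)
  open Algebra.Properties.Semiring.Mult semiring
    using (×-homo-+; ×1-homo-*; ×-assoc-*; ×-cong; ×-homo-1)
  open Algebra.Properties.Semiring.Exp semiring using (^-congˡ)
  open Algebra.Properties.Group +-group
    using () renaming (⁻¹-involutive to -‿involutive; ε⁻¹≈ε to -0#≈0#;
                       x∙y⁻¹≈ε⇒x≈y to x-y≈0⇒x≈y; x≈y⇒x∙y⁻¹≈ε to x≈y⇒x-y≈0)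
  open Algebra.Properties.AbelianGroup +-abelianGroup
    using () renaming (⁻¹-∙-comm to -‿+-comm)
  open Algebra.Properties.Ring ring using (-‿distribˡ-*; -‿distribʳ-*)
  open SetoidReasoning setoid

  private
    fromℤ : ℤ → Carrier
    fromℤ (ℤ.+ n)  = n · 1#
    fromℤ -[1+ n ] = - (suc n · 1#)

    fromℤ-⊖ : ∀ m n → fromℤ (m ℤ.⊖ n) ≈ m · 1# - n · 1#
    fromℤ-⊖ m zero = sym (trans (+-congˡ -0#≈0#) (+-identityʳ _))
    fromℤ-⊖ zero (suc n) = sym (+-identityˡ _)
    fromℤ-⊖ (suc m) (suc n) = begin
      fromℤ (suc m ℤ.⊖ suc n)          ≡⟨ ≡.cong fromℤ (ℤ.[1+m]⊖[1+n]≡m⊖n m n) ⟩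
      fromℤ (m ℤ.⊖ n)                  ≈⟨ fromℤ-⊖ m n ⟩
      m · 1# - n · 1#                  ≈⟨ +-congˡ (+-identityˡ _) ⟨
      m · 1# + (0# - n · 1#)           ≈⟨ +-congˡ (+-congʳ (-‿inverseʳ 1#)) ⟨
      m · 1# + (1# - 1# - n · 1#)      ≈⟨ +-congˡ (+-assoc _ _ _) ⟩
      m · 1# + (1# + (- 1# - n · 1#))  ≈⟨ +-assoc _ _ _ ⟨
      m · 1# + 1# + (- 1# - n · 1#)    ≈⟨ +-cong (+-comm _ _) (-‿+-comm _ _) ⟩
      suc m · 1# - suc n · 1#          ∎

    fromℤ-+ : ∀ i j → fromℤ (i ℤ.+ j) ≈ fromℤ i + fromℤ j
    fromℤ-+ (ℤ.+ m)  (ℤ.+ n)  = ×-homo-+ 1# m n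
    fromℤ-+ (ℤ.+ m)  -[1+ n ] = fromℤ-⊖ m (suc n)
    fromℤ-+ -[1+ m ] (ℤ.+ n)  = trans (fromℤ-⊖ n (suc m)) (+-comm _ _)
    fromℤ-+ -[1+ m ] -[1+ n ] = begin
      - (suc (suc (m ℕ.+ n)) · 1#)   ≡⟨ ≡.cong (λ k → - (suc k · 1#)) (≡.sym (+-suc m n)) ⟩
      - ((suc m ℕ.+ suc n) · 1#)     ≈⟨ -‿cong (×-homo-+ 1# (suc m) (suc n)) ⟩
      - (suc m · 1# + suc n · 1#)    ≈⟨ -‿+-comm _ _ ⟨
      - (suc m · 1#) - (suc n · 1#)  ∎
      where open import Data.Nat.Properties using (+-suc)

    fromℤ-neg : ∀ i → fromℤ (ℤ.- i) ≈ - fromℤ i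
    fromℤ-neg (ℤ.+ zero)  = sym -0#≈0#
    fromℤ-neg (ℤ.+ suc n) = refl
    fromℤ-neg -[1+ n ]    = sym (-‿involutive _)

    fromℤ-*⁺ : ∀ m j → fromℤ (ℤ.+ m ℤ.* j) ≈ fromℤ (ℤ.+ m) * fromℤ j
    fromℤ-*⁺ m (ℤ.+ n) = trans (reflexive (≡.cong fromℤ (≡.sym (ℤ.pos-* m n)))) (×1-homo-* m n)
    fromℤ-*⁺ m -[1+ n ] = begin
      fromℤ (ℤ.+ m ℤ.* ℤ.- (ℤ.+ suc n))   ≡⟨ ≡.cong fromℤ (≡.sym (ℤ.neg-distribʳ-* (ℤ.+ m) (ℤ.+ suc n))) ⟩
      fromℤ (ℤ.- (ℤ.+ m ℤ.* (ℤ.+ suc n))) ≈⟨ fromℤ-neg (ℤ.+ m ℤ.* (ℤ.+ suc n)) ⟩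
      - fromℤ (ℤ.+ m ℤ.* (ℤ.+ suc n))     ≈⟨ -‿cong (fromℤ-*⁺ m (ℤ.+ suc n)) ⟩
      - ((m · 1#) * (suc n · 1#))         ≈⟨ -‿distribʳ-* _ _ ⟩
      (m · 1#) * - (suc n · 1#)           ∎

    fromℤ-* : ∀ i j → fromℤ (i ℤ.* j) ≈ fromℤ i * fromℤ j
    fromℤ-* (ℤ.+ m)  j = fromℤ-*⁺ m j
    fromℤ-* -[1+ m ] j = begin
      fromℤ (ℤ.- (ℤ.+ suc m) ℤ.* j)       ≡⟨ ≡.cong fromℤ (≡.sym (ℤ.neg-distribˡ-* (ℤ.+ suc m) j)) ⟩
      fromℤ (ℤ.- ((ℤ.+ suc m) ℤ.* j))     ≈⟨ fromℤ-neg ((ℤ.+ suc m) ℤ.* j) ⟩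
      - fromℤ ((ℤ.+ suc m) ℤ.* j)         ≈⟨ -‿cong (fromℤ-*⁺ (suc m) j) ⟩
      - ((suc m · 1#) * fromℤ j)          ≈⟨ -‿distribˡ-* _ _ ⟩
      - (suc m · 1#) * fromℤ j            ∎

    morphism : ℤ.+-*-rawRing -Raw-AlmostCommutative⟶ fromCommutativeRing R
    morphism = record
      { ⟦_⟧ = fromℤ ; +-homo = fromℤ-+ ; *-homo = fromℤ-* ; -‿homo = fromℤ-neg
      ; 0-homo = refl ; 1-homo = ×-homo-1 1# }

    -- Comparing integers only semi-decides equality in `R`: an accepted identity holds over ℤ,
    -- hence in every characteristic.
    _coefficient≟_ : WeaklyDecidable (Induced-equivalence morphism)
    i coefficient≟ j = map (λ eq → reflexive (≡.cong fromℤ eq)) (dec⇒maybe (i ℤ.≟ j))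

    module Horner = Algebra.Solver.Ring ℤ.+-*-rawRing (fromCommutativeRing R) morphism _coefficient≟_

  ⟦_⟧ : ∀ {n} → Expr n → Vec Carrier n → Carrier
  ⟦ var i   ⟧ ρ = lookup ρ i
  ⟦ :0      ⟧ ρ = 0#
  ⟦ :1      ⟧ ρ = 1#
  ⟦ e :+ e′ ⟧ ρ = ⟦ e ⟧ ρ + ⟦ e′ ⟧ ρ
  ⟦ e :* e′ ⟧ ρ = ⟦ e ⟧ ρ * ⟦ e′ ⟧ ρ
  ⟦ :- e    ⟧ ρ = - ⟦ e ⟧ ρ
  ⟦ k :· e  ⟧ ρ = k · ⟦ e ⟧ ρ
  ⟦ e :^ k  ⟧ ρ = ⟦ e ⟧ ρ ^ k

  private
    toHorner : ∀ {n} → Expr n → Horner.Polynomial n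
    toHorner (var i)   = Horner.var i
    toHorner :0        = Horner.con (ℤ.+ 0)
    toHorner :1        = Horner.con (ℤ.+ 1)
    toHorner (e :+ e′) = toHorner e Horner.:+ toHorner e′
    toHorner (e :* e′) = toHorner e Horner.:* toHorner e′
    toHorner (:- e)    = Horner.:- toHorner e
    toHorner (k :· e)  = Horner.con (ℤ.+ k) Horner.:* toHorner e
    toHorner (e :^ k)  = toHorner e Horner.:^ k

    toHorner-correct : ∀ {n} (e : Expr n) ρ → Horner.⟦ toHorner e ⟧ ρ ≈ ⟦ e ⟧ ρ
    toHorner-correct (var i)   ρ = refl
    toHorner-correct :0        ρ = refl
    toHorner-correct :1        ρ = ×-homo-1 1#
    toHorner-correct (e :+ e′) ρ = +-cong (toHorner-correct e ρ) (toHorner-correct e′ ρ)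
    toHorner-correct (e :* e′) ρ = *-cong (toHorner-correct e ρ) (toHorner-correct e′ ρ)
    toHorner-correct (:- e)    ρ = -‿cong (toHorner-correct e ρ)
    toHorner-correct (k :· e)  ρ =
      trans (×-assoc-* k 1# _) (×-cong {k} ≡.refl (trans (*-identityˡ _) (toHorner-correct e ρ)))
    toHorner-correct (e :^ k)  ρ = ^-congˡ k (toHorner-correct e ρ)

  private
    Holds : ∀ {n} → Vec Carrier n → Equation n → Set ℓ
    Holds ρ (e := e′) = ⟦ e ⟧ ρ ≈ ⟦ e′ ⟧ ρ

    Entailment : ∀ {n} → Vec Carrier n → Sequent n → Set ℓ
    Entailment ρ (⊢ eq)            = Holds ρ eq
    Entailment ρ ((_ :× eq) ⊢ seq) = Holds ρ eq → Entailment ρ seq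

    -- `d` accumulates the combination of the hypotheses read so far; a certificate is valid when
    -- what is left of the conclusion is identically zero.
    residue : ∀ {n} → Expr n → Sequent n → Expr n
    residue d (⊢ (e := e′))               = (e :- e′) :- d
    residue d ((k :× (e := e′)) ⊢ seq) = residue (d :+ k :* (e :- e′)) seq

    isZero : ∀ {n} (e : Expr n) → _
    isZero e = Horner.normalise (toHorner e) Horner.≟N Horner.0N

    isZero-sound : ∀ {n} (e : Expr n) → T (is-just (isZero e)) → ∀ ρ → ⟦ e ⟧ ρ ≈ 0#
    isZero-sound e ok ρ with isZero e
    ... | just e≈0 = begin
      ⟦ e ⟧ ρ                                         ≈⟨ toHorner-correct e ρ ⟨
      Horner.⟦ toHorner e ⟧ ρ                         ≈⟨ Horner.correct (toHorner e) ρ ⟨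
      Horner.⟦ Horner.normalise (toHorner e) ⟧N ρ     ≈⟨ Horner.⟦ e≈0 ⟧N-cong ρ ⟩
      Horner.⟦ Horner.0N ⟧N ρ                         ≈⟨ Horner.0N-homo ρ ⟩
      0#                                              ∎

    entail : ∀ {n} ρ (d : Expr n) (seq : Sequent n) → ⟦ d ⟧ ρ ≈ 0# →
             ⟦ residue d seq ⟧ ρ ≈ 0# → Entailment ρ seq
    entail ρ d (⊢ (e := e′)) d≈0 r≈0 =
      x-y≈0⇒x≈y _ _ (trans (x-y≈0⇒x≈y _ _ r≈0) d≈0)
    entail ρ d ((k :× (e := e′)) ⊢ seq) d≈0 r≈0 e≈e′ = entail ρ _ seq
      (trans (+-cong d≈0 (trans (*-congˡ (x≈y⇒x-y≈0 e≈e′)) (zeroʳ _))) (+-identityˡ 0#)) r≈0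

  abstract
    -- The implicit argument is a closed proposition that computes to the trivial one when the
    -- residue has normal form zero. The certificate is thus checked by computation, and only proofs
    -- of the hypotheses remain to be supplied.
    lincomb : ∀ {n} (ρ : Vec Carrier n) (f : N-ary n (Expr n) (Sequent n)) →
              {_ : T (is-just (isZero (residue :0 (sequent f))))} →
              Entailment ρ (sequent f)
    lincomb ρ f {ok} = entail ρ :0 (sequent f) refl (isZero-sound (residue :0 (sequent f)) ok ρ)

  ⟦_⟧-cong : ∀ {n} (e : Expr n) {ρ σ : Vec Carrier n} → Pointwise _≈_ ρ σ → ⟦ e ⟧ ρ ≈ ⟦ e ⟧ σ
  ⟦ var i   ⟧-cong ρ≈σ = Pointwise.lookup ρ≈σ i
  ⟦ :0      ⟧-cong ρ≈σ = refl
  ⟦ :1      ⟧-cong ρ≈σ = refl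
  ⟦ e :+ e′ ⟧-cong ρ≈σ = +-cong (⟦ e ⟧-cong ρ≈σ) (⟦ e′ ⟧-cong ρ≈σ)
  ⟦ e :* e′ ⟧-cong ρ≈σ = *-cong (⟦ e ⟧-cong ρ≈σ) (⟦ e′ ⟧-cong ρ≈σ)
  ⟦ :- e    ⟧-cong ρ≈σ = -‿cong (⟦ e ⟧-cong ρ≈σ)
  ⟦ k :· e  ⟧-cong ρ≈σ = ×-cong {k} ≡.refl (⟦ e ⟧-cong ρ≈σ)
  ⟦ e :^ k  ⟧-cong ρ≈σ = ^-congˡ k (⟦ e ⟧-cong ρ≈σ)

-- Polynomial expressions under ring homomorphisms.

module Homomorphism {c ℓ c′ ℓ′} (R : CommutativeRing c ℓ) (S : CommutativeRing c′ ℓ′)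
  {f : CommutativeRing.Carrier R → CommutativeRing.Carrier S}
  (isHom : IsRingHomomorphism (CommutativeRing.rawRing R) (CommutativeRing.rawRing S) f) where
  private
    module R = CommutativeRing R
    module S = CommutativeRing S
    module LR = LinearCombination R
    module LS = LinearCombination S
  open Algebra.Definitions.RawSemiring (Semiring.rawSemiring R.semiring) using () renaming (_×_ to _·ᴿ_; _^_ to _^ᴿ_)
  open Algebra.Definitions.RawSemiring (Semiring.rawSemiring S.semiring) using () renaming (_×_ to _·ˢ_; _^_ to _^ˢ_)
  open IsRingHomomorphism isHom

  ·-homo : ∀ k x → f (k ·ᴿ x) S.≈ k ·ˢ f x
  ·-homo zero    x = 0#-homo
  ·-homo (suc k) x = S.trans (+-homo x _) (S.+-congˡ (·-homo k x))

  ^-homo : ∀ x k → f (x ^ᴿ k) S.≈ f x ^ˢ k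
  ^-homo x zero    = 1#-homo
  ^-homo x (suc k) = S.trans (*-homo x _) (S.*-congˡ (^-homo x k))

  ⟦_⟧-homo : ∀ {n} (e : Expr n) ρ → f (LR.⟦ e ⟧ ρ) S.≈ LS.⟦ e ⟧ (mapᵛ f ρ)
  ⟦ var i   ⟧-homo ρ = S.reflexive (≡.sym (lookup-map i f ρ))
  ⟦ :0      ⟧-homo ρ = 0#-homo
  ⟦ :1      ⟧-homo ρ = 1#-homo
  ⟦ e :+ e′ ⟧-homo ρ = S.trans (+-homo _ _) (S.+-cong (⟦ e ⟧-homo ρ) (⟦ e′ ⟧-homo ρ))
  ⟦ e :* e′ ⟧-homo ρ = S.trans (*-homo _ _) (S.*-cong (⟦ e ⟧-homo ρ) (⟦ e′ ⟧-homo ρ))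
  ⟦ :- e    ⟧-homo ρ = S.trans (-‿homo _) (S.-‿cong (⟦ e ⟧-homo ρ))
  ⟦ k :· e  ⟧-homo ρ = S.trans (·-homo k _) (×-cong {k} ≡.refl (⟦ e ⟧-homo ρ))
    where open Algebra.Properties.Semiring.Mult S.semiring using (×-cong)
  ⟦ e :^ k  ⟧-homo ρ = S.trans (^-homo _ k) (^-congˡ k (⟦ e ⟧-homo ρ))
    where open Algebra.Properties.Semiring.Exp S.semiring using (^-congˡ)

-- Arithmetic in discrete fields.

module FieldProperties {c ℓ₁ ℓ₂} (F : Field c ℓ₁ ℓ₂) where
  open Field F
  open HeytingField heytingField using (tight; #-irrefl)
  open HeytingProperties heytingCommutativeRing using (1#0)
  open LinearCombination commutativeRing public

  infix 4 _≈?_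

  #⇒≉ : ∀ {x y} → x # y → x ≉ y
  #⇒≉ x#y x≈y = #-irrefl x≈y x#y

  _≈?_ : Decidable _≈_
  x ≈? y with x #? y
  ... | yes x#y = no (#⇒≉ x#y)
  ... | no ¬x#y = yes (proj₁ (tight x y) ¬x#y)

  ≉⇒# : ∀ {x y} → x ≉ y → x # y
  ≉⇒# {x} {y} x≉y with x #? y
  ... | yes x#y = x#y
  ... | no ¬x#y = contradiction (proj₁ (tight x y) ¬x#y) x≉y

  1≉0 : 1# ≉ 0#
  1≉0 = #⇒≉ 1#0

  ⁻¹-inverseʳ : ∀ {x} → x ≉ 0# → x * x ⁻¹ ≈ 1#
  ⁻¹-inverseʳ {x} x≉0 with x #? 0#
  ... | no ¬x#0 = contradiction (≉⇒# x≉0) ¬x#0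
  ... | yes x#0 with #⇒invertible x#0
  -- Invertibility is stated for the difference of two apart elements, hence for `x - 0#` instead of
  -- `x`.
  ...   | y , _ , [x-0]y≈1 = lincomb (x ∷ y ∷ [])
    (λ x y → :1 :× (x :- :0) :* y := :1 ⊢ ⊢ x :* y := :1) [x-0]y≈1

  *-zero-divisor : ∀ {x y} → x * y ≈ 0# → x ≉ 0# → y ≈ 0#
  *-zero-divisor {x} {y} xy≈0 x≉0 = lincomb (x ∷ y ∷ x ⁻¹ ∷ [])
    (λ x y x⁻¹ → x⁻¹ :× x :* y := :0 ⊢ :- y :× x :* x⁻¹ := :1 ⊢ ⊢ y := :0)
    xy≈0 (⁻¹-inverseʳ x≉0)

  *-zero⇒ : ∀ {x y} → x * y ≈ 0# → x ≈ 0# ⊎ y ≈ 0#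
  *-zero⇒ {x} {y} xy≈0 with x ≈? 0#
  ... | yes x≈0 = inj₁ x≈0
  ... | no  x≉0 = inj₂ (*-zero-divisor xy≈0 x≉0)

  square-zero⇒ : ∀ {x} → x * x ≈ 0# → x ≈ 0#
  square-zero⇒ {x} xx≈0 with x ≈? 0#
  ... | yes x≈0 = x≈0
  ... | no  x≉0 = *-zero-divisor xx≈0 x≉0

  *-nonzero : ∀ {x y} → x ≉ 0# → y ≉ 0# → x * y ≉ 0#
  *-nonzero x≉0 y≉0 xy≈0 = y≉0 (*-zero-divisor xy≈0 x≉0)

  ^-nonzero : ∀ {x} n → x ≉ 0# → x ^ n ≉ 0#
  ^-nonzero zero    x≉0 = 1≉0
  ^-nonzero (suc n) x≉0 = *-nonzero x≉0 (^-nonzero n x≉0)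

  ⁻¹-nonzero : ∀ {x} → x ≉ 0# → x ⁻¹ ≉ 0#
  ⁻¹-nonzero {x} x≉0 x⁻¹≈0 = 1≉0 (trans (sym (⁻¹-inverseʳ x≉0)) (trans (*-congˡ x⁻¹≈0) (zeroʳ x)))

  *-cancelˡ-nonzero : ∀ {k x y} → k ≉ 0# → k * x ≈ k * y → x ≈ y
  *-cancelˡ-nonzero {k} {x} {y} k≉0 kx≈ky = lincomb (k ∷ x ∷ y ∷ k ⁻¹ ∷ [])
    (λ k x y k⁻¹ → k⁻¹ :× k :* x := k :* y ⊢ y :- x :× k :* k⁻¹ := :1 ⊢ ⊢ x := y)
    kx≈ky (⁻¹-inverseʳ k≉0)

  ≈-by-* : ∀ {k x y} → k ≉ 0# → k * (x - y) ≈ 0# → x ≈ y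
  ≈-by-* {k} {x} {y} k≉0 eq = lincomb (x ∷ y ∷ [])
    (λ x y → :1 :× x :- y := :0 ⊢ ⊢ x := y) (*-zero-divisor eq k≉0)

  square-≈ : ∀ {x y} → x ^ 2 ≈ y ^ 2 → x ≈ y ⊎ x ≈ - y
  square-≈ {x} {y} x²≈y² with *-zero⇒ {x - y} {x + y}
    (lincomb (x ∷ y ∷ []) (λ x y → :1 :× x :^ 2 := y :^ 2 ⊢ ⊢ (x :- y) :* (x :+ y) := :0) x²≈y²)
  ... | inj₁ x-y≈0 = inj₁ (lincomb (x ∷ y ∷ []) (λ x y → :1 :× x :- y := :0 ⊢ ⊢ x := y) x-y≈0)
  ... | inj₂ x+y≈0 = inj₂ (lincomb (x ∷ y ∷ []) (λ x y → :1 :× x :+ y := :0 ⊢ ⊢ x := :- y) x+y≈0)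

-- If `j` were missed, punching it out of the codomain would leave an injection into a set with
-- fewer than `m` elements.
injective⇒surjective : ∀ {m n} {f : Fin m → Fin n} → n ℕ.≤ m → Injective _≡_ _≡_ f → ∀ j → ∃[ i ] f i ≡ j
injective⇒surjective {m} {suc n} {f} n<m inj j with any? (λ i → f i Fin.≟ j)
... | yes hit  = hit
... | no  miss = contradiction
  (ℕ.≤-trans n<m (injective⇒≤ (λ eq → inj (punchOut-injective (avoids _) (avoids _) eq)))) ℕ.1+n≰n
  where
  avoids : ∀ i → j ≢ f i
  avoids i j≡fi = miss (i , ≡.sym j≡fi)

-- Short Weierstrass forms and points of order 3.

module _ {n : ℕ} where
  :cubic :cubic′ :division₃ : (A B X : Expr n) → Expr n
  :cubic     A B X = X :^ 3 :+ A :* X :+ B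
  :cubic′    A B X = 3 :· X :^ 2 :+ A
  :division₃ A B X = 3 :· X :^ 4 :+ 6 :· (A :* X :^ 2) :+ 12 :· (B :* X) :- A :^ 2

  -- The coefficients obtained by expanding (y - s x + w)² = (x - r)³ + A (x - r) + B.
  :a₁ :a₂ :a₃ :a₄ :a₆ : (s r w A B : Expr n) → Expr n
  :a₁ s r w A B = :- (2 :· s)
  :a₂ s r w A B = :- (3 :· r :+ s :^ 2)
  :a₃ s r w A B = 2 :· w
  :a₄ s r w A B = A :+ 3 :· r :^ 2 :+ 2 :· (s :* w)
  :a₆ s r w A B = B :- r :* A :- r :^ 3 :- w :^ 2

module Curves {c ℓ₁ ℓ₂} (F : Field c ℓ₁ ℓ₂) where
  open Field F hiding (zero)
  open FieldProperties F

  cubic division₃ : (A B X : Carrier) → Carrier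
  cubic     A B X = X ^ 3 + A * X + B
  division₃ A B X = 3 · X ^ 4 + 6 · (A * X ^ 2) + 12 · (B * X) - A ^ 2

  -- In the coordinates X = x − r and Y = y − s x + w, the equation becomes
  -- Y² = X³ + A X + B.
  record ShortForm (W : Weierstrass Carrier) : Set (c ⊔ ℓ₁) where
    open Weierstrass W
    field
      s r w A B : Carrier
      a₁≈ : a₁ ≈ - (2 · s)
      a₂≈ : a₂ ≈ - (3 · r + s ^ 2)
      a₃≈ : a₃ ≈ 2 · w
      a₄≈ : a₄ ≈ A + 3 · r ^ 2 + 2 · (s * w)
      a₆≈ : a₆ ≈ B - r * A - r ^ 3 - w ^ 2

  -- A double root X forces A = -3X² and B = 2X³, and then 4A³ and 27B² cancel.
  double-root-singular : ∀ {A B X} → cubic A B X ≈ 0# → 3 · X ^ 2 + A ≈ 0# →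
                         4 · A ^ 3 + 27 · B ^ 2 ≈ 0#
  double-root-singular {A} {B} {X} f≈0 f′≈0 = lincomb (A ∷ B ∷ X ∷ []) (λ A B X →
      4 :· (A :^ 2 :- 3 :· (A :* X :^ 2) :+ 9 :· X :^ 4) :× A := :- (3 :· X :^ 2) ⊢
      27 :· (B :+ 2 :· X :^ 3) :× B := 2 :· X :^ 3 ⊢
      ⊢ 4 :· A :^ 3 :+ 27 :· B :^ 2 := :0)
    (lincomb (A ∷ X ∷ []) (λ A X → :1 :× 3 :· X :^ 2 :+ A := :0 ⊢ ⊢ A := :- (3 :· X :^ 2)) f′≈0)
    (lincomb (A ∷ B ∷ X ∷ []) (λ A B X →
      :1 :× :cubic A B X := :0 ⊢ :- X :× 3 :· X :^ 2 :+ A := :0 ⊢ ⊢ B := 2 :· X :^ 3) f≈0 f′≈0)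

  module ShortFormCurve {W : Weierstrass Carrier} (S : ShortForm W)
    (2≉0 : 2 · 1# ≉ 0#) (nonsingular : 4 · ShortForm.A S ^ 3 + 27 · ShortForm.B S ^ 2 ≉ 0#) where
    open Weierstrass W
    open ShortForm S
    open Points F W

    infix 4 _≋?_

    ≋-refl : ∀ {P} → P ≋ P
    ≋-refl {∞}       = ∞
    ≋-refl {aff x y} = aff refl refl

    ≋-sym : ∀ {P Q} → P ≋ Q → Q ≋ P
    ≋-sym ∞         = ∞
    ≋-sym (aff p q) = aff (sym p) (sym q)

    ≋-trans : ∀ {P Q R} → P ≋ Q → Q ≋ R → P ≋ R
    ≋-trans ∞         ∞           = ∞
    ≋-trans (aff p q) (aff p′ q′) = aff (trans p p′) (trans q q′)

    _≋?_ : Decidable _≋_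
    ∞       ≋? ∞         = yes ∞
    ∞       ≋? aff x y   = no λ ()
    aff x y ≋? ∞         = no λ ()
    aff x y ≋? aff x′ y′ = map′ (λ (p , q) → aff p q) (λ { (aff p q) → p , q }) (x ≈? x′ ×-dec y ≈? y′)

    X : Carrier → Carrier
    X x = x - r

    Y : Carrier → Carrier → Carrier
    Y x y = y - s * x + w

    f ψ : Carrier → Carrier
    f = cubic A B
    ψ = division₃ A B

    X-cong : ∀ {x x′} → x ≈ x′ → X x ≈ X x′
    X-cong = +-congʳ

    Y-cong : ∀ {x x′ y y′} → x ≈ x′ → y ≈ y′ → Y x y ≈ Y x′ y′
    Y-cong x≈ y≈ = +-congʳ (+-cong y≈ (-‿cong (*-congˡ x≈)))

    f-cong : ∀ {X X′} → X ≈ X′ → f X ≈ f X′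
    f-cong X≈ = ⟦ :cubic (var zero) (var (suc zero)) (var (suc (suc zero))) ⟧-cong
      {A ∷ B ∷ _ ∷ []} {A ∷ B ∷ _ ∷ []} (refl ∷ refl ∷ X≈ ∷ [])

    ψ-cong : ∀ {X X′} → X ≈ X′ → ψ X ≈ ψ X′
    ψ-cong X≈ = ⟦ :division₃ (var zero) (var (suc zero)) (var (suc (suc zero))) ⟧-cong
      {A ∷ B ∷ _ ∷ []} {A ∷ B ∷ _ ∷ []} (refl ∷ refl ∷ X≈ ∷ [])

    onCurve⇒ : ∀ {x y} → OnCurve (aff x y) → Y x y ^ 2 ≈ f (X x)
    onCurve⇒ {x} {y} (aff eq) = lincomb
      (x ∷ y ∷ s ∷ r ∷ w ∷ A ∷ B ∷ a₁ ∷ a₂ ∷ a₃ ∷ a₄ ∷ a₆ ∷ [])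
      (λ x y s r w A B a₁ a₂ a₃ a₄ a₆ →
        :1 :× y :^ 2 :+ a₁ :* x :* y :+ a₃ :* y := x :^ 3 :+ a₂ :* x :^ 2 :+ a₄ :* x :+ a₆ ⊢
        :- (x :* y) :× a₁ := :a₁ s r w A B ⊢
        x :^ 2      :× a₂ := :a₂ s r w A B ⊢
        :- y        :× a₃ := :a₃ s r w A B ⊢
        x           :× a₄ := :a₄ s r w A B ⊢
        :1          :× a₆ := :a₆ s r w A B ⊢
        ⊢ (y :- s :* x :+ w) :^ 2 := :cubic A B (x :- r))
      eq a₁≈ a₂≈ a₃≈ a₄≈ a₆≈

    onCurve⇐ : ∀ {x y} → Y x y ^ 2 ≈ f (X x) → OnCurve (aff x y)
    onCurve⇐ {x} {y} eq = aff (lincomb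
      (x ∷ y ∷ s ∷ r ∷ w ∷ A ∷ B ∷ a₁ ∷ a₂ ∷ a₃ ∷ a₄ ∷ a₆ ∷ [])
      (λ x y s r w A B a₁ a₂ a₃ a₄ a₆ →
        :1 :× (y :- s :* x :+ w) :^ 2 := :cubic A B (x :- r) ⊢
        x :* y      :× a₁ := :a₁ s r w A B ⊢
        :- (x :^ 2) :× a₂ := :a₂ s r w A B ⊢
        y           :× a₃ := :a₃ s r w A B ⊢
        :- x        :× a₄ := :a₄ s r w A B ⊢
        :- :1       :× a₆ := :a₆ s r w A B ⊢
        ⊢ y :^ 2 :+ a₁ :* x :* y :+ a₃ :* y := x :^ 3 :+ a₂ :* x :^ 2 :+ a₄ :* x :+ a₆)
      eq a₁≈ a₂≈ a₃≈ a₄≈ a₆≈)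

    onCurve-resp : ∀ {x y x′ y′} → x ≈ x′ → y ≈ y′ → OnCurve (aff x y) → OnCurve (aff x′ y′)
    onCurve-resp x≈ y≈ on = onCurve⇐ (trans (^-congˡ 2 (sym (Y-cong x≈ y≈)))
      (trans (onCurve⇒ on) (f-cong (X-cong x≈))))
      where open import Algebra.Properties.Semiring.Exp semiring using (^-congˡ)

    neg : Carrier → Carrier → Carrier
    neg x y = - y - a₁ * x - a₃

    Y-neg : ∀ {x y} → Y x (neg x y) ≈ - Y x y
    Y-neg {x} {y} = lincomb (x ∷ y ∷ s ∷ r ∷ w ∷ A ∷ B ∷ a₁ ∷ a₃ ∷ []) (λ x y s r w A B a₁ a₃ →
      :- x  :× a₁ := :a₁ s r w A B ⊢
      :- :1 :× a₃ := :a₃ s r w A B ⊢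
      ⊢ (:- y :- a₁ :* x :- a₃) :- s :* x :+ w := :- (y :- s :* x :+ w)) a₁≈ a₃≈

    Y≈⇒y≈ : ∀ {x x′ y y′} → x ≈ x′ → Y x y ≈ Y x′ y′ → y ≈ y′
    Y≈⇒y≈ {x} {x′} {y} {y′} x≈ Y≈ = lincomb (x ∷ x′ ∷ y ∷ y′ ∷ s ∷ w ∷ []) (λ x x′ y y′ s w →
      s :× x := x′ ⊢ :1 :× y :- s :* x :+ w := y′ :- s :* x′ :+ w ⊢ ⊢ y := y′) x≈ Y≈

    onCurve-neg : ∀ {x y} → OnCurve (aff x y) → OnCurve (aff x (neg x y))
    onCurve-neg {x} {y} on = onCurve⇐ (lincomb (Y x (neg x y) ∷ Y x y ∷ f (X x) ∷ []) (λ Y′ Y f →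
      Y′ :- Y :× Y′ := :- Y ⊢ :1 :× Y :^ 2 := f ⊢ ⊢ Y′ :^ 2 := f) Y-neg (onCurve⇒ on))

    -- Equal abscissas give equal values of Y², so the values of Y agree up to sign.
    same-x : ∀ {x y x′ y′} → OnCurve (aff x y) → OnCurve (aff x′ y′) → x ≈ x′ →
             aff x y ≋ aff x′ y′ ⊎ aff x (neg x y) ≋ aff x′ y′
    same-x on on′ x≈ with square-≈ (trans (onCurve⇒ on′) (trans (f-cong (X-cong (sym x≈))) (sym (onCurve⇒ on))))
    ... | inj₁ Y′≈Y  = inj₁ (aff x≈ (sym (Y≈⇒y≈ (sym x≈) Y′≈Y)))
    ... | inj₂ Y′≈-Y = inj₂ (aff x≈ (sym (Y≈⇒y≈ (sym x≈) (trans Y′≈-Y (sym Y-neg)))))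

    sum≈ : ∀ {x₁ y₁ x₂ y₂} → x₁ ≈ x₂ → y₁ + y₂ + a₁ * x₂ + a₃ ≈ Y x₁ y₁ + Y x₂ y₂
    sum≈ {x₁} {y₁} {x₂} {y₂} x≈ = lincomb (x₁ ∷ y₁ ∷ x₂ ∷ y₂ ∷ s ∷ r ∷ w ∷ A ∷ B ∷ a₁ ∷ a₃ ∷ [])
      (λ x₁ y₁ x₂ y₂ s r w A B a₁ a₃ →
        x₂ :× a₁ := :a₁ s r w A B ⊢ :1 :× a₃ := :a₃ s r w A B ⊢ s :× x₁ := x₂ ⊢
        ⊢ y₁ :+ y₂ :+ a₁ :* x₂ :+ a₃ := (y₁ :- s :* x₁ :+ w) :+ (y₂ :- s :* x₂ :+ w)) a₁≈ a₃≈ x≈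

    D≈2Y : ∀ {x y} → 2 · y + a₁ * x + a₃ ≈ 2 · Y x y
    D≈2Y {x} {y} = lincomb (x ∷ y ∷ s ∷ r ∷ w ∷ A ∷ B ∷ a₁ ∷ a₃ ∷ [])
      (λ x y s r w A B a₁ a₃ →
        x :× a₁ := :a₁ s r w A B ⊢ :1 :× a₃ := :a₃ s r w A B ⊢
        ⊢ 2 :· y :+ a₁ :* x :+ a₃ := 2 :· (y :- s :* x :+ w)) a₁≈ a₃≈

    2Y≉0 : ∀ {Z} → Z ≉ 0# → 2 · Z ≉ 0#
    2Y≉0 {Z} Z≉0 eq = *-nonzero 2≉0 Z≉0 (lincomb (Z ∷ []) (λ Z → :1 :× 2 :· Z := :0 ⊢ ⊢ (2 :· :1) :* Z := :0) eq)

    tangent : Carrier → Carrier → Carrier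
    tangent x y = (3 · x ^ 2 + 2 · (a₂ * x) + a₄ - a₁ * y) / (2 · y + a₁ * x + a₃)

    x₃ : Carrier → Carrier → Carrier → Carrier
    x₃ m x₁ x₂ = m ^ 2 + a₁ * m - a₂ - x₁ - x₂

    -- A line of slope `m` has slope `m - s` in the coordinates (X , Y), where the addition formula
    -- takes its short form.
    X-x₃ : ∀ {m x₁ x₂} → X (x₃ m x₁ x₂) ≈ (m - s) ^ 2 - X x₁ - X x₂
    X-x₃ {m} {x₁} {x₂} = lincomb (m ∷ x₁ ∷ x₂ ∷ s ∷ r ∷ w ∷ A ∷ B ∷ a₁ ∷ a₂ ∷ [])
      (λ m x₁ x₂ s r w A B a₁ a₂ → m :× a₁ := :a₁ s r w A B ⊢ :- :1 :× a₂ := :a₂ s r w A B ⊢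
        ⊢ (m :^ 2 :+ a₁ :* m :- a₂ :- x₁ :- x₂) :- r := (m :- s) :^ 2 :- (x₁ :- r) :- (x₂ :- r)) a₁≈ a₂≈

    X≈⇒x≈ : ∀ {x x′} → X x ≈ X x′ → x ≈ x′
    X≈⇒x≈ {x} {x′} eq = lincomb (x ∷ x′ ∷ r ∷ []) (λ x x′ r → :1 :× x :- r := x′ :- r ⊢ ⊢ x := x′) eq

    tangent-slope : ∀ {x y} → Y x y ≉ 0# → 2 · (Y x y * (tangent x y - s)) ≈ 3 · X x ^ 2 + A
    tangent-slope {x} {y} Y≉0 = lincomb
      (x ∷ y ∷ tangent x y ∷ s ∷ r ∷ w ∷ A ∷ B ∷ a₁ ∷ a₂ ∷ a₃ ∷ a₄ ∷ [])
      (λ x y m s r w A B a₁ a₂ a₃ a₄ →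
        :1 :× (2 :· y :+ a₁ :* x :+ a₃) :* m := 3 :· x :^ 2 :+ 2 :· (a₂ :* x) :+ a₄ :- a₁ :* y ⊢
        :- (x :* m :+ y) :× a₁ := :a₁ s r w A B ⊢
        2 :· x           :× a₂ := :a₂ s r w A B ⊢
        :- m             :× a₃ := :a₃ s r w A B ⊢
        :1               :× a₄ := :a₄ s r w A B ⊢
        ⊢ 2 :· ((y :- s :* x :+ w) :* (m :- s)) := 3 :· (x :- r) :^ 2 :+ A)
      (lincomb (N ∷ D ∷ D ⁻¹ ∷ []) (λ N D D⁻¹ → N :× D :* D⁻¹ := :1 ⊢ ⊢ D :* (N :* D⁻¹) := N)
        (⁻¹-inverseʳ (λ D≈0 → 2Y≉0 Y≉0 (trans (sym D≈2Y) D≈0))))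
      a₁≈ a₂≈ a₃≈ a₄≈
      where
      N = 3 · x ^ 2 + 2 · (a₂ * x) + a₄ - a₁ * y
      D = 2 · y + a₁ * x + a₃

    -- M is the slope of the tangent at (X , Y), and (3X² + A)² − 12X f(X)
    -- equals − ψ(X).
    tripling : ∀ {X Y M} → Y ^ 2 ≈ f X → 2 · (Y * M) ≈ 3 · X ^ 2 + A →
               4 · Y ^ 2 * (M ^ 2 - 3 · X) ≈ - ψ X
    tripling {X} {Y} {M} on slope = lincomb (X ∷ Y ∷ M ∷ A ∷ B ∷ []) (λ X Y M A B →
      :- (12 :· X) :× Y :^ 2 := :cubic A B X ⊢
      2 :· (Y :* M) :+ (3 :· X :^ 2 :+ A) :× 2 :· (Y :* M) := 3 :· X :^ 2 :+ A ⊢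
      ⊢ 4 :· Y :^ 2 :* (M :^ 2 :- 3 :· X) := :- :division₃ A B X) on slope

    4Y²≉0 : ∀ {Z} → Z ≉ 0# → 4 · Z ^ 2 ≉ 0#
    4Y²≉0 {Z} Z≉0 eq = *-nonzero (2Y≉0 Z≉0) (2Y≉0 Z≉0)
      (lincomb (Z ∷ []) (λ Z → :1 :× 4 :· Z :^ 2 := :0 ⊢ ⊢ (2 :· Z) :* (2 :· Z) := :0) eq)

    -- In `tripling`, the factor M² - 3X is the difference between the abscissas of 2P and P. Hence
    -- 2P = ± P in abscissa exactly when ψ vanishes; this is one direction and `ψ⇒x₃-tangent` the
    -- other.
    x₃-tangent⇒ψ : ∀ {x y} → OnCurve (aff x y) → Y x y ≉ 0# →
                   x₃ (tangent x y) x x ≈ x → ψ (X x) ≈ 0#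
    x₃-tangent⇒ψ {x} {y} on Y≉0 x₃≈x = lincomb
      (X x ∷ Y x y ∷ tangent x y - s ∷ X (x₃ (tangent x y) x x) ∷ ψ (X x) ∷ [])
      (λ X Y M X₃ ψ →
        :1 :× 4 :· Y :^ 2 :* (M :^ 2 :- 3 :· X) := :- ψ ⊢
        4 :· Y :^ 2 :× X₃ := M :^ 2 :- X :- X ⊢
        :- (4 :· Y :^ 2) :× X₃ := X ⊢
        ⊢ ψ := :0)
      (tripling (onCurve⇒ on) (tangent-slope Y≉0)) X-x₃ (X-cong x₃≈x)

    -- The separate `x′` is there because `_⊕_` enters the abscissas of both summands into its
    -- formula, and these are only equivalent.
    ψ⇒x₃-tangent : ∀ {x y x′} → OnCurve (aff x y) → Y x y ≉ 0# → x ≈ x′ →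
                   ψ (X x) ≈ 0# → x₃ (tangent x y) x x′ ≈ x
    ψ⇒x₃-tangent {x} {y} {x′} on Y≉0 x≈x′ ψ≈0 = X≈⇒x≈ (≈-by-* (4Y²≉0 Y≉0) (lincomb
      (X x ∷ X x′ ∷ Y x y ∷ tangent x y - s ∷ X (x₃ (tangent x y) x x′) ∷ ψ (X x) ∷ [])
      (λ X X′ Y M X₃ ψ →
        :1 :× 4 :· Y :^ 2 :* (M :^ 2 :- 3 :· X) := :- ψ ⊢
        4 :· Y :^ 2 :× X₃ := M :^ 2 :- X :- X′ ⊢
        :- :1 :× ψ := :0 ⊢
        4 :· Y :^ 2 :× X := X′ ⊢
        ⊢ 4 :· Y :^ 2 :* (X₃ :- X) := :0)
      (tripling (onCurve⇒ on) (tangent-slope Y≉0)) X-x₃ ψ≈0 (X-cong x≈x′)))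

    -- At a common zero of f and ψ the square of f′ vanishes as well, which makes it a double root
    -- of f.
    ψ-root-not-2-torsion : ∀ {x y} → OnCurve (aff x y) → ψ (X x) ≈ 0# → Y x y ≉ 0#
    ψ-root-not-2-torsion {x} {y} on ψ≈0 Y≈0 = nonsingular (double-root-singular f≈0 f′≈0)
      where
      f≈0 : f (X x) ≈ 0#
      f≈0 = lincomb (Y x y ∷ f (X x) ∷ []) (λ Y f → :- :1 :× Y :^ 2 := f ⊢ Y :× Y := :0 ⊢ ⊢ f := :0)
        (onCurve⇒ on) Y≈0
      f′²≈0 : (3 · X x ^ 2 + A) * (3 · X x ^ 2 + A) ≈ 0#
      f′²≈0 = lincomb (X x ∷ A ∷ B ∷ []) (λ X A B →
        12 :· X :× :cubic A B X := :0 ⊢ :- :1 :× :division₃ A B X := :0 ⊢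
        ⊢ :cubic′ A B X :* :cubic′ A B X := :0) f≈0 ψ≈0
      f′≈0 : 3 · X x ^ 2 + A ≈ 0#
      f′≈0 = square-zero⇒ f′²≈0

    -- Describes ∞ and ± P without choosing P: only the abscissa enters, and this is what the
    -- Frobenius map and the uniqueness argument see.
    data VerticalLine (x₀ : Carrier) : Pred Point (c ⊔ ℓ₁) where
      ∞   : ∞ ∈ VerticalLine x₀
      aff : ∀ {x y} → OnCurve (aff x y) → x ≈ x₀ → aff x y ∈ VerticalLine x₀

    verticalSubgroup : ∀ {x₀} → ψ (X x₀) ≈ 0# → Subgroup
    verticalSubgroup {x₀} ψ≈0 = record
      { members  = VerticalLine x₀
      ; onCurve  = λ { ∞ → ∞ ; (aff on _) → on }
      ; resp-≋   = λ { ∞ ∞ → ∞ ; (aff x≈ y≈) (aff on x≈x₀) → aff (onCurve-resp x≈ y≈ on) (trans (sym x≈) x≈x₀) }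
      ; ∞-closed = ∞
      ; ⊕-closed = closed
      ; ⊖-closed = λ { ∞ → ∞ ; (aff on x≈x₀) → aff (onCurve-neg on) x≈x₀ }
      }
      where
      closed : ∀ {P Q} → P ∈ VerticalLine x₀ → Q ∈ VerticalLine x₀ → P ⊕ Q ∈ VerticalLine x₀
      closed ∞ q = q
      closed (aff on x≈) ∞ = aff on x≈
      closed (aff {x₁} {y₁} on₁ x₁≈) (aff {x₂} {y₂} on₂ x₂≈)
        with x₁ #? x₂ | y₁ + y₂ + a₁ * x₂ + a₃ #? 0#
      ... | yes x₁#x₂ | _        = contradiction (trans x₁≈ (sym x₂≈)) (#⇒≉ x₁#x₂)
      ... | no _      | no _     = ∞
      -- The points have the same abscissa and are not opposite, so this is a doubling. A root of ψ
      -- belongs to a flex: the tangent meets the curve only there, and the double is the negative.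
      ... | no _      | yes s#0 = aff
        (onCurve-resp (sym x₃≈x₁) (sym y₃≈) (onCurve-neg on₁)) (trans x₃≈x₁ x₁≈)
        where
        x₁≈x₂ = trans x₁≈ (sym x₂≈)
        m = tangent x₁ y₁
        x₃≈x₁ : x₃ m x₁ x₂ ≈ x₁
        x₃≈x₁ = ψ⇒x₃-tangent on₁ (ψ-root-not-2-torsion on₁ ψ₁≈0) x₁≈x₂ ψ₁≈0
          where ψ₁≈0 = trans (ψ-cong (X-cong x₁≈)) ψ≈0
        y₃≈ : - (y₁ + m * (x₃ m x₁ x₂ - x₁)) - a₁ * x₃ m x₁ x₂ - a₃ ≈ neg x₁ y₁
        y₃≈ = lincomb (x₁ ∷ y₁ ∷ m ∷ x₃ m x₁ x₂ ∷ a₁ ∷ a₃ ∷ []) (λ x₁ y₁ m x₃ a₁ a₃ →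
          :- (m :+ a₁) :× x₃ := x₁ ⊢
          ⊢ :- (y₁ :+ m :* (x₃ :- x₁)) :- a₁ :* x₃ :- a₃ := :- y₁ :- a₁ :* x₁ :- a₃) x₃≈x₁

    neg≉ : ∀ {x y} → Y x y ≉ 0# → ¬ (aff x y ≋ aff x (neg x y))
    neg≉ {x} {y} Y≉0 (aff _ y≈) = 2Y≉0 Y≉0 (lincomb (Y x y ∷ Y x (neg x y) ∷ []) (λ Y Y′ →
      :1 :× Y := Y′ ⊢ :1 :× Y′ := :- Y ⊢ ⊢ 2 :· Y := :0) (Y-cong refl y≈) Y-neg)

    verticalSubgroup-order : ∀ {x₀ y₀} (ψ≈0 : ψ (X x₀) ≈ 0#) → OnCurve (aff x₀ y₀) →
                             HasOrder (verticalSubgroup ψ≈0) 3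
    verticalSubgroup-order {x₀} {y₀} ψ≈0 on = e , e-injective , λ P → mk⇔ (covers P) (within P)
      where
      e : Fin 3 → Point
      e zero             = ∞
      e (suc zero)       = aff x₀ y₀
      e (suc (suc zero)) = aff x₀ (neg x₀ y₀)
      Y₀≉0 = ψ-root-not-2-torsion on ψ≈0
      e-injective : ∀ k l → e k ≋ e l → k ≡ l
      e-injective zero             zero             _  = ≡.refl
      e-injective zero             (suc zero)       ()
      e-injective zero             (suc (suc zero)) ()
      e-injective (suc zero)       zero             ()
      e-injective (suc (suc zero)) zero             ()
      e-injective (suc zero)       (suc zero)       _  = ≡.refl
      e-injective (suc (suc zero)) (suc (suc zero)) _  = ≡.refl
      e-injective (suc zero)       (suc (suc zero)) eq = contradiction eq (neg≉ Y₀≉0)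
      e-injective (suc (suc zero)) (suc zero)       eq = contradiction (≋-sym eq) (neg≉ Y₀≉0)
      covers : ∀ P → P ∈ VerticalLine x₀ → ∃[ k ] e k ≋ P
      covers .∞ ∞ = zero , ∞
      covers _ (aff on′ x≈x₀) with same-x on on′ (sym x≈x₀)
      ... | inj₁ eq = suc zero , eq
      ... | inj₂ eq = suc (suc zero) , eq
      within : ∀ P → ∃[ k ] e k ≋ P → P ∈ VerticalLine x₀
      within _ (zero , ∞)                     = ∞
      within _ (suc zero , aff x≈ y≈)         = aff (onCurve-resp x≈ y≈ on) (sym x≈)
      within _ (suc (suc zero) , aff x≈ y≈)   = aff (onCurve-resp x≈ y≈ (onCurve-neg on)) (sym x≈)

    module Order3 (H : Subgroup) (order : HasOrder H 3) where
      private
        e = proj₁ order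
        e-injective = proj₁ (proj₂ order)
        index : ∀ {P} → P ∈ members H → ∃[ k ] e k ≋ P
        index {P} = Equivalence.to (proj₂ (proj₂ order) P)

      -- Three distinct members occupy three distinct places in an enumeration of length 3, hence
      -- all of them.
      exhaust : ∀ {P Q R} → P ∈ members H → Q ∈ members H → R ∈ members H →
                ¬ (P ≋ Q) → ¬ (P ≋ R) → ¬ (Q ≋ R) →
                ∀ {T} → T ∈ members H → P ≋ T ⊎ Q ≋ T ⊎ R ≋ T
      exhaust {P} {Q} {R} P∈ Q∈ R∈ P≢Q P≢R Q≢R {T} T∈ with index P∈ | index Q∈ | index R∈ | index T∈
      ... | p , eP | q , eQ | r′ , eR | l , eT = found (injective⇒surjective ℕ.≤-refl g-injective l)
        where
        g : Fin 3 → Fin 3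
        g zero             = p
        g (suc zero)       = q
        g (suc (suc zero)) = r′
        same : ∀ {P Q k l} → e k ≋ P → e l ≋ Q → k ≡ l → P ≋ Q
        same eP eQ ≡.refl = ≋-trans (≋-sym eP) eQ
        g-injective : ∀ {i j} → g i ≡ g j → i ≡ j
        g-injective {zero}           {zero}           _  = ≡.refl
        g-injective {zero}           {suc zero}       eq = contradiction (same eP eQ eq) P≢Q
        g-injective {zero}           {suc (suc zero)} eq = contradiction (same eP eR eq) P≢R
        g-injective {suc zero}       {zero}           eq = contradiction (≋-sym (same eQ eP eq)) P≢Q
        g-injective {suc zero}       {suc zero}       _  = ≡.refl
        g-injective {suc zero}       {suc (suc zero)} eq = contradiction (same eQ eR eq) Q≢R
        g-injective {suc (suc zero)} {zero}           eq = contradiction (≋-sym (same eR eP eq)) P≢R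
        g-injective {suc (suc zero)} {suc zero}       eq = contradiction (≋-sym (same eR eQ eq)) Q≢R
        g-injective {suc (suc zero)} {suc (suc zero)} _  = ≡.refl
        found : ∃[ i ] g i ≡ l → P ≋ T ⊎ Q ≋ T ⊎ R ≋ T
        found (zero           , eq) = inj₁ (same eP eT eq)
        found (suc zero       , eq) = inj₂ (inj₁ (same eQ eT eq))
        found (suc (suc zero) , eq) = inj₂ (inj₂ (same eR eT eq))

      -- Otherwise each of the three enumerated members would be ∞ or `P`, and two of them would
      -- coincide.
      another : ∀ P → ∃[ x ] ∃[ y ] aff x y ∈ members H × ¬ (aff x y ≋ P)
      another P with any? (λ k → ¬? (e k ≋? ∞) ×-dec ¬? (e k ≋? P))
      ... | yes (k , k≢∞ , k≢P) = affine (e k) (Equivalence.from (proj₂ (proj₂ order) (e k)) (k , ≋-refl)) k≢∞ k≢P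
        where
        affine : ∀ Q → Q ∈ members H → ¬ (Q ≋ ∞) → ¬ (Q ≋ P) →
                 ∃[ x ] ∃[ y ] aff x y ∈ members H × ¬ (aff x y ≋ P)
        affine ∞         _  Q≢∞ _   = contradiction ∞ Q≢∞
        affine (aff x y) Q∈ _   Q≢P = x , y , Q∈ , Q≢P
      ... | no none = contradiction i<j (ℕ.<-irrefl (≡.cong Fin.toℕ (e-injective i j (same i j eq))))
        where
        class : Fin 3 → Fin 2
        class k with e k ≋? ∞
        ... | yes _ = zero
        ... | no  _ = suc zero
        is-P : ∀ k → ¬ (e k ≋ ∞) → e k ≋ P
        is-P k k≢∞ with e k ≋? P
        ... | yes k≋P = k≋P
        ... | no  k≢P = contradiction (k , k≢∞ , k≢P) none
        same : ∀ i j → class i ≡ class j → e i ≋ e j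
        same i j eq with e i ≋? ∞ | e j ≋? ∞
        ... | yes i≋∞ | yes j≋∞ = ≋-trans i≋∞ (≋-sym j≋∞)
        ... | no  i≢∞ | no  j≢∞ = ≋-trans (is-P i i≢∞) (≋-sym (is-P j j≢∞))
        same i j () | yes _ | no _
        same i j () | no _ | yes _
        collision = pigeonhole (ℕ.s≤s (ℕ.s≤s (ℕ.s≤s ℕ.z≤n))) class
        i = proj₁ collision
        j = proj₁ (proj₂ collision)
        i<j = proj₁ (proj₂ (proj₂ collision))
        eq = proj₂ (proj₂ (proj₂ collision))

      private
        ∞∈ = ∞-closed H

      module _ {x y} (P∈ : aff x y ∈ members H) (Y≉0 : Y x y ≉ 0#) where

        x-unique : ∀ {x′ y′} → aff x′ y′ ∈ members H → x′ ≈ x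
        x-unique Q∈ with exhaust ∞∈ P∈ (⊖-closed H P∈) (λ ()) (λ ()) (neg≉ Y≉0) Q∈
        ... | inj₂ (inj₁ (aff x≈ _)) = sym x≈
        ... | inj₂ (inj₂ (aff x≈ _)) = sym x≈

        members-vertical : members H ≐ VerticalLine x
        members-vertical = into , out
          where
          into : members H ⊆ VerticalLine x
          into {∞}       _  = ∞
          into {aff _ _} Q∈ = aff (onCurve H Q∈) (x-unique Q∈)
          out : VerticalLine x ⊆ members H
          out ∞ = ∞∈
          out (aff on x′≈x) with same-x (onCurve H P∈) on (sym x′≈x)
          ... | inj₁ eq = resp-≋ H eq P∈
          ... | inj₂ eq = resp-≋ H eq (⊖-closed H P∈)

        double : aff x y ⊕ aff x y ≡ thirdPoint (tangent x y) x y x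
        double with x #? x | y + y + a₁ * x + a₃ #? 0#
        ... | yes x#x | _      = contradiction refl (#⇒≉ x#x)
        ... | no _    | yes _  = ≡.refl
        ... | no _    | no ¬s#0 = contradiction
          (≉⇒# (λ s≈0 → 2Y≉0 Y≉0 (lincomb (Y x y ∷ y + y + a₁ * x + a₃ ∷ []) (λ Y s →
            :- :1 :× s := Y :+ Y ⊢ :1 :× s := :0 ⊢ ⊢ 2 :· Y := :0) (sum≈ refl) s≈0))) ¬s#0

        -- All affine members share the abscissa of P, and 2P is an affine member given by the
        -- tangent formula.
        ψ≈0 : ψ (X x) ≈ 0#
        ψ≈0 = x₃-tangent⇒ψ (onCurve H P∈) Y≉0
          (x-unique (≡.subst (_∈ members H) double (⊕-closed H P∈ P∈)))

      -- Two distinct points of order 2 generate a subgroup of order 4.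
      not-2-torsion : ∀ {x y} → aff x y ∈ members H → Y x y ≉ 0#
      not-2-torsion {x₁} {y₁} P∈ Y₁≈0 with another (aff x₁ y₁)
      ... | x₂ , y₂ , Q∈ , Q≢P with Y x₂ y₂ ≈? 0#
      -- If Q is not 2-torsion, all affine members have its abscissa, so P has it too and Y₂² = Y₁²
      -- = 0.
      ...   | no Y₂≉0 = *-nonzero Y₂≉0 Y₂≉0
        (lincomb (Y x₁ y₁ ∷ Y x₂ y₂ ∷ f (X x₁) ∷ f (X x₂) ∷ []) (λ Y₁ Y₂ f₁ f₂ →
          :1 :× Y₂ :^ 2 := f₂ ⊢ :- :1 :× Y₁ :^ 2 := f₁ ⊢ Y₁ :× Y₁ := :0 ⊢ :- :1 :× f₁ := f₂ ⊢
          ⊢ Y₂ :* Y₂ := :0)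
          (onCurve⇒ (onCurve H Q∈)) (onCurve⇒ (onCurve H P∈)) Y₁≈0 (f-cong (X-cong (x-unique Q∈ Y₂≉0 P∈))))
      ...   | yes Y₂≈0 = collinear (exhaust ∞∈ P∈ Q∈ (λ ()) (λ ()) (λ eq → Q≢P (≋-sym eq)) sum∈)
        where
        x₂≉x₁ : x₂ ≉ x₁
        x₂≉x₁ x₂≈x₁ = Q≢P (aff x₂≈x₁ (Y≈⇒y≈ x₂≈x₁ (trans Y₂≈0 (sym Y₁≈0))))
        m = (y₂ - y₁) / (x₂ - x₁)
        sum : aff x₁ y₁ ⊕ aff x₂ y₂ ≡ thirdPoint m x₁ y₁ x₂
        sum with x₁ #? x₂ | y₁ + y₂ + a₁ * x₂ + a₃ #? 0#
        ... | yes _      | _ = ≡.refl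
        ... | no  ¬x₁#x₂ | _ = contradiction (≉⇒# (λ x₁≈x₂ → x₂≉x₁ (sym x₁≈x₂))) ¬x₁#x₂
        sum∈ : thirdPoint m x₁ y₁ x₂ ∈ members H
        sum∈ = ≡.subst (_∈ members H) sum (⊕-closed H P∈ Q∈)
        Δx≉0 : x₂ - x₁ ≉ 0#
        Δx≉0 eq = x₂≉x₁ (lincomb (x₁ ∷ x₂ ∷ []) (λ x₁ x₂ → :1 :× x₂ :- x₁ := :0 ⊢ ⊢ x₂ := x₁) eq)
        -- Both points lie on the line Y = 0, whose slope in the coordinates (X , Y) is zero; hence
        -- X₃ = - X₁ - X₂, the third root of f.
        m≈s : m ≈ s
        m≈s = ≈-by-* Δx≉0 (lincomb (x₁ ∷ y₁ ∷ x₂ ∷ y₂ ∷ s ∷ w ∷ (x₂ - x₁) ⁻¹ ∷ []) (λ x₁ y₁ x₂ y₂ s w i →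
          y₂ :- y₁ :× (x₂ :- x₁) :* i := :1 ⊢
          :1 :× y₂ :- s :* x₂ :+ w := :0 ⊢
          :- :1 :× y₁ :- s :* x₁ :+ w := :0 ⊢
          ⊢ (x₂ :- x₁) :* ((y₂ :- y₁) :* i :- s) := :0) (⁻¹-inverseʳ Δx≉0) Y₂≈0 Y₁≈0)
        X₃≈ : X (x₃ m x₁ x₂) ≈ - X x₁ - X x₂
        X₃≈ = lincomb (X (x₃ m x₁ x₂) ∷ m ∷ s ∷ X x₁ ∷ X x₂ ∷ []) (λ X₃ m s X₁ X₂ →
          :1 :× X₃ := (m :- s) :^ 2 :- X₁ :- X₂ ⊢ m :- s :× m := s ⊢
          ⊢ X₃ := :- X₁ :- X₂) X-x₃ m≈s
        root : ∀ {x y} → aff x y ∈ members H → Y x y ≈ 0# → f (X x) ≈ 0#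
        root {x} {y} R∈ Y≈0 = lincomb (Y x y ∷ f (X x) ∷ []) (λ Y f →
          :- :1 :× Y :^ 2 := f ⊢ Y :× Y := :0 ⊢ ⊢ f := :0) (onCurve⇒ (onCurve H R∈)) Y≈0
        -- The difference quotient of f at X and X′ is X² + X X′ + X′² + A, and X′ = -2X turns it
        -- into f′(X).
        double-root : ∀ {X X′} → X′ - X ≉ 0# → f X ≈ 0# → f X′ ≈ 0# → - X - X′ ≈ X → 3 · X ^ 2 + A ≈ 0#
        double-root {X} {X′} ΔX≉0 f≈0 f′≈0 eq = *-zero-divisor {X′ - X} (lincomb (X ∷ X′ ∷ A ∷ B ∷ []) (λ X X′ A B →
          :1 :× :cubic A B X′ := :0 ⊢ :- :1 :× :cubic A B X := :0 ⊢
          (X′ :- X) :* (X′ :- X) :× :- X :- X′ := X ⊢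
          ⊢ (X′ :- X) :* :cubic′ A B X := :0) f′≈0 f≈0 eq) ΔX≉0
        ΔX≉0 : ∀ {x x′} → x ≉ x′ → X x - X x′ ≉ 0#
        ΔX≉0 {x} {x′} x≉ eq = x≉ (lincomb (x ∷ x′ ∷ r ∷ []) (λ x x′ r → :1 :× (x :- r) :- (x′ :- r) := :0 ⊢ ⊢ x := x′) eq)
        collinear : ¬ (∞ ≋ thirdPoint m x₁ y₁ x₂ ⊎ aff x₁ y₁ ≋ thirdPoint m x₁ y₁ x₂ ⊎
                       aff x₂ y₂ ≋ thirdPoint m x₁ y₁ x₂)
        collinear (inj₂ (inj₁ (aff x₁≈x₃ _))) = nonsingular (double-root-singular (root P∈ Y₁≈0)
          (double-root (ΔX≉0 x₂≉x₁) (root P∈ Y₁≈0) (root Q∈ Y₂≈0) (trans (sym X₃≈) (X-cong (sym x₁≈x₃)))))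
        collinear (inj₂ (inj₂ (aff x₂≈x₃ _))) = nonsingular (double-root-singular (root Q∈ Y₂≈0)
          (double-root (ΔX≉0 (λ eq → x₂≉x₁ (sym eq))) (root Q∈ Y₂≈0) (root P∈ Y₁≈0)
            (trans (+-comm _ _) (trans (sym X₃≈) (X-cong (sym x₂≈x₃))))))

  :discriminant : ∀ {n} (a₁ a₂ a₃ a₄ a₆ : Expr n) → Expr n
  :discriminant a₁ a₂ a₃ a₄ a₆ =
    :- (b₂ :^ 2 :* b₈) :- 8 :· b₄ :^ 3 :- 27 :· b₆ :^ 2 :+ 9 :· (b₂ :* b₄ :* b₆)
    where
    b₂ = a₁ :^ 2 :+ 4 :· a₂
    b₄ = 2 :· a₄ :+ a₁ :* a₃
    b₆ = a₃ :^ 2 :+ 4 :· a₆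
    b₈ = a₁ :^ 2 :* a₆ :+ 4 :· (a₂ :* a₆) :- a₁ :* a₃ :* a₄ :+ a₂ :* a₃ :^ 2 :- a₄ :^ 2

  module _ {W : Weierstrass Carrier} (S : ShortForm W) where
    open Weierstrass W
    open ShortForm S

    discriminant-shortForm : discriminant F W ≈ - (16 · (4 · A ^ 3 + 27 · B ^ 2))
    discriminant-shortForm = trans
      (⟦ :discriminant (var zero) (var (suc zero)) (var (suc (suc zero)))
           (var (suc (suc (suc zero)))) (var (suc (suc (suc (suc zero))))) ⟧-cong
        {a₁ ∷ a₂ ∷ a₃ ∷ a₄ ∷ a₆ ∷ []} (a₁≈ ∷ a₂≈ ∷ a₃≈ ∷ a₄≈ ∷ a₆≈ ∷ []))
      (lincomb (s ∷ r ∷ w ∷ A ∷ B ∷ []) λ s r w A B →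
        ⊢ :discriminant (:a₁ s r w A B) (:a₂ s r w A B) (:a₃ s r w A B) (:a₄ s r w A B) (:a₆ s r w A B)
            := :- (16 :· (4 :· A :^ 3 :+ 27 :· B :^ 2)))

    nonsingular-shortForm : discriminant F W # 0# → 4 · A ^ 3 + 27 · B ^ 2 ≉ 0#
    nonsingular-shortForm Δ#0 eq = #⇒≉ Δ#0 (lincomb
      (discriminant F W ∷ 4 · A ^ 3 + 27 · B ^ 2 ∷ []) (λ Δ δ →
        :1 :× Δ := :- (16 :· δ) ⊢ :- (16 :· :1) :× δ := :0 ⊢ ⊢ Δ := :0) discriminant-shortForm eq)

  -- `s` and `w` complete the square in y and `r` then completes the cube in x, which requires
  -- dividing by 2 and by 3; `A` and `B` absorb the rest.
  shortForm : 2 · 1# ≉ 0# → 3 · 1# ≉ 0# → ∀ W → ShortForm W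
  shortForm 2≉0 3≉0 W = record
    { s = s ; r = r ; w = w ; A = A ; B = B
    ; a₁≈ = lincomb (a₁ ∷ ½ ∷ []) (λ a₁ ½ →
        :- a₁ :× (2 :· :1) :* ½ := :1 ⊢ ⊢ a₁ := :- (2 :· (:- (a₁ :* ½)))) 2½≈1
    ; a₂≈ = lincomb (a₂ ∷ s ∷ ⅓ ∷ []) (λ a₂ s ⅓ →
        :- (a₂ :+ s :^ 2) :× (3 :· :1) :* ⅓ := :1 ⊢
        ⊢ a₂ := :- (3 :· (:- ((a₂ :+ s :^ 2) :* ⅓)) :+ s :^ 2)) (⁻¹-inverseʳ 3≉0)
    ; a₃≈ = lincomb (a₃ ∷ ½ ∷ []) (λ a₃ ½ →
        :- a₃ :× (2 :· :1) :* ½ := :1 ⊢ ⊢ a₃ := 2 :· (a₃ :* ½)) 2½≈1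
    ; a₄≈ = lincomb (a₄ ∷ r ∷ s ∷ w ∷ []) (λ a₄ r s w →
        ⊢ a₄ := a₄ :- 3 :· r :^ 2 :- 2 :· (s :* w) :+ 3 :· r :^ 2 :+ 2 :· (s :* w))
    ; a₆≈ = lincomb (a₆ ∷ r ∷ A ∷ w ∷ []) (λ a₆ r A w →
        ⊢ a₆ := a₆ :+ r :* A :+ r :^ 3 :+ w :^ 2 :- r :* A :- r :^ 3 :- w :^ 2)
    }
    where
    open Weierstrass W
    ½ = (2 · 1#) ⁻¹
    ⅓ = (3 · 1#) ⁻¹
    2½≈1 = ⁻¹-inverseʳ 2≉0
    s = - (a₁ * ½)
    w = a₃ * ½
    r = - ((a₂ + s ^ 2) * ⅓)
    A = a₄ - 3 · r ^ 2 - 2 · (s * w)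
    B = a₆ + r * A + r ^ 3 + w ^ 2

module _ {c ℓ₁ ℓ₂ c′ ℓ₁′ ℓ₂′} (F : Field c ℓ₁ ℓ₂) (L : Field c′ ℓ₁′ ℓ₂′)
  {f : Field.Carrier F → Field.Carrier L} (isHom : IsRingHomomorphism (Field.rawRing F) (Field.rawRing L) f) where
  private
    module L = Field L
  open Homomorphism (Field.commutativeRing F) (Field.commutativeRing L) isHom
  open IsRingHomomorphism isHom using (⟦⟧-cong)

  mapShortForm : ∀ {W} → Curves.ShortForm F W → Curves.ShortForm L (mapCoefficients f W)
  mapShortForm S = record
    { s = f s ; r = f r ; w = f w ; A = f A ; B = f B
    ; a₁≈ = L.trans (⟦⟧-cong a₁≈) (⟦ coefficient :a₁ ⟧-homo ρ)
    ; a₂≈ = L.trans (⟦⟧-cong a₂≈) (⟦ coefficient :a₂ ⟧-homo ρ)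
    ; a₃≈ = L.trans (⟦⟧-cong a₃≈) (⟦ coefficient :a₃ ⟧-homo ρ)
    ; a₄≈ = L.trans (⟦⟧-cong a₄≈) (⟦ coefficient :a₄ ⟧-homo ρ)
    ; a₆≈ = L.trans (⟦⟧-cong a₆≈) (⟦ coefficient :a₆ ⟧-homo ρ)
    }
    where
    open Curves.ShortForm S
    ρ = s ∷ r ∷ w ∷ A ∷ B ∷ []
    coefficient : ((s r w A B : Expr 5) → Expr 5) → Expr 5
    coefficient a = a (var zero) (var (suc zero)) (var (suc (suc zero))) (var (suc (suc (suc zero))))
                      (var (suc (suc (suc (suc zero)))))

-- Counting in finite fields: units and cosets of powers.

module Representatives {a ℓ} {A : Set a} {_~_ : Rel A ℓ} (isDecEquivalence : IsDecEquivalence _~_) where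
  open IsDecEquivalence isDecEquivalence renaming (sym to ~-sym; trans to ~-trans; refl to ~-refl)

  -- Later applied to the units with x ~ y when x^m = y^m, so that the number of representatives is
  -- the number of nonzero m-th powers.
  representatives : ∀ {n} (f : Fin n → A) → ∃[ k ] Σ[ rep ∈ (Fin k → Fin n) ]
    (∀ {i j} → f (rep i) ~ f (rep j) → i ≡ j) × (∀ i → ∃[ j ] f i ~ f (rep j))
  representatives {zero} f = zero , (λ ()) , (λ { {()} }) , λ ()
  representatives {suc n} f with representatives (λ i → f (suc i))
  ... | k , rep , distinct , covers with any? (λ j → f zero ≟ f (suc (rep j)))
  ...   | yes hit = k , (λ j → suc (rep j)) , distinct , λ { zero → hit ; (suc i) → covers i }
  ...   | no miss = suc k , rep′ , distinct′ , covers′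
    where
    rep′ : Fin (suc k) → Fin (suc n)
    rep′ zero    = zero
    rep′ (suc j) = suc (rep j)
    distinct′ : ∀ {i j} → f (rep′ i) ~ f (rep′ j) → i ≡ j
    distinct′ {zero}  {zero}  _  = ≡.refl
    distinct′ {zero}  {suc j} eq = contradiction (j , eq) miss
    distinct′ {suc i} {zero}  eq = contradiction (i , ~-sym eq) miss
    distinct′ {suc i} {suc j} eq = ≡.cong suc (distinct eq)
    covers′ : ∀ i → ∃[ j ] f i ~ f (rep′ j)
    covers′ zero    = zero , ~-refl
    covers′ (suc i) with covers i
    ... | j , eq = suc j , eq

module FiniteFieldProperties {c ℓ₁ ℓ₂} (𝔽 : FiniteField c ℓ₁ ℓ₂) where
  open FiniteField 𝔽 hiding (zero)
  open FieldProperties fld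
  open Algebra.Properties.CommutativeMonoid.Sum *-commutativeMonoid
    using () renaming (sum to product; sum-cong-≋ to product-cong; sum-permute to product-permute;
                       ∑-distrib-+ to product-distrib; sum-replicate to product-replicate)

  element : Fin size → Carrier
  element = Inverse.to enumeration

  index : Carrier → Fin size
  index = Inverse.from enumeration

  index-cong : ∀ {x y} → x ≈ y → index x ≡ index y
  index-cong = Inverse.from-cong enumeration

  element-index : ∀ x → element (index x) ≈ x
  element-index x = Inverse.inverseˡ enumeration ≡.refl

  index-element : ∀ i → index (element i) ≡ i
  index-element i = Inverse.inverseʳ enumeration refl

  index-injective : ∀ {x y} → index x ≡ index y → x ≈ y
  index-injective {x} {y} eq =
    trans (sym (element-index x)) (trans (reflexive (≡.cong element eq)) (element-index y))

  element-injective : ∀ {i j} → element i ≈ element j → i ≡ j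
  element-injective {i} {j} eq =
    ≡.trans (≡.sym (index-element i)) (≡.trans (index-cong eq) (index-element j))

  surjective-of-injective : {f : Carrier → Carrier} → (∀ {x y} → f x ≈ f y → x ≈ y) → ∀ y → ∃[ x ] f x ≈ y
  surjective-of-injective {f} inj y
    with injective⇒surjective {f = λ i → index (f (element i))} ℕ.≤-refl
      (λ eq → element-injective (inj (index-injective eq))) (index y)
  ... | i , eq = element i , index-injective eq

  -- A gapless numbering of the nonzero elements, over which products can be formed; it arises by
  -- punching the index of zero out of the enumeration.
  record Units (n : ℕ) : Set (c ⊔ ℓ₁) where
    field
      size≡          : size ≡ suc n
      unit           : Fin n → Carrier
      unit≉0         : ∀ i → unit i ≉ 0#
      unit-injective : ∀ {i j} → unit i ≈ unit j → i ≡ j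
      unitIndex      : ∀ {x} → x ≉ 0# → Fin n
      unit-index     : ∀ {x} (x≉0 : x ≉ 0#) → unit (unitIndex x≉0) ≈ x

  units : ∃[ n ] Units n
  units = enumerate size ≡.refl
    where
    enumerate : ∀ m → size ≡ m → ∃[ n ] Units n
    enumerate zero    eq = contradiction (≡.subst Fin eq (index 0#)) λ ()
    enumerate (suc n) eq = n , record
      { size≡          = eq
      ; unit           = unit
      ; unit≉0         = λ i eq → punchInᵢ≢i i₀ i (element′-injective (trans eq (sym element-i₀)))
      ; unit-injective = λ eq → punchIn-injective i₀ _ _ (element′-injective eq)
      ; unitIndex      = λ x≉0 → punchOut (avoids x≉0)
      ; unit-index     = λ x≉0 → trans (reflexive (≡.cong element′ (punchIn-punchOut (avoids x≉0)))) (element′-index _)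
      }
      where
      element′ : Fin (suc n) → Carrier
      element′ i = element (≡.subst Fin (≡.sym eq) i)
      index′ : Carrier → Fin (suc n)
      index′ x = ≡.subst Fin eq (index x)
      element′-index : ∀ x → element′ (index′ x) ≈ x
      element′-index x = trans (reflexive (≡.cong element (≡.subst-sym-subst eq))) (element-index x)
      element′-injective : ∀ {i j} → element′ i ≈ element′ j → i ≡ j
      element′-injective eq′ = ≡.subst-injective (≡.sym eq) (element-injective eq′)
      i₀ = index′ 0#
      element-i₀ = element′-index 0#
      unit : Fin n → Carrier
      unit i = element′ (punchIn i₀ i)
      avoids : ∀ {x} → x ≉ 0# → i₀ ≢ index′ x
      avoids x≉0 i₀≡ = x≉0 (trans (sym (element′-index _)) (trans (reflexive (≡.cong element′ (≡.sym i₀≡))) element-i₀))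

  product-nonzero : ∀ {n} {f : Fin n → Carrier} → (∀ i → f i ≉ 0#) → product f ≉ 0#
  product-nonzero {zero}  f≉0 = 1≉0
  product-nonzero {suc n} f≉0 = *-nonzero (f≉0 zero) (product-nonzero (λ i → f≉0 (suc i)))

  module _ {n} (U : Units n) where
    open Units U

    -- Multiplication by x permutes the units.
    unit-^ : ∀ {x} → x ≉ 0# → x ^ n ≈ 1#
    unit-^ {x} x≉0 = *-cancelˡ-nonzero (product-nonzero unit≉0) (begin
      product unit * x ^ n                   ≈⟨ *-comm _ _ ⟩
      x ^ n * product unit                   ≈⟨ *-congʳ (product-replicate n) ⟨
      product {n} (λ _ → x) * product unit   ≈⟨ product-distrib (λ _ → x) unit ⟨
      product (λ i → x * unit i)             ≈⟨ product-cong (λ i → unit-index (x*unit≉0 i)) ⟨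
      product (λ i → unit (to i))            ≈⟨ product-permute unit (permutation to from to-from from-to) ⟨
      product unit                           ≈⟨ *-identityʳ _ ⟨
      product unit * 1#                      ∎)
      where
      open SetoidReasoning setoid
      x*unit≉0 : ∀ i → x * unit i ≉ 0#
      x*unit≉0 i = *-nonzero x≉0 (unit≉0 i)
      x⁻¹*unit≉0 : ∀ i → x ⁻¹ * unit i ≉ 0#
      x⁻¹*unit≉0 i = *-nonzero (⁻¹-nonzero x≉0) (unit≉0 i)
      to from : Fin n → Fin n
      to i   = unitIndex (x*unit≉0 i)
      from i = unitIndex (x⁻¹*unit≉0 i)
      to-from : ∀ i → to (from i) ≡ i
      to-from i = unit-injective (trans (unit-index _) (lincomb (x ∷ x ⁻¹ ∷ unit i ∷ unit (from i) ∷ []) (λ x x⁻¹ u v →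
        x :× v := x⁻¹ :* u ⊢ u :× x :* x⁻¹ := :1 ⊢ ⊢ x :* v := u) (unit-index _) (⁻¹-inverseʳ x≉0)))
      from-to : ∀ i → from (to i) ≡ i
      from-to i = unit-injective (trans (unit-index _) (lincomb (x ∷ x ⁻¹ ∷ unit i ∷ unit (to i) ∷ []) (λ x x⁻¹ u v →
        x⁻¹ :× v := x :* u ⊢ u :× x :* x⁻¹ := :1 ⊢ ⊢ x⁻¹ :* v := u) (unit-index _) (⁻¹-inverseʳ x≉0)))

  ^-size : ∀ x → x ^ size ≈ x
  ^-size x with units
  ... | n , U with x ≈? 0#
  ...   | yes x≈0 = begin
    x ^ size     ≡⟨ ≡.cong (x ^_) (Units.size≡ U) ⟩
    x * x ^ n    ≈⟨ *-congʳ x≈0 ⟩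
    0# * x ^ n   ≈⟨ zeroˡ _ ⟩
    0#           ≈⟨ x≈0 ⟨
    x            ∎
    where open SetoidReasoning setoid
  ...   | no x≉0 = begin
    x ^ size     ≡⟨ ≡.cong (x ^_) (Units.size≡ U) ⟩
    x * x ^ n    ≈⟨ *-congˡ (unit-^ U x≉0) ⟩
    x * 1#       ≈⟨ *-identityʳ x ⟩
    x            ∎
    where open SetoidReasoning setoid

  -- The hypotheses say that the m-th powers have index at most m in the
  -- group of units, and at least m.
  module PowerCosets {n} (U : Units n) (m : ℕ) {b : Carrier} (b≉0 : b ≉ 0#) (ζ : Fin m → Carrier)
    (fibre : ∀ {x y} → y ≉ 0# → x ^ m ≈ y ^ m → ∃[ i ] x ≈ ζ i * y)
    (independent : ∀ {i j : Fin m} {x y} → x ≉ 0# → y ≉ 0# →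
                   b ^ toℕ i * x ^ m ≈ b ^ toℕ j * y ^ m → i ≡ j) where
    open Units U

    private
      isDecEquivalence : IsDecEquivalence (λ x y → x ^ m ≈ y ^ m)
      isDecEquivalence = record
        { isEquivalence = record { refl = refl ; sym = sym ; trans = trans }
        ; _≟_ = λ x y → x ^ m ≈? y ^ m }
      reps = Representatives.representatives isDecEquivalence unit

    k : ℕ
    k = proj₁ reps

    root : Fin k → Carrier
    root j = unit (proj₁ (proj₂ reps) j)

    root≉0 : ∀ j → root j ≉ 0#
    root≉0 j = unit≉0 _

    root-distinct : ∀ {i j} → root i ^ m ≈ root j ^ m → i ≡ j
    root-distinct = proj₁ (proj₂ (proj₂ reps))

    element-of : Fin m × Fin k → Carrier
    element-of (i , j) = b ^ toℕ i * root j ^ m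

    element-of≉0 : ∀ p → element-of p ≉ 0#
    element-of≉0 (i , j) = *-nonzero (^-nonzero (toℕ i) b≉0) (^-nonzero m (root≉0 j))

    element-of-injective : ∀ {p p′} → element-of p ≈ element-of p′ → p ≡ p′
    element-of-injective {i , j} {i′ , j′} eq with independent {i} {i′} (root≉0 j) (root≉0 j′) eq
    ... | ≡.refl with root-distinct (*-cancelˡ-nonzero (^-nonzero (toℕ i) b≉0) eq)
    ...   | ≡.refl = ≡.refl

    private
      toUnit : Fin (m ℕ.* k) → Fin n
      toUnit l = unitIndex (element-of≉0 (remQuot k l))

      toUnit-injective : ∀ {l l′} → toUnit l ≡ toUnit l′ → l ≡ l′
      toUnit-injective {l} {l′} eq = ≡.trans (≡.sym (combine-remQuot {m} k l)) (≡.trans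
        (≡.cong (λ p → combine (proj₁ p) (proj₂ p)) (element-of-injective (trans (sym (unit-index _))
          (trans (reflexive (≡.cong unit eq)) (unit-index _)))))
        (combine-remQuot {m} k l′))

      -- A unit is recovered from the representative of its m-th power and the factor `ζ l` relating
      -- the two.
      n≤mk : n ℕ.≤ m ℕ.* k
      n≤mk = injective⇒≤ {f = g} g-injective
        where
        coset : ∀ i → ∃[ j ] unit i ^ m ≈ root j ^ m
        coset = proj₂ (proj₂ (proj₂ reps))
        factor : ∀ i → ∃[ l ] unit i ≈ ζ l * root (proj₁ (coset i))
        factor i = fibre (root≉0 _) (proj₂ (coset i))
        g : Fin n → Fin (m ℕ.* k)
        g i = combine (proj₁ (factor i)) (proj₁ (coset i))
        g-injective : ∀ {i i′} → g i ≡ g i′ → i ≡ i′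
        g-injective {i} {i′} eq with combine-injective (proj₁ (factor i)) (proj₁ (coset i)) (proj₁ (factor i′)) (proj₁ (coset i′)) eq
        ... | l≡l′ , j≡j′ = unit-injective (begin
          unit i                                           ≈⟨ proj₂ (factor i) ⟩
          ζ (proj₁ (factor i)) * root (proj₁ (coset i))    ≡⟨ ≡.cong₂ (λ l j → ζ l * root j) l≡l′ j≡j′ ⟩
          ζ (proj₁ (factor i′)) * root (proj₁ (coset i′))  ≈⟨ proj₂ (factor i′) ⟨
          unit i′                                          ∎)
          where open SetoidReasoning setoid

    units-size : n ≡ m ℕ.* k
    units-size = ℕ.≤-antisym n≤mk (injective⇒≤ toUnit-injective)

    -- The elements b^i y^m, with y a representative and i below m, are distinct and at least as
    -- many as the units, so none is missed.
    decompose : ∀ {x} → x ≉ 0# → ∃[ p ] element-of p ≈ x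
    decompose x≉0 with injective⇒surjective n≤mk toUnit-injective (unitIndex x≉0)
    ... | l , eq = remQuot k l , trans (sym (unit-index _)) (trans (reflexive (≡.cong unit eq)) (unit-index x≉0))

-- Monic polynomials and the Frobenius map.

module MonicPolynomials {c ℓ₁ ℓ₂} (F : Field c ℓ₁ ℓ₂) where
  open Field F hiding (zero)
  open FieldProperties F
  open Algebra.Properties.CommutativeMonoid.Sum *-commutativeMonoid
    using () renaming (sum to product)

  private
    eval : ∀ {n} → Vec Carrier n → Carrier → Carrier
    eval = monicEval F

  -- Horner's scheme: the values at `r` of the proper tails are the coefficients of the quotient,
  -- and the value of the whole is the remainder.
  divide : ∀ {n} (as : Vec Carrier (suc n)) r →
           ∃[ bs ] ∀ z → eval as z ≈ (z - r) * eval {n} bs z + eval as r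
  divide (a ∷ []) r = [] , λ z → lincomb (a ∷ r ∷ z ∷ []) (λ a r z →
    ⊢ a :+ z :* :1 := (z :- r) :* :1 :+ (a :+ r :* :1))
  divide (a ∷ as@(_ ∷ _)) r with divide as r
  ... | bs , division = eval as r ∷ bs , λ z →
    lincomb (a ∷ r ∷ z ∷ eval as z ∷ eval as r ∷ eval bs z ∷ []) (λ a r z asz asr bsz →
      z :× asz := (z :- r) :* bsz :+ asr ⊢
      ⊢ a :+ z :* asz := (z :- r) :* (asr :+ z :* bsz) :+ (a :+ r :* asr)) (division z)

  -- After one root is divided out, the others remain roots of the quotient, because they differ
  -- from it; the degree matches their number.
  splits : ∀ {n} (as : Vec Carrier n) (ρ : Fin n → Carrier) →
           (∀ {i j} → ρ i ≈ ρ j → i ≡ j) → (∀ i → eval as (ρ i) ≈ 0#) →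
           ∀ z → eval as z ≈ product (λ i → z - ρ i)
  splits []          ρ distinct root z = refl
  splits as@(_ ∷ _) ρ distinct root z with divide as (ρ zero)
  ... | bs , division = trans (division z) (trans (+-congˡ (root zero)) (trans (+-identityʳ _)
    (*-congˡ (splits bs (λ i → ρ (suc i)) (λ eq → suc-injective (distinct eq)) root′ z))))
    where
    root′ : ∀ i → eval bs (ρ (suc i)) ≈ 0#
    root′ i = *-zero-divisor (lincomb
      (ρ (suc i) ∷ ρ zero ∷ eval bs (ρ (suc i)) ∷ eval as (ρ (suc i)) ∷ eval as (ρ zero) ∷ [])
      (λ x r b a a₀ → :- :1 :× a := (x :- r) :* b :+ a₀ ⊢ :1 :× a := :0 ⊢ :- :1 :× a₀ := :0 ⊢
        ⊢ (x :- r) :* b := :0) (division _) (root (suc i)) (root zero))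
      (λ eq → 0≢1+n (distinct {zero} {suc i} (lincomb (ρ zero ∷ ρ (suc i) ∷ []) (λ r x →
        :- :1 :× x :- r := :0 ⊢ ⊢ r := x) eq)))

  product-zero⇒ : ∀ {n} {f : Fin n → Carrier} → product f ≈ 0# → ∃[ i ] f i ≈ 0#
  product-zero⇒ {zero}  1≈0 = contradiction 1≈0 1≉0
  product-zero⇒ {suc n} eq with *-zero⇒ eq
  ... | inj₁ eq₀ = zero , eq₀
  ... | inj₂ eq′ with product-zero⇒ eq′
  ...   | i , eqᵢ = suc i , eqᵢ

  ^-splits : ∀ {q} → 2 ℕ.≤ q → (ρ : Fin q → Carrier) → (∀ {i j} → ρ i ≈ ρ j → i ≡ j) →
             (∀ i → ρ i ^ q ≈ ρ i) → ∀ z → z ^ q - z ≈ product (λ i → z - ρ i)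
  ^-splits {suc zero} (ℕ.s≤s ())
  ^-splits {suc (suc m)} _ ρ distinct fixed z =
    trans (sym (value z)) (splits coefficients ρ distinct root z)
    where
    coefficients : Vec Carrier (suc (suc m))
    -- The polynomial z^q - z; the bound q ≥ 2 keeps its linear term below the leading one.
    coefficients = 0# ∷ - 1# ∷ replicate m 0#
    value₀ : ∀ m z → eval (replicate m 0#) z ≈ z ^ m
    value₀ zero    z = refl
    value₀ (suc m) z = trans (+-identityˡ _) (*-congˡ (value₀ m z))
    value : ∀ z → eval coefficients z ≈ z ^ suc (suc m) - z
    value z = lincomb (z ∷ eval (replicate m 0#) z ∷ z ^ m ∷ []) (λ z e p →
      z :* z :× e := p ⊢ ⊢ :0 :+ z :* (:- :1 :+ z :* e) := z :* (z :* p) :- z) (value₀ m z)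
    root : ∀ i → eval coefficients (ρ i) ≈ 0#
    root i = trans (value (ρ i)) (trans (+-congʳ (fixed i)) (-‿inverseʳ (ρ i)))

module FieldHomomorphism {c ℓ₁ ℓ₂ c′ ℓ₁′ ℓ₂′} (F : Field c ℓ₁ ℓ₂) (L : Field c′ ℓ₁′ ℓ₂′)
  {f : Field.Carrier F → Field.Carrier L} (isHom : IsRingHomomorphism (Field.rawRing F) (Field.rawRing L) f) where
  private
    module F = Field F
    module FP = FieldProperties F
    module L = Field L
    module LP = FieldProperties L
  open IsRingHomomorphism isHom
  open Homomorphism F.commutativeRing L.commutativeRing isHom public

  nonzero : ∀ {x} → x F.≉ F.0# → f x L.≉ L.0#
  nonzero {x} x≉0 fx≈0 = LP.1≉0 (L.trans (L.sym 1#-homo) (L.trans (⟦⟧-cong (F.sym (FP.⁻¹-inverseʳ x≉0)))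
    (L.trans (*-homo _ _) (L.trans (L.*-congʳ fx≈0) (L.zeroˡ _)))))

  injective : ∀ {x y} → f x L.≈ f y → x F.≈ y
  injective {x} {y} eq with x FP.≈? y
  ... | yes x≈y = x≈y
  ... | no  x≉y = contradiction
    (L.trans (+-homo _ _) (L.trans (L.+-congˡ (-‿homo y)) (L.trans (L.+-congʳ eq) (L.-‿inverseʳ _))))
    (nonzero (λ x-y≈0 → x≉y (FP.lincomb (x ∷ y ∷ []) (λ x y → :1 :× x :- y := :0 ⊢ ⊢ x := y) x-y≈0)))

  multiple-nonzero : ∀ {n} → n F.· F.1# F.≉ F.0# → n L.· L.1# L.≉ L.0#
  multiple-nonzero {n} n≉0 eq = nonzero n≉0 (L.trans (·-homo n F.1#)
    (L.trans (LP.⟦ n :· var zero ⟧-cong (1#-homo ∷ [])) eq))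

module Frobenius {c ℓ₁ ℓ₂ c′ ℓ₁′ ℓ₂′} (𝔽 : FiniteField c ℓ₁ ℓ₂)
  (𝔽̄ : AlgebraicClosure (FiniteField.fld 𝔽) c′ ℓ₁′ ℓ₂′) where
  open AlgebraicClosure 𝔽̄ hiding (zero)
  private
    module K = FiniteField 𝔽
    module KP = FieldProperties K.fld
    q = K.size
  open FiniteFieldProperties 𝔽
  open IsRingHomomorphism isHomomorphism
  open FieldProperties closure
  open MonicPolynomials closure
  open FieldHomomorphism K.fld closure isHomomorphism
  open Algebra.Properties.CommutativeMonoid.Sum *-commutativeMonoid
    using () renaming (sum to product; sum-cong-≋ to product-cong; sum-permute to product-permute)

  embed-^-size : ∀ k → embed k ^ q ≈ embed k
  embed-^-size k = trans (sym (^-homo k q)) (⟦⟧-cong (^-size k))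

  2≤size : 2 ℕ.≤ q
  2≤size = injective⇒≤ {f = λ { zero → index K.0# ; (suc _) → index K.1# }} inj
    where
    inj : ∀ {i j : Fin 2} → _ → i ≡ j
    inj {zero}     {zero}     _  = ≡.refl
    inj {zero}     {suc zero} eq = contradiction (K.sym (index-injective eq)) KP.1≉0
    inj {suc zero} {zero}     eq = contradiction (index-injective eq) KP.1≉0
    inj {suc zero} {suc zero} _  = ≡.refl

  frobenius-product : ∀ z → z ^ q - z ≈ product (λ i → z - embed (element i))
  frobenius-product = ^-splits 2≤size (λ i → embed (element i))
    (λ eq → element-injective (injective eq)) (λ i → embed-^-size (element i))

  -- For a fixed z the product of all differences z - r with r in 𝔽_q vanishes, hence so does a
  -- factor.
  fixed⇒embed : ∀ {z} → z ^ q ≈ z → ∃[ k ] embed k ≈ z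
  fixed⇒embed {z} fixed with product-zero⇒ (trans (sym (frobenius-product z)) (trans (+-congʳ fixed) (-‿inverseʳ z)))
  ... | i , eq = element i , lincomb (z ∷ embed (element i) ∷ []) (λ z e → :- :1 :× z :- e := :0 ⊢ ⊢ e := z) eq

  -- z ↦ z^q − z is the product of all z − r with r in the finite field,
  -- hence invariant under translation by elements of that field.
  ^-size-+ : ∀ z c → (z + embed c) ^ q ≈ z ^ q + embed c
  ^-size-+ z c = lincomb (z ∷ embed c ∷ (z + embed c) ^ q ∷ z ^ q ∷ product translated ∷ product factors ∷ [])
    (λ z c zc^q z^q P P′ →
      :1 :× zc^q :- (z :+ c) := P ⊢ :- :1 :× z^q :- z := P′ ⊢ :1 :× P := P′ ⊢
      ⊢ zc^q := z^q :+ c)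
    (frobenius-product _) (frobenius-product _)
    (trans (product-permute translated (permutation (shift c) (shift (K.- c)) shift-unshift unshift-shift))
           (product-cong permuted))
    where
    translated factors : Fin q → Carrier
    translated i = z + embed c - embed (element i)
    factors i    = z - embed (element i)
    shift : K.Carrier → Fin q → Fin q
    shift c i = index (element i K.+ c)
    shift-unshift : ∀ i → shift c (shift (K.- c) i) ≡ i
    shift-unshift i = element-injective (K.trans (element-index _) (KP.lincomb
      (element i ∷ c ∷ element (shift (K.- c) i) ∷ []) (λ x c y → :1 :× y := x :- c ⊢ ⊢ y :+ c := x) (element-index _)))
    unshift-shift : ∀ i → shift (K.- c) (shift c i) ≡ i
    unshift-shift i = element-injective (K.trans (element-index _) (KP.lincomb
      (element i ∷ c ∷ element (shift c i) ∷ []) (λ x c y → :1 :× y := x :+ c ⊢ ⊢ y :- c := x) (element-index _)))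
    permuted : ∀ i → translated (shift c i) ≈ factors i
    permuted i = lincomb (z ∷ embed c ∷ embed (element i) ∷ embed (element (shift c i)) ∷ [])
      (λ z c x y → :- :1 :× y := x :+ c ⊢ ⊢ z :+ c :- y := z :- x)
      (trans (⟦⟧-cong (element-index _)) (+-homo _ _))

-- Rational subgroups of order 3 and roots of the division polynomial.

module RationalSubgroups {c ℓ₁ ℓ₂ c′ ℓ₁′ ℓ₂′} (𝔽 : FiniteField c ℓ₁ ℓ₂)
  (𝔽̄ : AlgebraicClosure (FiniteField.fld 𝔽) c′ ℓ₁′ ℓ₂′)
  (2≉0 : ¬ (FiniteField._≈_ 𝔽 (FiniteField._·_ 𝔽 2 (FiniteField.1# 𝔽)) (FiniteField.0# 𝔽)))
  (E : EllipticCurve (FiniteField.fld 𝔽))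
  (S : Curves.ShortForm (FiniteField.fld 𝔽) (EllipticCurve.equation E)) where

  private
    module K = FiniteField 𝔽
    module KC = Curves K.fld
    q = K.size
    module SK = KC.ShortForm S
  open SK using (A; B)
  open AlgebraicClosure 𝔽̄ hiding (zero)
  open IsRingHomomorphism isHomomorphism
  open FieldProperties closure
  open FieldHomomorphism K.fld closure isHomomorphism
  open Frobenius 𝔽 𝔽̄
  open Algebra.Properties.Semiring.Exp semiring using (^-congˡ; ^-assocʳ)
  open Algebra.Properties.CommutativeSemiring.Exp commutativeSemiring using (^-distrib-*)

  private
    Sᴸ = mapShortForm K.fld closure isHomomorphism S
    s = embed SK.s
    r = embed SK.r
    w = embed SK.w
    :A :B :X : Expr 3
    :A = var zero
    :B = var (suc zero)
    :X = var (suc (suc zero))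

    nonsingular : 4 · embed A ^ 3 + 27 · embed B ^ 2 ≉ 0#
    nonsingular eq = nonzero (KC.nonsingular-shortForm S (EllipticCurve.nonsingular E))
      (trans (⟦ 4 :· var zero :^ 3 :+ 27 :· var (suc zero) :^ 2 ⟧-homo (A ∷ B ∷ [])) eq)

  open Points closure (mapCoefficients embed (EllipticCurve.equation E))
  open Curves.ShortFormCurve closure Sᴸ (multiple-nonzero {2} 2≉0) nonsingular

  private
    fᴷ ψᴷ : K.Carrier → K.Carrier
    fᴷ = KC.cubic A B
    ψᴷ = KC.division₃ A B

    f-embed : ∀ k → embed (fᴷ k) ≈ f (embed k)
    f-embed k = ⟦ :cubic :A :B :X ⟧-homo (A ∷ B ∷ k ∷ [])

    ψ-embed : ∀ k → embed (ψᴷ k) ≈ ψ (embed k)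
    ψ-embed k = ⟦ :division₃ :A :B :X ⟧-homo (A ∷ B ∷ k ∷ [])

    X-embed : ∀ k → embed (k K.- SK.r) ≈ X (embed k)
    X-embed k = ⟦ var zero :- var (suc zero) ⟧-homo (k ∷ SK.r ∷ [])

    x-of : K.Carrier → Carrier
    x-of X = embed (X K.+ SK.r)

    X-x-of : ∀ k → X (x-of k) ≈ embed k
    X-x-of k = lincomb (embed k ∷ r ∷ x-of k ∷ []) (λ X r x → :1 :× x := X :+ r ⊢ ⊢ x :- r := X) (+-homo k SK.r)

    ψ-x-of : ∀ {k} → ψᴷ k K.≈ K.0# → ψ (X (x-of k)) ≈ 0#
    ψ-x-of {k} eq = trans (ψ-cong (X-x-of k)) (trans (sym (ψ-embed k)) (trans (⟦⟧-cong eq) 0#-homo))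

    point-above : ∀ x → ∃[ y ] OnCurve (aff x y)
    -- A root of z² - f(X), to be used as the coordinate Y.
    point-above x with closed 1 (- f (X x) ∷ 0# ∷ [])
    ... | z , eq = z + s * x - w , onCurve⇐ (lincomb (z ∷ s ∷ x ∷ w ∷ f (X x) ∷ []) (λ z s x w f →
      :1 :× :- f :+ z :* (:0 :+ z :* :1) := :0 ⊢
      ⊢ (z :+ s :* x :- w :- s :* x :+ w) :^ 2 := f) eq)

    -- For an abscissa in 𝔽_q the value Y² = f(X) is fixed by the Frobenius map, which therefore
    -- sends Y to ± Y.
    Y-^q² : ∀ {x y k} → embed k ≈ x → OnCurve (aff x y) → (Y x y ^ q) ^ 2 ≈ Y x y ^ 2
    Y-^q² {x} {y} {k} k≈x on = begin
      (Y x y ^ q) ^ 2             ≈⟨ ^-assocʳ (Y x y) q 2 ⟩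
      Y x y ^ (q ℕ.* 2)           ≡⟨ ≡.cong (Y x y ^_) (ℕ.*-comm q 2) ⟩
      Y x y ^ (2 ℕ.* q)           ≈⟨ ^-assocʳ (Y x y) 2 q ⟨
      (Y x y ^ 2) ^ q             ≈⟨ ^-congˡ q Y²≈ ⟩
      embed (fᴷ (k K.- SK.r)) ^ q ≈⟨ embed-^-size _ ⟩
      embed (fᴷ (k K.- SK.r))     ≈⟨ Y²≈ ⟨
      Y x y ^ 2                   ∎
      where
      open SetoidReasoning setoid
      Y²≈ : Y x y ^ 2 ≈ embed (fᴷ (k K.- SK.r))
      Y²≈ = trans (onCurve⇒ on) (trans (f-cong (trans (X-cong (sym k≈x)) (sym (X-embed k)))) (sym (f-embed _)))

    shift : K.Carrier → K.Carrier
    shift k = SK.s K.* k K.- SK.w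

    shift-embed : ∀ {k x} → embed k ≈ x → embed (shift k) ≈ s * x - w
    shift-embed {k} k≈x = trans (⟦ var zero :* var (suc zero) :- var (suc (suc zero)) ⟧-homo (SK.s ∷ k ∷ SK.w ∷ []))
      (+-congʳ (*-congˡ k≈x))

    -- The coordinates y and Y differ by s x - w, an element of 𝔽_q, so that `^-size-+` applies.
    y-^q : ∀ {x k Z} → embed k ≈ x → (Z + (s * x - w)) ^ q ≈ Z ^ q + (s * x - w)
    y-^q {x} {k} {Z} k≈x = begin
      (Z + (s * x - w)) ^ q        ≈⟨ ^-congˡ q (+-congˡ (shift-embed k≈x)) ⟨
      (Z + embed (shift k)) ^ q    ≈⟨ ^-size-+ Z (shift k) ⟩
      Z ^ q + embed (shift k)      ≈⟨ +-congˡ (shift-embed k≈x) ⟩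
      Z ^ q + (s * x - w)          ∎
      where open SetoidReasoning setoid

    y-split : ∀ {x y} → y ≈ Y x y + (s * x - w)
    y-split {x} {y} = lincomb (x ∷ y ∷ s ∷ w ∷ []) (λ x y s w →
      ⊢ y := (y :- s :* x :+ w) :+ (s :* x :- w))

    x-^q : ∀ {x k} → embed k ≈ x → x ^ q ≈ x
    x-^q k≈x = trans (^-congˡ q (sym k≈x)) (trans (embed-^-size _) k≈x)

    frobenius-onCurve : ∀ {x y k} → embed k ≈ x → OnCurve (aff x y) → OnCurve (aff (x ^ q) (y ^ q))
    frobenius-onCurve {x} {y} {k} k≈x on = onCurve⇐ (begin
      Y (x ^ q) (y ^ q) ^ 2   ≈⟨ ^-congˡ 2 Y≈ ⟩
      (Y x y ^ q) ^ 2         ≈⟨ Y-^q² k≈x on ⟩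
      Y x y ^ 2               ≈⟨ onCurve⇒ on ⟩
      f (X x)                 ≈⟨ f-cong (X-cong (x-^q k≈x)) ⟨
      f (X (x ^ q))           ∎)
      where
      open SetoidReasoning setoid
      Y≈ : Y (x ^ q) (y ^ q) ≈ Y x y ^ q
      Y≈ = lincomb (x ∷ x ^ q ∷ y ^ q ∷ Y x y ^ q ∷ s ∷ w ∷ []) (λ x x^q y^q Y^q s w →
        :- s :× x^q := x ⊢ :1 :× y^q := Y^q :+ (s :* x :- w) ⊢
        ⊢ y^q :- s :* x^q :+ w := Y^q) (x-^q k≈x) (trans (^-congˡ q y-split) (y-^q k≈x))

    vertical-rational : ∀ {x₀ k} (ψ≈0 : ψ (X x₀) ≈ 0#) → embed k ≈ x₀ →
                        IsRational 𝔽 𝔽̄ E (verticalSubgroup ψ≈0)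
    vertical-rational ψ≈0 k≈x₀ ∞ = ∞
    vertical-rational ψ≈0 k≈x₀ (aff on x≈x₀) = aff (frobenius-onCurve k≈x on) (trans (x-^q k≈x) x≈x₀)
      where k≈x = trans k≈x₀ (sym x≈x₀)

    module RationalOrder3 (H : Subgroup) (order : HasOrder H 3) (rational : IsRational 𝔽 𝔽̄ E H) where
      open Order3 H order
      private
        point = another ∞
      x₀ y₀ : Carrier
      x₀ = proj₁ point
      y₀ = proj₁ (proj₂ point)
      P∈ : aff x₀ y₀ ∈ members H
      P∈ = proj₁ (proj₂ (proj₂ point))
      Y₀≉0 = not-2-torsion P∈
      H≐ : members H ≐ VerticalLine x₀
      H≐ = members-vertical P∈ Y₀≉0
      private
        -- The Frobenius map sends P to a member, and all affine members have abscissa x₀; hence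
        -- x₀^q = x₀.
        rational-x = fixed⇒embed (x-unique P∈ Y₀≉0 (rational P∈))
      k : K.Carrier
      k = proj₁ rational-x
      k≈x₀ : embed k ≈ x₀
      k≈x₀ = proj₂ rational-x
      Xᴷ = k K.- SK.r
      Xᴷ≈ : embed Xᴷ ≈ X x₀
      Xᴷ≈ = trans (X-embed k) (X-cong k≈x₀)
      ψᴷ≈0 : ψᴷ Xᴷ K.≈ K.0#
      ψᴷ≈0 = injective (trans (ψ-embed Xᴷ) (trans (ψ-cong Xᴷ≈) (trans (ψ≈0 P∈ Y₀≉0) (sym 0#-homo))))

    y-^q² : ∀ {x y k} → embed k ≈ x → OnCurve (aff x y) → (y ^ q) ^ q ≈ y
    y-^q² {x} {y} {k} k≈x on = [ (λ Y^q≈Y → trans (^-congˡ q (fixed Y^q≈Y)) (fixed Y^q≈Y)) , negated ]′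
      (square-≈ (Y-^q² k≈x on))
      where
      open SetoidReasoning setoid
      fixed : Y x y ^ q ≈ Y x y → y ^ q ≈ y
      fixed Y^q≈Y = begin
        y ^ q                        ≈⟨ ^-congˡ q y-split ⟩
        (Y x y + (s * x - w)) ^ q    ≈⟨ y-^q k≈x ⟩
        Y x y ^ q + (s * x - w)      ≈⟨ +-congʳ Y^q≈Y ⟩
        Y x y + (s * x - w)          ≈⟨ y-split ⟨
        y                            ∎
      -- Writing -1 as the image of an element of 𝔽_q gives (-1)^q = -1 with no discussion of the
      -- parity of q. Applying the Frobenius map twice then restores the sign of Y.
      -1≈ : embed (K.- K.1#) ≈ - 1#
      -1≈ = trans (-‿homo _) (-‿cong 1#-homo)
      -1Y≈-Y : embed (K.- K.1#) * Y x y ≈ - Y x y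
      -1Y≈-Y = lincomb (embed (K.- K.1#) ∷ Y x y ∷ []) (λ e Y → Y :× e := :- :1 ⊢ ⊢ e :* Y := :- Y) -1≈
      negated : Y x y ^ q ≈ - Y x y → (y ^ q) ^ q ≈ y
      negated Y^q≈-Y = begin
        (y ^ q) ^ q                                 ≈⟨ ^-congˡ q (trans (^-congˡ q y-split) (y-^q k≈x)) ⟩
        (Y x y ^ q + (s * x - w)) ^ q               ≈⟨ y-^q k≈x ⟩
        (Y x y ^ q) ^ q + (s * x - w)               ≈⟨ +-congʳ (^-congˡ q (trans Y^q≈-Y (sym -1Y≈-Y))) ⟩
        (embed (K.- K.1#) * Y x y) ^ q + (s * x - w) ≈⟨ +-congʳ (^-distrib-* _ _ q) ⟩
        embed (K.- K.1#) ^ q * Y x y ^ q + (s * x - w) ≈⟨ +-congʳ (*-cong (embed-^-size _) Y^q≈-Y) ⟩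
        embed (K.- K.1#) * - Y x y + (s * x - w)    ≈⟨ +-congʳ (lincomb (embed (K.- K.1#) ∷ Y x y ∷ []) (λ e Y →
                                                         :- Y :× e := :- :1 ⊢ ⊢ e :* :- Y := Y) -1≈) ⟩
        Y x y + (s * x - w)                         ≈⟨ y-split ⟨
        y                                           ∎

    ^-q^2 : ∀ z → z ^ (q ℕ.^ 2) ≈ (z ^ q) ^ q
    ^-q^2 z = trans (reflexive (≡.cong (λ n → z ^ (q ℕ.* n)) (ℕ.*-identityʳ q))) (sym (^-assocʳ z q q))

  IsUniqueRoot : K.Carrier → Set _
  IsUniqueRoot X = KC.division₃ A B X K.≈ K.0# × (∀ X′ → KC.division₃ A B X′ K.≈ K.0# → X′ K.≈ X)

  -- Any root of ψ in 𝔽_q yields a rational vertical line, which must be the given subgroup. A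
  -- square root of f(X) in 𝔽_q would be ± Y and put both coordinates of the point into 𝔽_q.
  unique-root-of : OnlyOneRationalSubgroupOfOrder3 𝔽 𝔽̄ E →
    ∃[ X ] IsUniqueRoot X × IsQuadraticNonResidue K.fld (KC.cubic A B X)
  unique-root-of (H , order , rational , unique , points) = Xᴷ , (ψᴷ≈0 , only-root) , nonresidue
    where
    open RationalOrder3 H order rational
    open Order3 H order using (x-unique)
    only-root : ∀ X′ → ψᴷ X′ K.≈ K.0# → X′ K.≈ Xᴷ
    only-root X′ ψ′≈0 = injective (trans (sym (X-x-of X′)) (trans (X-cong x′≈x₀) (sym Xᴷ≈)))
      where
      ψ″≈0 = ψ-x-of ψ′≈0
      on = proj₂ (point-above (x-of X′))
      x′≈x₀ : x-of X′ ≈ x₀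
      x′≈x₀ = x-unique P∈ Y₀≉0 (proj₁
        (unique (verticalSubgroup ψ″≈0) (verticalSubgroup-order ψ″≈0 on) (vertical-rational ψ″≈0 refl))
        (aff on refl))
    nonresidue : IsQuadraticNonResidue K.fld (fᴷ Xᴷ)
    nonresidue m m²≈f = proj₂ (points P∈) ((k , k≈x₀) , y₀∈)
      where
      Y²≈ : Y x₀ y₀ ^ 2 ≈ embed m ^ 2
      Y²≈ = trans (onCurve⇒ (onCurve H P∈)) (trans (f-cong (sym Xᴷ≈)) (trans (sym (f-embed Xᴷ))
        (trans (⟦⟧-cong (K.sym m²≈f)) (trans (*-homo m m) (lincomb (embed m ∷ []) (λ m → ⊢ m :* m := m :^ 2))))))
      y₀∈ : In𝔽q 𝔽 𝔽̄ E y₀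
      y₀∈ = [ (λ Y≈m → m K.+ shift k , trans (+-homo _ _) (trans (+-cong (sym Y≈m) (shift-embed k≈x₀)) (sym y-split)))
            , (λ Y≈-m → K.- m K.+ shift k ,
                 trans (+-homo _ _) (trans (+-cong (trans (-‿homo m) (sym Y≈-m)) (shift-embed k≈x₀)) (sym y-split))) ]′ (square-≈ Y²≈)

  -- Any rational subgroup of order 3 has its abscissa at a root of ψ in 𝔽_q, hence at the given
  -- one. Since Y^q = ± Y, its points are fixed by the square of the Frobenius map.
  only-one-from : ∀ {X} → IsUniqueRoot X → IsQuadraticNonResidue K.fld (KC.cubic A B X) →
                  OnlyOneRationalSubgroupOfOrder3 𝔽 𝔽̄ E
  only-one-from {Xᴷ} (ψᴷ≈0 , only-root) nonresidue =
    H , verticalSubgroup-order ψ≈0 (proj₂ (point-above x₀)) , vertical-rational ψ≈0 refl , unique , points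
    where
    x₀ = x-of Xᴷ
    ψ≈0 : ψ (X x₀) ≈ 0#
    ψ≈0 = ψ-x-of ψᴷ≈0
    H = verticalSubgroup ψ≈0
    unique : ∀ H′ → HasOrder H′ 3 → IsRational 𝔽 𝔽̄ E H′ → members H′ ≐ members H
    unique H′ order′ rational′ =
      (λ P∈H′ → move x′≈x₀ (proj₁ H≐ P∈H′)) , (λ P∈H → proj₂ H≐ (move (sym x′≈x₀) P∈H))
      where
      open RationalOrder3 H′ order′ rational′ renaming (x₀ to x′; Xᴷ to X′; ψᴷ≈0 to ψ′≈0; Xᴷ≈ to X′≈)
      x′≈x₀ : x′ ≈ x₀
      x′≈x₀ = X≈⇒x≈ (trans (sym X′≈) (trans (⟦⟧-cong (only-root X′ ψ′≈0)) (sym (X-x-of Xᴷ))))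
      move : ∀ {x x′} → x ≈ x′ → VerticalLine x ⊆ VerticalLine x′
      move x≈x′ ∞          = ∞
      move x≈x′ (aff on eq) = aff on (trans eq x≈x′)
    points : PointsDefinedOver𝔽q²∖𝔽q 𝔽 𝔽̄ E H
    points {x} {y} (aff on x≈x₀) = (x∈ , trans (^-q^2 y) (y-^q² k≈x on)) , not-both
      where
      k≈x = sym x≈x₀
      x∈ : x ^ (q ℕ.^ 2) ≈ x
      x∈ = trans (^-q^2 x) (trans (^-congˡ q (x-^q k≈x)) (x-^q k≈x))
      not-both : ¬ (In𝔽q 𝔽 𝔽̄ E x × In𝔽q 𝔽 𝔽̄ E y)
      not-both (_ , (l , l≈y)) = nonresidue (l K.- shift (Xᴷ K.+ SK.r)) (injective (begin
        embed (m K.* m)      ≈⟨ *-homo m m ⟩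
        embed m * embed m    ≈⟨ *-cong m≈Y m≈Y ⟩
        Y x y * Y x y        ≈⟨ lincomb (Y x y ∷ []) (λ Y → ⊢ Y :* Y := Y :^ 2) ⟩
        Y x y ^ 2            ≈⟨ onCurve⇒ on ⟩
        f (X x)              ≈⟨ f-cong (trans (X-cong x≈x₀) (X-x-of Xᴷ)) ⟩
        f (embed Xᴷ)         ≈⟨ f-embed Xᴷ ⟨
        embed (fᴷ Xᴷ)        ∎))
        where
        open SetoidReasoning setoid
        m = l K.- shift (Xᴷ K.+ SK.r)
        m≈Y : embed m ≈ Y x y
        m≈Y = begin
          embed m                                    ≈⟨ +-homo _ _ ⟩
          embed l + embed (K.- shift (Xᴷ K.+ SK.r))  ≈⟨ +-cong l≈y (-‿homo _) ⟩
          y - embed (shift (Xᴷ K.+ SK.r))            ≈⟨ +-congˡ (-‿cong (shift-embed k≈x)) ⟩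
          y - (s * x - w)                            ≈⟨ lincomb (x ∷ y ∷ s ∷ w ∷ []) (λ x y s w → ⊢ y :- (s :* x :- w) := y :- s :* x :+ w) ⟩
          Y x y                                      ∎

-- Classes modulo squares and modulo cubes.

module SquareClasses {c ℓ₁ ℓ₂} (𝔽 : FiniteField c ℓ₁ ℓ₂) {t : FiniteField.Carrier 𝔽}
  (nonresidue : IsQuadraticNonResidue (FiniteField.fld 𝔽) t) where
  open FiniteField 𝔽 hiding (zero)
  open FieldProperties fld
  open FiniteFieldProperties 𝔽

  t≉0 : t ≉ 0#
  t≉0 t≈0 = nonresidue 0# (trans (zeroˡ 0#) (sym t≈0))

  -- In characteristic 2 squaring is injective, hence onto for a finite field, and `t` would be a
  -- square.
  2≉0 : 2 · 1# ≉ 0#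
  2≉0 2≈0 with surjective-of-injective {_^ 2} (λ {x} {y} eq → [ (λ x≈y → x≈y) , (λ x≈-y → lincomb (x ∷ y ∷ [])
      (λ x y → :1 :× x := :- y ⊢ :- y :× 2 :· :1 := :0 ⊢ ⊢ x := y) x≈-y 2≈0) ]′ (square-≈ eq)) t
  ... | s , s²≈t = nonresidue s (trans (lincomb (s ∷ []) (λ s → ⊢ s :* s := s :^ 2)) s²≈t)

  private
    ζ : Fin 2 → Carrier
    ζ zero    = 1#
    ζ (suc _) = - 1#

    fibre : ∀ {x y} → y ≉ 0# → x ^ 2 ≈ y ^ 2 → ∃[ i ] x ≈ ζ i * y
    fibre {x} {y} _ eq =
      [ (λ x≈y → zero , trans x≈y (sym (*-identityˡ y)))
      , (λ x≈-y → suc zero , trans x≈-y (lincomb (y ∷ []) (λ y → ⊢ :- y := (:- :1) :* y))) ]′ (square-≈ eq)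

    quotient : ∀ {x y} → y ≉ 0# → ¬ ((t ^ 0) * x ^ 2 ≈ (t ^ 1) * y ^ 2)
    quotient {x} {y} y≉0 eq = nonresidue (x * y ⁻¹) (lincomb (x ∷ y ∷ y ⁻¹ ∷ t ∷ []) (λ x y i t →
      i :^ 2 :× :1 :* x :^ 2 := (t :* :1) :* y :^ 2 ⊢
      t :* (y :* i :+ :1) :× y :* i := :1 ⊢
      ⊢ (x :* i) :* (x :* i) := t) eq (⁻¹-inverseʳ y≉0))

    independent : ∀ {i j : Fin 2} {x y} → x ≉ 0# → y ≉ 0# →
                  t ^ toℕ i * x ^ 2 ≈ t ^ toℕ j * y ^ 2 → i ≡ j
    independent {zero}     {zero}     _   _   _  = ≡.refl
    independent {zero}     {suc zero} _   y≉0 eq = contradiction eq (quotient y≉0)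
    independent {suc zero} {zero}     x≉0 _   eq = contradiction (sym eq) (quotient x≉0)
    independent {suc zero} {suc zero} _   _   _  = ≡.refl

  -- The squares have index 2, so all nonsquares lie in the coset of `t`.
  nonresidue⇒t*square : ∀ {g} → IsQuadraticNonResidue fld g → ∃[ s ] s ≉ 0# × g ≈ t * s ^ 2
  nonresidue⇒t*square {g} g-nonresidue = case (decompose g≉0)
    where
    open PowerCosets (proj₂ units) 2 t≉0 ζ fibre independent
    g≉0 : g ≉ 0#
    g≉0 g≈0 = g-nonresidue 0# (trans (zeroˡ 0#) (sym g≈0))
    case : ∃[ p ] element-of p ≈ g → ∃[ s ] s ≉ 0# × g ≈ t * s ^ 2
    case ((zero , j) , eq) = contradiction (trans (lincomb (root j ∷ []) (λ s → ⊢ s :* s := :1 :* s :^ 2)) eq) (g-nonresidue (root j))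
    case ((suc zero , j) , eq) = root j , root≉0 j , trans (sym eq) (*-congʳ (*-identityʳ t))

module CubeClasses {c ℓ₁ ℓ₂ d m₁ m₂} (𝔽 : FiniteField c ℓ₁ ℓ₂) (C : HeytingField d m₁ m₂)
  (character : CubicCharacter (FiniteField.fld 𝔽) C) {ρ : HeytingField.Carrier C} {b₀ : FiniteField.Carrier 𝔽}
  (ρ-primitive : IsPrimitiveCubeRoot C ρ)
  (χb₀≈ρ : HeytingField._≈_ C (CubicCharacter.χ character b₀) ρ) where
  private
    module C where
      open HeytingField C public using (_#_; #-irrefl; heytingCommutativeRing)
      open HeytingCommutativeRing heytingCommutativeRing public using (commutativeRing)
      open CommutativeRing commutativeRing public
      open Algebra.Definitions.RawSemiring (Semiring.rawSemiring semiring) public using (_^_)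
      open LinearCombination commutativeRing public

  open FiniteField 𝔽 hiding (zero)
  open FieldProperties fld
  open FiniteFieldProperties 𝔽
  open CubicCharacter character
  private
    ρ³≈1 = proj₁ ρ-primitive

    ρ≉1 : ρ C.≉ C.1#
    ρ≉1 ρ≈1 = C.#-irrefl ρ≈1 (proj₂ ρ-primitive)

    χ-^ : ∀ x n → χ (x ^ n) C.≈ χ x C.^ n
    χ-^ x zero    = χ-one
    χ-^ x (suc n) = C.trans (χ-homo-* x _) (C.*-congˡ (χ-^ x n))

  χ-cube : ∀ {x} → x ≉ 0# → χ (x ^ 3) C.≈ C.1#
  χ-cube {x} x≉0 = C.trans (χ-^ x 3) (χ-cubic x (≉⇒# x≉0))

  b₀≉0 : b₀ ≉ 0#
  b₀≉0 b₀≈0 = ρ≉1 (C.lincomb (ρ ∷ []) (λ ρ →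
    :1 :- ρ :^ 2 :× ρ := :0 ⊢ :1 :× ρ :* (ρ :* ρ) := :1 ⊢ ⊢ ρ := :1)
    (C.trans (C.sym χb₀≈ρ) (C.trans (χ-cong b₀≈0) χ-zero)) ρ³≈1)

  private
    ρ-^-injective : ∀ {i j : Fin 3} → ρ C.^ toℕ i C.≈ ρ C.^ toℕ j → i ≡ j
    ρ-^-injective {zero}           {zero}           _ = ≡.refl
    ρ-^-injective {suc zero}       {suc zero}       _ = ≡.refl
    ρ-^-injective {suc (suc zero)} {suc (suc zero)} _ = ≡.refl
    ρ-^-injective {zero}           {suc zero}       eq = contradiction
      (C.lincomb (ρ ∷ []) (λ ρ → :- :1 :× :1 := ρ :^ 1 ⊢ ⊢ ρ := :1) eq) ρ≉1
    ρ-^-injective {suc zero}       {zero}           eq = ≡.sym (ρ-^-injective {zero} {suc zero} (C.sym eq))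
    ρ-^-injective {zero}           {suc (suc zero)} eq = contradiction
      (C.lincomb (ρ ∷ []) (λ ρ → ρ :× :1 := ρ :^ 2 ⊢ :1 :× ρ :* (ρ :* ρ) := :1 ⊢ ⊢ ρ := :1) eq ρ³≈1) ρ≉1
    ρ-^-injective {suc (suc zero)} {zero}           eq = ≡.sym (ρ-^-injective {zero} {suc (suc zero)} (C.sym eq))
    ρ-^-injective {suc zero}       {suc (suc zero)} eq = contradiction
      (C.lincomb (ρ ∷ []) (λ ρ → :- (ρ :^ 2) :× ρ :^ 1 := ρ :^ 2 ⊢ :1 :- ρ :× ρ :* (ρ :* ρ) := :1 ⊢ ⊢ ρ := :1) eq ρ³≈1) ρ≉1
    ρ-^-injective {suc (suc zero)} {suc zero}       eq = ≡.sym (ρ-^-injective {suc zero} {suc (suc zero)} (C.sym eq))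

    χ-coset : ∀ (i : Fin 3) {x} → x ≉ 0# → χ (b₀ ^ toℕ i * x ^ 3) C.≈ ρ C.^ toℕ i
    χ-coset i {x} x≉0 = C.trans (χ-homo-* _ _) (C.trans (C.*-cong (C.trans (χ-^ b₀ (toℕ i))
      (^-congˡ (toℕ i) χb₀≈ρ)) (χ-cube x≉0)) (C.*-identityʳ _))
      where open Algebra.Properties.Semiring.Exp C.semiring using (^-congˡ)

  -- The character takes the value ρ^i on the coset of b₀^i, and 1, ρ, ρ² are distinct.
  cosets-independent : ∀ {i j : Fin 3} {x y} → x ≉ 0# → y ≉ 0# →
                       b₀ ^ toℕ i * x ^ 3 ≈ b₀ ^ toℕ j * y ^ 3 → i ≡ j
  cosets-independent {i} {j} x≉0 y≉0 eq =
    ρ-^-injective (C.trans (C.sym (χ-coset i x≉0)) (C.trans (χ-cong eq) (χ-coset j y≉0)))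

  private
    b₀-not-cube : ∀ z → ¬ (z ^ 3 ≈ b₀)
    b₀-not-cube z z³≈b₀ = ρ≉1 (C.trans (C.sym χb₀≈ρ) (C.trans (χ-cong (sym z³≈b₀)) (χ-cube z≉0)))
      where
      z≉0 : z ≉ 0#
      z≉0 z≈0 = b₀≉0 (lincomb (z ∷ b₀ ∷ []) (λ z b → :- :1 :× z :^ 3 := b ⊢ z :^ 2 :× z := :0 ⊢ ⊢ b := :0) z³≈b₀ z≈0)

    -- Cubing is not injective, since b₀ is not a cube.
    cube-root-of-unity : ∃[ ω ] ω ≉ 1# × ω ^ 3 ≈ 1#
    cube-root-of-unity with any? (λ i → any? (λ j →
      ¬? (element i ≈? element j) ×-dec element i ^ 3 ≈? element j ^ 3))
    ... | no none = contradiction (proj₂ cube-root) (b₀-not-cube _)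
      where
      cube-injective : ∀ {x y} → x ^ 3 ≈ y ^ 3 → x ≈ y
      cube-injective {x} {y} eq with x ≈? y
      ... | yes x≈y = x≈y
      ... | no  x≉y = contradiction (index x , index y ,
        (λ eq′ → x≉y (trans (sym (element-index x)) (trans eq′ (element-index y)))) ,
        trans (^-congˡ 3 (element-index x)) (trans eq (^-congˡ 3 (sym (element-index y))))) none
        where open Algebra.Properties.Semiring.Exp semiring using (^-congˡ)
      cube-root = surjective-of-injective {_^ 3} cube-injective b₀
    ... | yes (i , j , x≉y , x³≈y³) = x * y ⁻¹ , ω≉1 , ω³≈1
      where
      x = element i
      y = element j
      y≉0 : y ≉ 0#
      y≉0 y≈0 with x ≈? 0#
      ... | yes x≈0 = x≉y (trans x≈0 (sym y≈0))
      ... | no  x≉0 = ^-nonzero 3 x≉0 (lincomb (x ∷ y ∷ []) (λ x y →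
        :1 :× x :^ 3 := y :^ 3 ⊢ y :^ 2 :× y := :0 ⊢ ⊢ x :^ 3 := :0) x³≈y³ y≈0)
      ω≉1 : x * y ⁻¹ ≉ 1#
      ω≉1 ω≈1 = x≉y (lincomb (x ∷ y ∷ y ⁻¹ ∷ []) (λ x y i →
        y :× x :* i := :1 ⊢ :- x :× y :* i := :1 ⊢ ⊢ x := y) ω≈1 (⁻¹-inverseʳ y≉0))
      ω³≈1 : (x * y ⁻¹) ^ 3 ≈ 1#
      ω³≈1 = lincomb (x ∷ y ∷ y ⁻¹ ∷ []) (λ x y i →
        i :^ 3 :× x :^ 3 := y :^ 3 ⊢ y :^ 2 :* i :^ 2 :+ y :* i :+ :1 :× y :* i := :1 ⊢ ⊢ (x :* i) :^ 3 := :1)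
        x³≈y³ (⁻¹-inverseʳ y≉0)

    ω = proj₁ cube-root-of-unity
    ω-1≉0 : ω - 1# ≉ 0#
    ω-1≉0 eq = proj₁ (proj₂ cube-root-of-unity) (lincomb (ω ∷ []) (λ ω → :1 :× ω :- :1 := :0 ⊢ ⊢ ω := :1) eq)
    ω³≈1 = proj₂ (proj₂ cube-root-of-unity)

    ω²+ω+1≈0 : ω ^ 2 + ω + 1# ≈ 0#
    ω²+ω+1≈0 = *-zero-divisor (lincomb (ω ∷ []) (λ ω →
      :1 :× ω :^ 3 := :1 ⊢ ⊢ (ω :- :1) :* (ω :^ 2 :+ ω :+ :1) := :0) ω³≈1) ω-1≉0

    -- The last value is ω², in the form given by ω² + ω + 1 = 0.
    ζ : Fin 3 → Carrier
    ζ zero             = 1#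
    ζ (suc zero)       = ω
    ζ (suc (suc zero)) = - (1# + ω)

    fibre : ∀ {x y} → y ≉ 0# → x ^ 3 ≈ y ^ 3 → ∃[ i ] x ≈ ζ i * y
    fibre {x} {y} _ x³≈y³ =
      [ (λ eq → zero , lincomb (x ∷ y ∷ []) (λ x y → :1 :× x :- y := :0 ⊢ ⊢ x := :1 :* y) eq)
      , (λ eq → [ (λ eq → suc zero , lincomb (x ∷ y ∷ ω ∷ []) (λ x y ω → :1 :× x :- ω :* y := :0 ⊢ ⊢ x := ω :* y) eq)
                , (λ eq → suc (suc zero) , lincomb (x ∷ y ∷ ω ∷ []) (λ x y ω →
                     :1 :× x :+ (:1 :+ ω) :* y := :0 ⊢ ⊢ x := :- (:1 :+ ω) :* y) eq) ]′ (*-zero⇒ eq)) ]′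
      (*-zero⇒ {x - y} {(x - ω * y) * (x + (1# + ω) * y)} (lincomb (x ∷ y ∷ ω ∷ []) (λ x y ω →
        :1 :× x :^ 3 := y :^ 3 ⊢ :- ((x :- y) :* y :^ 2) :× ω :^ 2 :+ ω :+ :1 := :0 ⊢
        ⊢ (x :- y) :* ((x :- ω :* y) :* (x :+ (:1 :+ ω) :* y)) := :0) x³≈y³ ω²+ω+1≈0))

  -- In characteristic 3 one has (ω - 1)³ = ω³ - 1 = 0, although ω ≠ 1.
  3≉0 : 3 · 1# ≉ 0#
  3≉0 3≈0 = ^-nonzero 3 ω-1≉0 (lincomb (ω ∷ []) (λ ω →
    :1 :× ω :^ 3 := :1 ⊢ ω :- ω :^ 2 :× 3 :· :1 := :0 ⊢ ⊢ (ω :- :1) :^ 3 := :0) ω³≈1 3≈0)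

  open PowerCosets (proj₂ units) 3 b₀≉0 ζ fibre cosets-independent public

  size≡ : size ≡ suc (3 ℕ.* k)
  size≡ = ≡.trans (Units.size≡ (proj₂ units)) (≡.cong suc units-size)

  -- On b₀^i z³ the character is ρ^i, and this is 1 only for i = 0.
  χ≈1⇒cube : ∀ {x} → x ≉ 0# → χ x C.≈ C.1# → ∃[ z ] z ≉ 0# × z ^ 3 ≈ x
  χ≈1⇒cube {x} x≉0 χx≈1 = case (decompose x≉0)
    where
    case : ∃[ p ] element-of p ≈ x → ∃[ z ] z ≉ 0# × z ^ 3 ≈ x
    case ((zero  , j) , eq) = root j , root≉0 j , trans (sym (*-identityˡ _)) eq
    case ((suc i , j) , eq) = contradiction (ρ-^-injective {suc i} {zero}
      (C.trans (C.sym (χ-coset (suc i) (root≉0 j))) (C.trans (χ-cong eq) χx≈1))) λ ()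

-- The model curves with a marked root of ψ.

module _ {n : ℕ} where
  -- The factor `l` is a quadratic twist: X is multiplied by l, hence A by l² and B by l³.
  :modelA :modelB : (l α β : Expr n) → Expr n
  :modelA l α β = l :^ 2 :* (6 :· (α :* β) :- 27 :· α :^ 4)
  :modelB l α β = l :^ 3 :* (β :^ 2 :- 18 :· (α :^ 3 :* β) :+ 54 :· α :^ 6)

-- With a = 6α and b = 2β, the curve y² + axy + by = x³ has the short form
-- Y² = X³ + (6αβ − 27α⁴) X + (β² − 18α³β + 54α⁶), in which the point (0 , 0)
-- becomes (3α² , β), and a³ − 27b = 54 (4α³ − β).
module Model {c ℓ₁ ℓ₂} (F : Field c ℓ₁ ℓ₂)
  (2≉0 : ¬ (Field._≈_ F (Field._·_ F 2 (Field.1# F)) (Field.0# F)))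
  (3≉0 : ¬ (Field._≈_ F (Field._·_ F 3 (Field.1# F)) (Field.0# F))) where
  open Field F hiding (zero)
  open FieldProperties F
  open Curves F

  private
    :0ᶠ :1ᶠ :2ᶠ : Expr 3
    :0ᶠ = var zero
    :1ᶠ = var (suc zero)
    :2ᶠ = var (suc (suc zero))

  division₃-cong : ∀ {A B X A′ B′ X′} → A ≈ A′ → B ≈ B′ → X ≈ X′ → division₃ A B X ≈ division₃ A′ B′ X′
  division₃-cong {A} {B} {X} {A′} {B′} {X′} A≈ B≈ X≈ = ⟦ :division₃ :0ᶠ :1ᶠ :2ᶠ ⟧-cong
    {A ∷ B ∷ X ∷ []} {A′ ∷ B′ ∷ X′ ∷ []} (A≈ ∷ B≈ ∷ X≈ ∷ [])

  cubic-cong : ∀ {A B X A′ B′ X′} → A ≈ A′ → B ≈ B′ → X ≈ X′ → cubic A B X ≈ cubic A′ B′ X′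
  cubic-cong {A} {B} {X} {A′} {B′} {X′} A≈ B≈ X≈ = ⟦ :cubic :0ᶠ :1ᶠ :2ᶠ ⟧-cong
    {A ∷ B ∷ X ∷ []} {A′ ∷ B′ ∷ X′ ∷ []} (A≈ ∷ B≈ ∷ X≈ ∷ [])

  2·≉0 : ∀ {x} → x ≉ 0# → 2 · x ≉ 0#
  2·≉0 {x} x≉0 eq = *-nonzero 2≉0 x≉0 (lincomb (x ∷ []) (λ x → :1 :× 2 :· x := :0 ⊢ ⊢ (2 :· :1) :* x := :0) eq)

  3·≉0 : ∀ {x} → x ≉ 0# → 3 · x ≉ 0#
  3·≉0 {x} x≉0 eq = *-nonzero 3≉0 x≉0 (lincomb (x ∷ []) (λ x → :1 :× 3 :· x := :0 ⊢ ⊢ (3 :· :1) :* x := :0) eq)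

  modelA modelB : (l α β : Carrier) → Carrier
  modelA l α β = l ^ 2 * (6 · (α * β) - 27 · α ^ 4)
  modelB l α β = l ^ 3 * (β ^ 2 - 18 · (α ^ 3 * β) + 54 · α ^ 6)

  module ModelCurve {A B l α β : Carrier} (A≈ : A ≈ modelA l α β) (B≈ : B ≈ modelB l α β)
    (l≉0 : l ≉ 0#) (β≉0 : β ≉ 0#) where

    X₀ : Carrier
    X₀ = l * (3 · α ^ 2)

    κ : Carrier
    κ = 216 · α ^ 3 - 54 · β

    -- `w` is the abscissa x on y² + axy + by = x³, whose 3-division polynomial is x (3x³ + a²x² +
    -- 3abx + 3b²).
    model-division₃ : ∀ w → division₃ A B (l * (3 · α ^ 2 + w)) ≈
      l ^ 4 * w * (3 · w ^ 3 + 36 · (α ^ 2 * w ^ 2) + 36 · (α * β * w) + 12 · β ^ 2)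
    model-division₃ w = trans (division₃-cong A≈ B≈ refl) (lincomb (l ∷ α ∷ β ∷ w ∷ []) (λ l α β w →
      ⊢ :division₃ (:modelA l α β) (:modelB l α β) (l :* (3 :· α :^ 2 :+ w)) :=
        l :^ 4 :* w :* (3 :· w :^ 3 :+ 36 :· (α :^ 2 :* w :^ 2) :+ 36 :· (α :* β :* w) :+ 12 :· β :^ 2)))

    model-root : division₃ A B X₀ ≈ 0#
    model-root = trans (division₃-cong refl refl (lincomb (l ∷ α ∷ []) (λ l α →
        ⊢ l :* (3 :· α :^ 2) := l :* (3 :· α :^ 2 :+ :0))))
      (trans (model-division₃ 0#) (lincomb (l ∷ α ∷ β ∷ []) (λ l α β →
        ⊢ l :^ 4 :* :0 :* (3 :· :0 :^ 3 :+ 36 :· (α :^ 2 :* :0 :^ 2) :+ 36 :· (α :* β :* :0) :+ 12 :· β :^ 2) := :0)))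

    model-cubic : cubic A B X₀ ≈ l ^ 3 * β ^ 2
    model-cubic = trans (cubic-cong A≈ B≈ refl) (lincomb (l ∷ α ∷ β ∷ []) (λ l α β →
      ⊢ :cubic (:modelA l α β) (:modelB l α β) (l :* (3 :· α :^ 2)) := l :^ 3 :* β :^ 2))

    model-cubic′ : 3 · X₀ ^ 2 + A ≈ l ^ 2 * (6 · (α * β))
    model-cubic′ = lincomb (l ∷ α ∷ β ∷ A ∷ []) (λ l α β A →
      :1 :× A := :modelA l α β ⊢
      ⊢ :cubic′ A :0 (l :* (3 :· α :^ 2)) := l :^ 2 :* (6 :· (α :* β))) A≈

    quartic : Carrier → Carrier
    quartic w = 3 · w ^ 3 + 36 · (α ^ 2 * w ^ 2) + 36 · (α * β * w) + 12 · β ^ 2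

    -- Up to the twist this is the discriminant b³ (a³ - 27b). The left side depends on α only
    -- through α³, which serves as a single variable in the final identity.
    model-discriminant : 2 · (4 · A ^ 3 + 27 · B ^ 2) ≈ - (l ^ 6 * (β ^ 3 * κ))
    model-discriminant = trans
      (⟦ 2 :· (4 :· var zero :^ 3 :+ 27 :· var (suc zero) :^ 2) ⟧-cong
        {A ∷ B ∷ []} {l ^ 2 * (α * P) ∷ l ^ 3 * Q ∷ []}
        (trans A≈ (lincomb (l ∷ α ∷ β ∷ []) (λ l α β →
           ⊢ :modelA l α β := l :^ 2 :* (α :* (6 :· β :- 27 :· α :^ 3)))) ∷
         trans B≈ (lincomb (l ∷ α ∷ β ∷ []) (λ l α β →
           ⊢ :modelB l α β := l :^ 3 :* (β :^ 2 :- 18 :· (α :^ 3 :* β) :+ 54 :· (α :^ 3) :^ 2))) ∷ []))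
      (trans (lincomb (l ∷ α ∷ P ∷ Q ∷ []) (λ l α P Q →
         ⊢ 2 :· (4 :· (l :^ 2 :* (α :* P)) :^ 3 :+ 27 :· (l :^ 3 :* Q) :^ 2) :=
           l :^ 6 :* (2 :· (4 :· (α :^ 3 :* P :^ 3) :+ 27 :· Q :^ 2))))
      (lincomb (l ^ 6 ∷ α ^ 3 ∷ β ∷ []) (λ l⁶ c β →
         ⊢ l⁶ :* (2 :· (4 :· (c :* (6 :· β :- 27 :· c) :^ 3) :+ 27 :· (β :^ 2 :- 18 :· (c :* β) :+ 54 :· c :^ 2) :^ 2)) :=
           :- (l⁶ :* (β :^ 3 :* (216 :· c :- 54 :· β))))))
      where
      P = 6 · β - 27 · α ^ 3
      Q = β ^ 2 - 18 · (α ^ 3 * β) + 54 · (α ^ 3) ^ 2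

    nonsingular⇒κ≉0 : 4 · A ^ 3 + 27 · B ^ 2 ≉ 0# → κ ≉ 0#
    nonsingular⇒κ≉0 δ≉0 κ≈0 = 2·≉0 δ≉0 (lincomb (l ∷ β ∷ κ ∷ 4 · A ^ 3 + 27 · B ^ 2 ∷ []) (λ l β κ δ →
      :1 :× 2 :· δ := :- (l :^ 6 :* (β :^ 3 :* κ)) ⊢ :- (l :^ 6 :* β :^ 3) :× κ := :0 ⊢
      ⊢ 2 :· δ := :0) model-discriminant κ≈0)

    κ≉0⇒nonsingular : κ ≉ 0# → 4 · A ^ 3 + 27 · B ^ 2 ≉ 0#
    κ≉0⇒nonsingular κ≉0 δ≈0 = *-nonzero (^-nonzero 6 l≉0) (*-nonzero (^-nonzero 3 β≉0) κ≉0)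
      (lincomb (l ∷ β ∷ κ ∷ 4 · A ^ 3 + 27 · B ^ 2 ∷ []) (λ l β κ δ →
        :1 :× 2 :· δ := :- (l :^ 6 :* (β :^ 3 :* κ)) ⊢ :- (2 :· :1) :× δ := :0 ⊢
        ⊢ l :^ 6 :* (β :^ 3 :* κ) := :0) model-discriminant δ≈0)

    -- Dividing the quartic factor by w³ and completing the cube gives
    -- (6α + 6β/w)³ = κ.
    root⇒cube : ∀ {X} → division₃ A B X ≈ 0# → X ≉ X₀ → ∃[ d ] d ^ 3 ≈ κ
    root⇒cube {X} ψ≈0 X≉X₀ = 6 · α + 6 · (β * w ⁻¹) , lincomb
      (α ∷ β ∷ w ∷ w ⁻¹ ∷ []) (λ α β w i →
        18 :· (β :* i :^ 3) :×
          3 :· w :^ 3 :+ 36 :· (α :^ 2 :* w :^ 2) :+ 36 :· (α :* β :* w) :+ 12 :· β :^ 2 := :0 ⊢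
        :- (54 :· (β :* ((w :* i) :^ 2 :+ w :* i :+ :1)) :+ 648 :· (α :^ 2 :* β :* i :* (w :* i :+ :1))
           :+ 648 :· (α :* β :^ 2 :* i :^ 2)) :× w :* i := :1 ⊢
        ⊢ (6 :· α :+ 6 :· (β :* i)) :^ 3 := 216 :· α :^ 3 :- 54 :· β) quartic≈0 (⁻¹-inverseʳ w≉0)
      where
      w = (X - X₀) * l ⁻¹
      X≈ : l * (3 · α ^ 2 + w) ≈ X
      X≈ = lincomb (l ∷ l ⁻¹ ∷ α ∷ X ∷ []) (λ l i α X →
        X :- l :* (3 :· α :^ 2) :× l :* i := :1 ⊢
        ⊢ l :* (3 :· α :^ 2 :+ (X :- l :* (3 :· α :^ 2)) :* i) := X) (⁻¹-inverseʳ l≉0)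
      w≉0 : w ≉ 0#
      w≉0 w≈0 = X≉X₀ (trans (sym X≈) (lincomb (l ∷ α ∷ w ∷ []) (λ l α w →
        l :× w := :0 ⊢ ⊢ l :* (3 :· α :^ 2 :+ w) := l :* (3 :· α :^ 2)) w≈0))
      quartic≈0 : quartic w ≈ 0#
      quartic≈0 = *-zero-divisor (trans (sym (model-division₃ w)) (trans (division₃-cong refl refl X≈) ψ≈0))
        (*-nonzero (^-nonzero 4 l≉0) w≉0)

    -- Solve d = 6α + 6β/w for w. The denominator d - 6α is nonzero, because d = 6α would give 54β =
    -- 0.
    cube⇒root : ∀ {d} → d ^ 3 ≈ κ → ∃[ X ] division₃ A B X ≈ 0# × X ≉ X₀
    cube⇒root {d} d³≈κ = l * (3 · α ^ 2 + w) , ψ≈0 , X≉X₀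
      where
      e = d - 6 · α
      w = 6 · (β * e ⁻¹)
      e≉0 : e ≉ 0#
      e≉0 e≈0 = 2·≉0 (3·≉0 (3·≉0 (3·≉0 β≉0))) (lincomb (α ∷ β ∷ d ∷ []) (λ α β d →
        :- (d :^ 2 :+ 6 :· (α :* d) :+ 36 :· α :^ 2) :× d :- 6 :· α := :0 ⊢
        :1 :× d :^ 3 := 216 :· α :^ 3 :- 54 :· β ⊢
        ⊢ 2 :· 3 :· 3 :· 3 :· β := :0) e≈0 d³≈κ)
      quartic≈0 : quartic w ≈ 0#
      quartic≈0 = lincomb (α ∷ β ∷ d ∷ e ⁻¹ ∷ []) (λ α β d i → let e = d :- 6 :· α ; w = 6 :· (β :* i) in
        12 :· (β :^ 2 :* i :^ 3) :× d :^ 3 := 216 :· α :^ 3 :- 54 :· β ⊢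
        :- (12 :· β :^ 2 :* (108 :· (α :^ 2 :* i :^ 2) :+ 18 :· (α :* i :* (e :* i :+ :1)) :+ (e :* i) :^ 2 :+ e :* i :+ :1))
          :× e :* i := :1 ⊢
        ⊢ 3 :· w :^ 3 :+ 36 :· (α :^ 2 :* w :^ 2) :+ 36 :· (α :* β :* w) :+ 12 :· β :^ 2 := :0)
        d³≈κ (⁻¹-inverseʳ e≉0)
      ψ≈0 : division₃ A B (l * (3 · α ^ 2 + w)) ≈ 0#
      ψ≈0 = trans (model-division₃ w) (trans (*-congˡ quartic≈0) (zeroʳ _))
      X≉X₀ : l * (3 · α ^ 2 + w) ≉ X₀
      X≉X₀ eq = *-nonzero l≉0 (2·≉0 (3·≉0 (*-nonzero β≉0 (⁻¹-nonzero e≉0))))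
        (lincomb (l ∷ α ∷ β ∷ e ⁻¹ ∷ []) (λ l α β i →
          :1 :× l :* (3 :· α :^ 2 :+ 6 :· (β :* i)) := l :* (3 :· α :^ 2) ⊢
          ⊢ l :* (2 :· 3 :· (β :* i)) := :0) eq)

  -- The value of the cubic at a root of the division polynomial determines
  -- l³β², and its derivative there l²αβ.
  root⇒model : ∀ {A B X l α β} → l ≉ 0# → β ≉ 0# → division₃ A B X ≈ 0# →
               cubic A B X ≈ l ^ 3 * β ^ 2 → 3 · X ^ 2 + A ≈ l ^ 2 * (6 · (α * β)) →
               X ≈ l * (3 · α ^ 2) × A ≈ modelA l α β × B ≈ modelB l α β
  root⇒model {A} {B} {X} {l} {α} {β} l≉0 β≉0 ψ≈0 f≈ f′≈ = X≈ , A≈ , B≈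
    where
    X≈ : X ≈ l * (3 · α ^ 2)
    -- By ψ = 12 X f - f′², the vanishing of ψ reads 12 X l³β² = 36 l⁴α²β².
    X≈ = ≈-by-* (2·≉0 (2·≉0 (3·≉0 (*-nonzero (^-nonzero 3 l≉0) (^-nonzero 2 β≉0)))))
      (lincomb (A ∷ B ∷ X ∷ l ∷ α ∷ β ∷ []) (λ A B X l α β → 
        :- (12 :· X) :× :cubic A B X := l :^ 3 :* β :^ 2 ⊢
        :cubic′ A B X :+ l :^ 2 :* (6 :· (α :* β)) :× :cubic′ A B X := l :^ 2 :* (6 :· (α :* β)) ⊢
        :1 :× :division₃ A B X := :0 ⊢
        ⊢ 2 :· 2 :· 3 :· (l :^ 3 :* β :^ 2) :* (X :- l :* (3 :· α :^ 2)) := :0) f≈ f′≈ ψ≈0)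
    A≈ : A ≈ modelA l α β
    A≈ = lincomb (A ∷ X ∷ l ∷ α ∷ β ∷ []) (λ A X l α β →
      :1 :× :cubic′ A :0 X := l :^ 2 :* (6 :· (α :* β)) ⊢
      :- (3 :· (X :+ l :* (3 :· α :^ 2))) :× X := l :* (3 :· α :^ 2) ⊢
      ⊢ A := :modelA l α β) f′≈ X≈
    B≈ : B ≈ modelB l α β
    B≈ = lincomb (A ∷ B ∷ X ∷ l ∷ α ∷ β ∷ []) (λ A B X l α β → let Z = l :* (3 :· α :^ 2) in
      :1 :× :cubic A B X := l :^ 3 :* β :^ 2 ⊢
      :- (X :^ 2 :+ X :* Z :+ Z :^ 2 :+ :modelA l α β) :× X := Z ⊢
      :- X :× A := :modelA l α β ⊢
      ⊢ B := :modelB l α β) f≈ X≈ A≈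

-- Classification of the curves up to isomorphism.

module Classification {c ℓ₁ ℓ₂ c′ ℓ₁′ ℓ₂′ d m₁ m₂} (𝔽 : FiniteField c ℓ₁ ℓ₂)
  (𝔽̄ : AlgebraicClosure (FiniteField.fld 𝔽) c′ ℓ₁′ ℓ₂′) (C : HeytingField d m₁ m₂)
  (character : CubicCharacter (FiniteField.fld 𝔽) C) {ρ : HeytingField.Carrier C} {b₀ t : FiniteField.Carrier 𝔽}
  (ρ-primitive : IsPrimitiveCubeRoot C ρ)
  (χb₀≈ρ : HeytingField._≈_ C (CubicCharacter.χ character b₀) ρ)
  (nonresidue : IsQuadraticNonResidue (FiniteField.fld 𝔽) t) where
  open FiniteField 𝔽 hiding (zero)
  open FieldProperties fld
  open SquareClasses 𝔽 nonresidue
  open CubeClasses 𝔽 C character ρ-primitive χb₀≈ρ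
  open Curves fld
  open Model fld 2≉0 3≉0
  open Family fld C character b₀ t
  open CubicCharacter character using (χ; χ-cong)
  private
    module C = HeytingField C

    P : EllipticCurve fld → Set _
    P = OnlyOneRationalSubgroupOfOrder3 𝔽 𝔽̄

    6≉0 : 6 · 1# ≉ 0#
    6≉0 eq = 2·≉0 3≉0 (lincomb {0} [] (:1 :× 6 :· :1 := :0 ⊢ ⊢ 2 :· 3 :· :1 := :0) eq)

    -- For the denominators 48, 4, 864 and 24 of the family.
    powers≉0 : ∀ {x} m n → x ≈ (2 · 1#) ^ m * (3 · 1#) ^ n → x ≉ 0#
    powers≉0 m n x≈ x≈0 = *-nonzero (^-nonzero m 2≉0) (^-nonzero n 3≉0) (trans (sym x≈) x≈0)

  half sixth : Carrier → Carrier
  half  b = b * (2 · 1#) ⁻¹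
  sixth a = a * (6 · 1#) ⁻¹

  2·half : ∀ b → 2 · half b ≈ b
  2·half b = lincomb (b ∷ (2 · 1#) ⁻¹ ∷ []) (λ b i → b :× (2 :· :1) :* i := :1 ⊢ ⊢ 2 :· (b :* i) := b) (⁻¹-inverseʳ 2≉0)

  6·sixth : ∀ a → 6 · sixth a ≈ a
  6·sixth a = lincomb (a ∷ (6 · 1#) ⁻¹ ∷ []) (λ a i → a :× (6 :· :1) :* i := :1 ⊢ ⊢ 6 :· (a :* i) := a) (⁻¹-inverseʳ 6≉0)

  A-model : ∀ {a b α β} → a ≈ 6 · α → b ≈ 2 · β → t ^ 2 * A a b ≈ modelA t α β
  A-model {a} {b} {α} {β} a≈ b≈ = *-congˡ (trans
    (⟦ :- (var zero :* (var zero :^ 3 :- 24 :· var (suc zero))) :* var (suc (suc zero)) ⟧-cong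
      {a ∷ b ∷ (48 · 1#) ⁻¹ ∷ []} {6 · α ∷ 2 · β ∷ (48 · 1#) ⁻¹ ∷ []} (a≈ ∷ b≈ ∷ refl ∷ []))
    (lincomb (α ∷ β ∷ (48 · 1#) ⁻¹ ∷ []) (λ α β i →
      6 :· (α :* β) :- 27 :· α :^ 4 :× (48 :· :1) :* i := :1 ⊢
      ⊢ :- (6 :· α :* ((6 :· α) :^ 3 :- 24 :· 2 :· β)) :* i := 6 :· (α :* β) :- 27 :· α :^ 4)
      (⁻¹-inverseʳ (powers≉0 4 1 (lincomb {0} [] (⊢ 48 :· :1 := (2 :· :1) :^ 4 :* (3 :· :1) :^ 1))))))

  B-model : ∀ {a b α β} → a ≈ 6 · α → b ≈ 2 · β → t ^ 3 * B a b ≈ modelB t α β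
  B-model {a} {b} {α} {β} a≈ b≈ = *-congˡ (trans
    (⟦ var (suc zero) :^ 2 :* i₄ :+ var zero :^ 6 :* i₈₆₄ :- (var zero :^ 3 :* var (suc zero)) :* i₂₄ ⟧-cong
      {a ∷ b ∷ (4 · 1#) ⁻¹ ∷ (864 · 1#) ⁻¹ ∷ (24 · 1#) ⁻¹ ∷ []}
      {6 · α ∷ 2 · β ∷ (4 · 1#) ⁻¹ ∷ (864 · 1#) ⁻¹ ∷ (24 · 1#) ⁻¹ ∷ []} (a≈ ∷ b≈ ∷ refl ∷ refl ∷ refl ∷ []))
    (lincomb (α ∷ β ∷ (4 · 1#) ⁻¹ ∷ (864 · 1#) ⁻¹ ∷ (24 · 1#) ⁻¹ ∷ []) (λ α β i₄ i₈₆₄ i₂₄ →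
      β :^ 2                   :× (4 :· :1) :* i₄ := :1 ⊢
      54 :· α :^ 6             :× (864 :· :1) :* i₈₆₄ := :1 ⊢
      :- (18 :· (α :^ 3 :* β)) :× (24 :· :1) :* i₂₄ := :1 ⊢
      ⊢ (2 :· β) :^ 2 :* i₄ :+ (6 :· α) :^ 6 :* i₈₆₄ :- ((6 :· α) :^ 3 :* (2 :· β)) :* i₂₄ :=
        β :^ 2 :- 18 :· (α :^ 3 :* β) :+ 54 :· α :^ 6)
      (⁻¹-inverseʳ (powers≉0 2 0 (lincomb {0} [] (⊢ 4 :· :1 := (2 :· :1) :^ 2 :* (3 :· :1) :^ 0))))
      (⁻¹-inverseʳ (powers≉0 5 3 (lincomb {0} [] (⊢ 864 :· :1 := (2 :· :1) :^ 5 :* (3 :· :1) :^ 3))))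
      (⁻¹-inverseʳ (powers≉0 3 1 (lincomb {0} [] (⊢ 24 :· :1 := (2 :· :1) :^ 3 :* (3 :· :1) :^ 1))))))
    where
    i₄ i₈₆₄ i₂₄ : Expr 5
    i₄   = var (suc (suc zero))
    i₈₆₄ = var (suc (suc (suc zero)))
    i₂₄  = var (suc (suc (suc (suc zero))))

  family-shortForm : ∀ i a → ShortForm (equationOf i a)
  family-shortForm i a = record
    { s = 0# ; r = 0# ; w = 0# ; A = A′ ; B = B′
    ; a₁≈ = lincomb {0} [] (⊢ :0 := :- (2 :· :0))
    ; a₂≈ = lincomb {0} [] (⊢ :0 := :- (3 :· :0 :+ :0 :^ 2))
    ; a₃≈ = lincomb {0} [] (⊢ :0 := 2 :· :0)
    ; a₄≈ = lincomb (A′ ∷ []) (λ A → ⊢ A := A :+ 3 :· :0 :^ 2 :+ 2 :· (:0 :* :0))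
    ; a₆≈ = lincomb (A′ ∷ B′ ∷ []) (λ A B → ⊢ B := B :- :0 :* A :- :0 :^ 3 :- :0 :^ 2)
    }
    where
    A′ = t ^ 2 * A a (b₀ ^ toℕ i)
    B′ = t ^ 3 * B a (b₀ ^ toℕ i)

  module FamilyCurve (i : Fin 3) (a : Carrier) where
    b α β : Carrier
    b = b₀ ^ toℕ i
    α = sixth a
    β = half b

    a≈6α : a ≈ 6 · α
    a≈6α = sym (6·sixth a)

    b≈2β : b ≈ 2 · β
    b≈2β = sym (2·half b)

    b≉0 : b ≉ 0#
    b≉0 = ^-nonzero (toℕ i) b₀≉0

    β≉0 : β ≉ 0#
    β≉0 = *-nonzero b≉0 (⁻¹-nonzero 2≉0)

    open ModelCurve (A-model a≈6α b≈2β) (B-model a≈6α b≈2β) t≉0 β≉0 public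

    a³-27b≈κ : a ^ 3 - 27 · b ≈ κ
    a³-27b≈κ = trans (⟦ var zero :^ 3 :- 27 :· var (suc zero) ⟧-cong
      {a ∷ b ∷ []} {6 · α ∷ 2 · β ∷ []} (a≈6α ∷ b≈2β ∷ []))
      (lincomb (α ∷ β ∷ []) (λ α β → ⊢ (6 :· α) :^ 3 :- 27 :· 2 :· β := 216 :· α :^ 3 :- 54 :· β))

  κ-of : Fin 3 → Carrier → Carrier
  κ-of i a = a ^ 3 - 27 · b₀ ^ toℕ i

  κ-index≉0 : ∀ j → κ-of (i j) (a j) ≉ 0#
  κ-index≉0 j κ≈0 = nonsingular⇒κ≉0 (nonsingular-shortForm (family-shortForm (i j) (a j)) (nonsingular j))
    (trans (sym a³-27b≈κ) κ≈0)
    where open FamilyCurve (i j) (a j)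

  κ-index-not-cube : ∀ j d → ¬ (d ^ 3 ≈ κ-of (i j) (a j))
  κ-index-not-cube j d d³≈κ = condition j (C.trans (χ-cong (sym d³≈κ)) (χ-cube d≉0))
    where
    d≉0 : d ≉ 0#
    d≉0 d≈0 = κ-index≉0 j (trans (sym d³≈κ) (lincomb (d ∷ []) (λ d → d :^ 2 :× d := :0 ⊢ ⊢ d :^ 3 := :0) d≈0))

  makeIndex : ∀ i a → κ-of i a ≉ 0# → (∀ d → ¬ (d ^ 3 ≈ κ-of i a)) → Index
  makeIndex i a κ≉0 not-cube = record
    { i           = i
    ; a           = a
    ; condition   = λ χκ≈1 → not-cube _ (proj₂ (proj₂ (χ≈1⇒cube κ≉0 χκ≈1)))
    ; nonsingular = ≉⇒# (λ Δ≈0 → 2·≉0 (2·≉0 (2·≉0 (2·≉0 δ≉0))) (lincomb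
        (discriminant fld (equationOf i a) ∷ δ ∷ []) (λ Δ δ →
          :1 :× Δ := :- (16 :· δ) ⊢ :- :1 :× Δ := :0 ⊢ ⊢ 2 :· 2 :· 2 :· 2 :· δ := :0)
        (discriminant-shortForm (family-shortForm i a)) Δ≈0))
    }
    where
    open FamilyCurve i a
    δ = 4 · (t ^ 2 * A a b) ^ 3 + 27 · (t ^ 3 * B a b) ^ 2
    δ≉0 : δ ≉ 0#
    δ≉0 = κ≉0⇒nonsingular (λ κ≈0 → κ≉0 (trans a³-27b≈κ κ≈0))

  -- A second root would make a³ - 27b a cube, against the condition on the character.
  family-unique-root : ∀ j → let open FamilyCurve (i j) (a j) in
    ∀ X → division₃ (t ^ 2 * A (a j) b) (t ^ 3 * B (a j) b) X ≈ 0# → X ≈ X₀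
  family-unique-root j X ψ≈0 = conclude (X ≈? X₀)
    where
    open FamilyCurve (i j) (a j)
    conclude : Dec (X ≈ X₀) → X ≈ X₀
    conclude (yes X≈X₀) = X≈X₀
    conclude (no  X≉X₀) = contradiction (trans (proj₂ (root⇒cube ψ≈0 X≉X₀)) (sym a³-27b≈κ)) (κ-index-not-cube j _)

  curve∈P : ∀ j → curve j ∈ P
  curve∈P j = only-one-from (model-root , family-unique-root j) X₀-nonresidue
    where
    open FamilyCurve (i j) (a j)
    open RationalSubgroups 𝔽 𝔽̄ 2≉0 (curve j) (family-shortForm (i j) (a j))
    X₀-nonresidue : IsQuadraticNonResidue fld (cubic (t ^ 2 * A (a j) b) (t ^ 3 * B (a j) b) X₀)
    -- Here f(X₀) = t³β² = t (tβ)², so a square root of it divided by tβ is a square root of t.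
    X₀-nonresidue s s²≈ = nonresidue (s * (t * β) ⁻¹) (lincomb
      (s ∷ t ∷ β ∷ (t * β) ⁻¹ ∷ []) (λ s t β i →
        i :^ 2 :× s :* s := t :^ 3 :* β :^ 2 ⊢
        t :* (t :* β :* i :+ :1) :× t :* β :* i := :1 ⊢
        ⊢ (s :* i) :* (s :* i) := t) (trans s²≈ model-cubic) (⁻¹-inverseʳ (*-nonzero t≉0 β≉0)))

  Scaled : (A B A′ B′ : Carrier) → Set _
  Scaled A B A′ B′ = ∃[ u ] u ≉ 0# × A ≈ u ^ 4 * A′ × B ≈ u ^ 6 * B′

  Scaled-trans : ∀ {A B A′ B′ A″ B″} → Scaled A B A′ B′ → Scaled A′ B′ A″ B″ → Scaled A B A″ B″
  Scaled-trans {A} {B} {A′} {B′} {A″} {B″} (u , u≉0 , A≈ , B≈) (v , v≉0 , A′≈ , B′≈) = u * v , *-nonzero u≉0 v≉0 ,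
    lincomb (u ∷ v ∷ A ∷ A′ ∷ A″ ∷ []) (λ u v A A′ A″ →
      :1 :× A := u :^ 4 :* A′ ⊢ u :^ 4 :× A′ := v :^ 4 :* A″ ⊢ ⊢ A := (u :* v) :^ 4 :* A″) A≈ A′≈ ,
    lincomb (u ∷ v ∷ B ∷ B′ ∷ B″ ∷ []) (λ u v A A′ A″ →
      :1 :× A := u :^ 6 :* A′ ⊢ u :^ 6 :× A′ := v :^ 6 :* A″ ⊢ ⊢ A := (u :* v) :^ 6 :* A″) B≈ B′≈

  ScaledToIndex : (A B : Carrier) → Index → Set _
  ScaledToIndex A′ B′ j = Scaled A′ B′ (t ^ 2 * A (a j) (b₀ ^ toℕ (i j))) (t ^ 3 * B (a j) (b₀ ^ toℕ (i j)))

  scaled⇒isomorphic : ∀ E (S : ShortForm (EllipticCurve.equation E)) j →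
    ScaledToIndex (ShortForm.A S) (ShortForm.B S) j → Isomorphic fld E (curve j)
  -- The constant `r * s - w` is the one for which y - s x + w becomes u³y′ under the change of
  -- variables.
  scaled⇒isomorphic E S j (u , u≉0 , A≈ , B≈) = u , r , s , r * s - w , ≉⇒# u≉0 ,
    lincomb (u ∷ s ∷ r ∷ w ∷ Aˢ ∷ Bˢ ∷ a₁ ∷ []) (λ u s r w A B a₁ →
      :- :1 :× a₁ := :a₁ s r w A B ⊢ ⊢ u :* :0 := a₁ :+ 2 :· s) a₁≈ ,
    lincomb (u ∷ s ∷ r ∷ w ∷ Aˢ ∷ Bˢ ∷ a₁ ∷ a₂ ∷ []) (λ u s r w A B a₁ a₂ →
      s :× a₁ := :a₁ s r w A B ⊢ :- :1 :× a₂ := :a₂ s r w A B ⊢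
      ⊢ u :^ 2 :* :0 := a₂ :- s :* a₁ :+ 3 :· r :- s :^ 2) a₁≈ a₂≈ ,
    lincomb (u ∷ s ∷ r ∷ w ∷ Aˢ ∷ Bˢ ∷ a₁ ∷ a₃ ∷ []) (λ u s r w A B a₁ a₃ →
      :- r :× a₁ := :a₁ s r w A B ⊢ :- :1 :× a₃ := :a₃ s r w A B ⊢
      ⊢ u :^ 3 :* :0 := a₃ :+ r :* a₁ :+ 2 :· (r :* s :- w)) a₁≈ a₃≈ ,
    lincomb (u ∷ s ∷ r ∷ w ∷ Aˢ ∷ Bˢ ∷ a₁ ∷ a₂ ∷ a₃ ∷ a₄ ∷ A′ ∷ []) (λ u s r w A B a₁ a₂ a₃ a₄ A′ →
      let t = r :* s :- w in
      t :+ r :* s :× a₁ := :a₁ s r w A B ⊢ :- (2 :· r) :× a₂ := :a₂ s r w A B ⊢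
      s :× a₃ := :a₃ s r w A B ⊢ :- :1 :× a₄ := :a₄ s r w A B ⊢ :- :1 :× A := u :^ 4 :* A′ ⊢
      ⊢ u :^ 4 :* A′ := a₄ :- s :* a₃ :+ 2 :· (r :* a₂) :- (t :+ r :* s) :* a₁ :+ 3 :· r :^ 2 :- 2 :· (s :* t))
      a₁≈ a₂≈ a₃≈ a₄≈ A≈ ,
    lincomb (u ∷ s ∷ r ∷ w ∷ Aˢ ∷ Bˢ ∷ a₁ ∷ a₂ ∷ a₃ ∷ a₄ ∷ a₆ ∷ B′ ∷ []) (λ u s r w A B a₁ a₂ a₃ a₄ a₆ B′ →
      let t = r :* s :- w in
      r :* t :× a₁ := :a₁ s r w A B ⊢ :- (r :^ 2) :× a₂ := :a₂ s r w A B ⊢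
      t :× a₃ := :a₃ s r w A B ⊢ :- r :× a₄ := :a₄ s r w A B ⊢ :- :1 :× a₆ := :a₆ s r w A B ⊢
      :- :1 :× B := u :^ 6 :* B′ ⊢
      ⊢ u :^ 6 :* B′ := a₆ :+ r :* a₄ :+ r :^ 2 :* a₂ :+ r :^ 3 :- t :* a₃ :- t :^ 2 :- r :* t :* a₁)
      a₁≈ a₂≈ a₃≈ a₄≈ a₆≈ B≈
    where
    open Weierstrass (EllipticCurve.equation E)
    open ShortForm S renaming (A to Aˢ; B to Bˢ)
    A′ = t ^ 2 * A (a j) (b₀ ^ toℕ (i j))
    B′ = t ^ 3 * B (a j) (b₀ ^ toℕ (i j))

  -- Both equations have a₁ = a₂ = a₃ = 0. Comparing these coefficients forces the three translation
  -- parameters to vanish, as 2 and 3 are invertible, and only the scaling by u is left.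
  isomorphic⇒scaled : ∀ j k → Isomorphic fld (curve j) (curve k) →
    ScaledToIndex (t ^ 2 * A (a j) (b₀ ^ toℕ (i j))) (t ^ 3 * B (a j) (b₀ ^ toℕ (i j))) k
  isomorphic⇒scaled j k (u , r , s , τ , u#0 , eq₁ , eq₂ , eq₃ , eq₄ , eq₆) = u , #⇒≉ u#0 ,
    lincomb (u ∷ r ∷ s ∷ τ ∷ Aⱼ ∷ Aₖ ∷ []) (λ u r s t Aⱼ Aₖ →
      :- :1 :× u :^ 4 :* Aₖ := Aⱼ :- s :* :0 :+ 2 :· (r :* :0) :- (t :+ r :* s) :* :0 :+ 3 :· r :^ 2 :- 2 :· (s :* t) ⊢
      :- (3 :· r) :× r := :0 ⊢ 2 :· t :× s := :0 ⊢
      ⊢ Aⱼ := u :^ 4 :* Aₖ) eq₄ r≈0 s≈0 ,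
    lincomb (u ∷ r ∷ s ∷ τ ∷ Aⱼ ∷ Bⱼ ∷ Bₖ ∷ []) (λ u r s t Aⱼ Bⱼ Bₖ →
      :- :1 :× u :^ 6 :* Bₖ := Bⱼ :+ r :* Aⱼ :+ r :^ 2 :* :0 :+ r :^ 3 :- t :* :0 :- t :^ 2 :- r :* t :* :0 ⊢
      :- (Aⱼ :+ r :^ 2) :× r := :0 ⊢ t :× t := :0 ⊢
      ⊢ Bⱼ := u :^ 6 :* Bₖ) eq₆ r≈0 τ≈0
    where
    Aⱼ = t ^ 2 * A (a j) (b₀ ^ toℕ (i j))
    Bⱼ = t ^ 3 * B (a j) (b₀ ^ toℕ (i j))
    Aₖ = t ^ 2 * A (a k) (b₀ ^ toℕ (i k))
    Bₖ = t ^ 3 * B (a k) (b₀ ^ toℕ (i k))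
    s≈0 : s ≈ 0#
    s≈0 = *-zero-divisor {2 · 1#} (lincomb (u ∷ s ∷ []) (λ u s →
      :- :1 :× u :* :0 := :0 :+ 2 :· s ⊢ ⊢ (2 :· :1) :* s := :0) eq₁) 2≉0
    r≈0 : r ≈ 0#
    r≈0 = *-zero-divisor {3 · 1#} (lincomb (u ∷ r ∷ s ∷ []) (λ u r s →
      :- :1 :× u :^ 2 :* :0 := :0 :- s :* :0 :+ 3 :· r :- s :^ 2 ⊢ s :× s := :0 ⊢
      ⊢ (3 :· :1) :* r := :0) eq₂ s≈0) 3≉0
    τ≈0 : τ ≈ 0#
    τ≈0 = *-zero-divisor {2 · 1#} (lincomb (u ∷ r ∷ τ ∷ []) (λ u r t →
      :- :1 :× u :^ 3 :* :0 := :0 :+ r :* :0 :+ 2 :· t ⊢ ⊢ (2 :· :1) :* t := :0) eq₃) 2≉0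

  -- The rational points of order 3 correspond under scaling, so that β and αβ
  -- are multiplied by u³ and u⁴, up to the sign of u.
  scaled⇒parameters : ∀ j k → ScaledToIndex (t ^ 2 * A (a j) (b₀ ^ toℕ (i j))) (t ^ 3 * B (a j) (b₀ ^ toℕ (i j))) k →
                      i j ≡ i k × a j ^ 3 ≈ a k ^ 3
  scaled⇒parameters j k (u , u≉0 , A≈ , B≈) =
    [ (λ eq → conclude u≉0 eq αβs)
    -- Replacing u by -u changes the sign of u³ and keeps u⁴.
    , (λ eq → conclude -u≉0
        (lincomb (u ∷ J.β ∷ K.β ∷ []) (λ u βⱼ βₖ → :- :1 :× u :^ 3 :* βₖ := :- βⱼ ⊢ ⊢ (:- u) :^ 3 :* βₖ := βⱼ) eq)
        (trans (lincomb (u ∷ K.α ∷ K.β ∷ []) (λ u α β → ⊢ (:- u) :^ 4 :* (α :* β) := u :^ 4 :* (α :* β))) αβs)) ]′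
    (square-≈ βs)
    where
    module J = FamilyCurve (i j) (a j)
    module K = FamilyCurve (i k) (a k)
    Aⱼ = t ^ 2 * A (a j) (b₀ ^ toℕ (i j))
    Bⱼ = t ^ 3 * B (a j) (b₀ ^ toℕ (i j))
    Aₖ = t ^ 2 * A (a k) (b₀ ^ toℕ (i k))
    Bₖ = t ^ 3 * B (a k) (b₀ ^ toℕ (i k))
    -- ψ is homogeneous of weight 8 when X, A, B have weights 2, 4, 6, so the scaled root is again a
    -- root, and there is only one.
    X≈ : u ^ 2 * K.X₀ ≈ J.X₀
    X≈ = family-unique-root j _ (trans (division₃-cong A≈ B≈ refl) (lincomb
      (u ∷ Aₖ ∷ Bₖ ∷ K.X₀ ∷ []) (λ u A B X → u :^ 8 :× :division₃ A B X := :0 ⊢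
        ⊢ :division₃ (u :^ 4 :* A) (u :^ 6 :* B) (u :^ 2 :* X) := :0) K.model-root))
    βs : (u ^ 3 * K.β) ^ 2 ≈ J.β ^ 2
    βs = *-cancelˡ-nonzero (^-nonzero 3 t≉0) (begin
      t ^ 3 * (u ^ 3 * K.β) ^ 2     ≈⟨ lincomb (t ∷ u ∷ K.β ∷ []) (λ t u β → ⊢ t :^ 3 :* (u :^ 3 :* β) :^ 2 := u :^ 6 :* (t :^ 3 :* β :^ 2)) ⟩
      u ^ 6 * (t ^ 3 * K.β ^ 2)     ≈⟨ *-congˡ K.model-cubic ⟨
      u ^ 6 * cubic Aₖ Bₖ K.X₀      ≈⟨ lincomb (u ∷ Aₖ ∷ Bₖ ∷ K.X₀ ∷ []) (λ u A B X →
                                         ⊢ u :^ 6 :* :cubic A B X := :cubic (u :^ 4 :* A) (u :^ 6 :* B) (u :^ 2 :* X)) ⟩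
      cubic (u ^ 4 * Aₖ) (u ^ 6 * Bₖ) (u ^ 2 * K.X₀) ≈⟨ cubic-cong (sym A≈) (sym B≈) X≈ ⟩
      cubic Aⱼ Bⱼ J.X₀              ≈⟨ J.model-cubic ⟩
      t ^ 3 * J.β ^ 2               ∎)
      where open SetoidReasoning setoid
    αβs : u ^ 4 * (K.α * K.β) ≈ J.α * J.β
    αβs = *-cancelˡ-nonzero (2·≉0 (3·≉0 (^-nonzero 2 t≉0))) (lincomb
      (t ∷ u ∷ K.α ∷ K.β ∷ J.α ∷ J.β ∷ Aₖ ∷ Aⱼ ∷ K.X₀ ∷ J.X₀ ∷ [])
      (λ t u αₖ βₖ αⱼ βⱼ Aₖ Aⱼ Xₖ Xⱼ →
        :- (u :^ 4) :× :cubic′ Aₖ :0 Xₖ := t :^ 2 :* (6 :· (αₖ :* βₖ)) ⊢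
        :1 :× :cubic′ Aⱼ :0 Xⱼ := t :^ 2 :* (6 :· (αⱼ :* βⱼ)) ⊢
        :- :1 :× Aⱼ := u :^ 4 :* Aₖ ⊢
        3 :· (u :^ 2 :* Xₖ :+ Xⱼ) :× u :^ 2 :* Xₖ := Xⱼ ⊢
        ⊢ 2 :· 3 :· t :^ 2 :* (u :^ 4 :* (αₖ :* βₖ)) := 2 :· 3 :· t :^ 2 :* (αⱼ :* βⱼ))
      K.model-cubic′ J.model-cubic′ A≈ X≈)
    -u≉0 : - u ≉ 0#
    -u≉0 eq = u≉0 (lincomb (u ∷ []) (λ u → :- :1 :× :- u := :0 ⊢ ⊢ u := :0) eq)
    -- The relation between the β says that b₀^i for the two curves differ by the cube v³, so the
    -- exponents agree and v³ = 1. The α then differ by the factor v, which disappears from a³.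
    conclude : ∀ {v} → v ≉ 0# → v ^ 3 * K.β ≈ J.β → v ^ 4 * (K.α * K.β) ≈ J.α * J.β →
               i j ≡ i k × a j ^ 3 ≈ a k ^ 3
    conclude {v} v≉0 v³β≈ v⁴αβ≈ = iⱼ≡iₖ , lincomb (v ∷ a j ∷ a k ∷ J.α ∷ K.α ∷ []) (λ v aⱼ aₖ αⱼ αₖ →
        aⱼ :^ 2 :+ aⱼ :* (6 :· αⱼ) :+ (6 :· αⱼ) :^ 2 :× aⱼ := 6 :· αⱼ ⊢
        :- (aₖ :^ 2 :+ aₖ :* (6 :· αₖ) :+ (6 :· αₖ) :^ 2) :× aₖ := 6 :· αₖ ⊢
        :- (216 :· (αⱼ :^ 2 :+ αⱼ :* (v :* αₖ) :+ (v :* αₖ) :^ 2)) :× v :* αₖ := αⱼ ⊢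
        216 :· αₖ :^ 3 :× v :^ 3 := :1 ⊢
        ⊢ aⱼ :^ 3 := aₖ :^ 3) J.a≈6α K.a≈6α vα≈ v³≈1
      where
      iⱼ≡iₖ : i j ≡ i k
      iⱼ≡iₖ = ≡.sym (cosets-independent v≉0 1≉0 (lincomb (v ∷ J.b ∷ K.b ∷ J.β ∷ K.β ∷ []) (λ v bⱼ bₖ βⱼ βₖ →
        v :^ 3 :× bₖ := 2 :· βₖ ⊢ :- :1 :× bⱼ := 2 :· βⱼ ⊢ 2 :· :1 :× v :^ 3 :* βₖ := βⱼ ⊢
        ⊢ bₖ :* v :^ 3 := bⱼ :* :1 :^ 3) K.b≈2β J.b≈2β v³β≈))
      βⱼ≈βₖ : J.β ≈ K.β
      βⱼ≈βₖ = reflexive (≡.cong (λ i → half (b₀ ^ toℕ i)) iⱼ≡iₖ)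
      v³≈1 : v ^ 3 ≈ 1#
      v³≈1 = *-cancelˡ-nonzero K.β≉0 (lincomb (v ∷ J.β ∷ K.β ∷ []) (λ v βⱼ βₖ →
        :1 :× v :^ 3 :* βₖ := βⱼ ⊢ :1 :× βⱼ := βₖ ⊢ ⊢ βₖ :* v :^ 3 := βₖ :* :1) v³β≈ βⱼ≈βₖ)
      vα≈ : v * K.α ≈ J.α
      vα≈ = *-cancelˡ-nonzero J.β≉0 (lincomb (v ∷ J.α ∷ K.α ∷ J.β ∷ K.β ∷ []) (λ v αⱼ αₖ βⱼ βₖ →
        :1 :× v :^ 4 :* (αₖ :* βₖ) := αⱼ :* βⱼ ⊢ :- (v :* αₖ) :× v :^ 3 :* βₖ := βⱼ ⊢
        ⊢ βⱼ :* (v :* αₖ) := βⱼ :* αⱼ) v⁴αβ≈ v³β≈)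

  -- The quotient u of the two values of a is a cube root of unity, taken as 1 if both vanish. Since
  -- u³ = 1, replacing a by ua multiplies A by u = u⁴ and leaves B fixed, where u⁶ = 1.
  parameters⇒scaled : ∀ j k → i j ≡ i k → a j ^ 3 ≈ a k ^ 3 →
    ScaledToIndex (t ^ 2 * A (a j) (b₀ ^ toℕ (i j))) (t ^ 3 * B (a j) (b₀ ^ toℕ (i j))) k
  parameters⇒scaled j k iⱼ≡iₖ aⱼ³≈aₖ³ = scale (ratio (a k ≈? 0#))
    where
    ratio : Dec (a k ≈ 0#) → ∃[ u ] u ≉ 0# × u ^ 3 ≈ 1# × a j ≈ u * a k
    ratio (yes aₖ≈0) = 1# , 1≉0 , lincomb {0} [] (⊢ :1 :^ 3 := :1) , trans aⱼ≈0 (trans (sym aₖ≈0) (sym (*-identityˡ _)))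
      where
      aⱼ≈0 : a j ≈ 0#
      aⱼ≈0 with a j ≈? 0#
      ... | yes eq  = eq
      ... | no aⱼ≉0 = contradiction (lincomb (a j ∷ a k ∷ []) (λ aⱼ aₖ →
        :1 :× aⱼ :^ 3 := aₖ :^ 3 ⊢ aₖ :^ 2 :× aₖ := :0 ⊢ ⊢ aⱼ :^ 3 := :0) aⱼ³≈aₖ³ aₖ≈0) (^-nonzero 3 aⱼ≉0)
    ratio (no aₖ≉0) = a j * a k ⁻¹ , (λ u≈0 → 1≉0 (trans (sym u³≈1) (lincomb (a j * a k ⁻¹ ∷ []) (λ u →
        u :^ 2 :× u := :0 ⊢ ⊢ u :^ 3 := :0) u≈0))) , u³≈1 ,
      lincomb (a j ∷ a k ∷ a k ⁻¹ ∷ []) (λ aⱼ aₖ i → :- aⱼ :× aₖ :* i := :1 ⊢ ⊢ aⱼ := aⱼ :* i :* aₖ) (⁻¹-inverseʳ aₖ≉0)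
      where
      u³≈1 : (a j * a k ⁻¹) ^ 3 ≈ 1#
      u³≈1 = lincomb (a j ∷ a k ∷ a k ⁻¹ ∷ []) (λ aⱼ aₖ i →
        i :^ 3 :× aⱼ :^ 3 := aₖ :^ 3 ⊢ (aₖ :* i) :^ 2 :+ aₖ :* i :+ :1 :× aₖ :* i := :1 ⊢
        ⊢ (aⱼ :* i) :^ 3 := :1) aⱼ³≈aₖ³ (⁻¹-inverseʳ aₖ≉0)
    module K = FamilyCurve (i k) (a k)
    b≈ : b₀ ^ toℕ (i j) ≈ b₀ ^ toℕ (i k)
    b≈ = reflexive (≡.cong (λ i → b₀ ^ toℕ i) iⱼ≡iₖ)
    scale : ∃[ u ] u ≉ 0# × u ^ 3 ≈ 1# × a j ≈ u * a k → _
    scale (u , u≉0 , u³≈1 , aⱼ≈uaₖ) = u , u≉0 ,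
      trans (A-model aⱼ≈ bⱼ≈) (trans (lincomb (t ∷ u ∷ K.α ∷ K.β ∷ []) (λ t u α β →
        :- (6 :· (t :^ 2 :* u :* α :* β)) :× u :^ 3 := :1 ⊢
        ⊢ :modelA t (u :* α) β := u :^ 4 :* :modelA t α β) u³≈1) (*-congˡ (sym (A-model K.a≈6α K.b≈2β)))) ,
      trans (B-model aⱼ≈ bⱼ≈) (trans (lincomb (t ∷ u ∷ K.α ∷ K.β ∷ []) (λ t u α β →
        t :^ 3 :* (18 :· (u :^ 3 :* α :^ 3 :* β) :- (u :^ 3 :+ :1) :* β :^ 2) :× u :^ 3 := :1 ⊢
        ⊢ :modelB t (u :* α) β := u :^ 6 :* :modelB t α β) u³≈1) (*-congˡ (sym (B-model K.a≈6α K.b≈2β))))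
      where
      aⱼ≈ : a j ≈ 6 · (u * K.α)
      aⱼ≈ = lincomb (u ∷ a j ∷ a k ∷ K.α ∷ []) (λ u aⱼ aₖ α →
        :1 :× aⱼ := u :* aₖ ⊢ u :× aₖ := 6 :· α ⊢ ⊢ aⱼ := 6 :· (u :* α)) aⱼ≈uaₖ K.a≈6α
      bⱼ≈ : b₀ ^ toℕ (i j) ≈ 2 · K.β
      bⱼ≈ = trans b≈ K.b≈2β

  -- Write f(X) = t s². A model with l = t v² and 2β = b has f(X) = t³v⁶β², so s = tβv³ is wanted,
  -- that is 2s/t = b v³. The cube class of 2s/t thus provides b and v, and f′(X) = 6 l²αβ then
  -- defines α.
  classify : ∀ E → E ∈ P → (S : ShortForm (EllipticCurve.equation E)) →
             ∃[ j ] ScaledToIndex (ShortForm.A S) (ShortForm.B S) j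
  classify E E∈P S = fromRoot (unique-root-of E∈P)
    where
    open RationalSubgroups 𝔽 𝔽̄ 2≉0 E S
    open ShortForm S using () renaming (A to Aˢ; B to Bˢ)
    module _ (X : Carrier) (unique-root : IsUniqueRoot X) (s : Carrier) (s≉0 : s ≉ 0#)
      (f≈ : cubic Aˢ Bˢ X ≈ t * s ^ 2) (i : Fin 3) (j : Fin k) (coset : b₀ ^ toℕ i * root j ^ 3 ≈ 2 · s * t ⁻¹) where
      v b β l D α a′ : Carrier
      v = root j
      b = b₀ ^ toℕ i
      β = half b
      l = t * v ^ 2
      D = l ^ 2 * (6 · β)
      α = (3 · X ^ 2 + Aˢ) * D ⁻¹
      a′ = 6 · α
      v≉0 : v ≉ 0#
      v≉0 = root≉0 j
      β≉0 : β ≉ 0#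
      β≉0 = *-nonzero (^-nonzero (toℕ i) b₀≉0) (⁻¹-nonzero 2≉0)
      l≉0 : l ≉ 0#
      l≉0 = *-nonzero t≉0 (^-nonzero 2 v≉0)
      D≉0 : D ≉ 0#
      D≉0 eq = *-nonzero (^-nonzero 2 l≉0) (2·≉0 (3·≉0 β≉0)) (lincomb (l ∷ β ∷ []) (λ l β →
        :1 :× l :^ 2 :* (6 :· β) := :0 ⊢ ⊢ l :^ 2 :* (2 :· 3 :· β) := :0) eq)
      s≈ : s ≈ t * β * v ^ 3
      s≈ = *-cancelˡ-nonzero 2≉0 (lincomb (s ∷ t ∷ t ⁻¹ ∷ b ∷ β ∷ v ∷ []) (λ s t i b β v →
        :- (2 :· s) :× t :* i := :1 ⊢ :- t :× b :* v :^ 3 := 2 :· s :* i ⊢ :- (t :* v :^ 3) :× 2 :· β := b ⊢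
        ⊢ (2 :· :1) :* s := (2 :· :1) :* (t :* β :* v :^ 3)) (⁻¹-inverseʳ t≉0) coset (2·half b))
      model = root⇒model l≉0 β≉0 (proj₁ unique-root)
        (lincomb (cubic Aˢ Bˢ X ∷ s ∷ t ∷ β ∷ v ∷ []) (λ f s t β v →
          :1 :× f := t :* s :^ 2 ⊢ t :* (s :+ t :* β :* v :^ 3) :× s := t :* β :* v :^ 3 ⊢
          ⊢ f := (t :* v :^ 2) :^ 3 :* β :^ 2) f≈ s≈)
        (lincomb (3 · X ^ 2 + Aˢ ∷ l ∷ β ∷ D ⁻¹ ∷ []) (λ N l β i →
          :- N :× l :^ 2 :* (6 :· β) :* i := :1 ⊢ ⊢ N := l :^ 2 :* (6 :· (N :* i :* β))) (⁻¹-inverseʳ D≉0))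
      A≈ = proj₁ (proj₂ model)
      B≈ = proj₂ (proj₂ model)
      open ModelCurve A≈ B≈ l≉0 β≉0
      κ≈ : κ-of i a′ ≈ κ
      κ≈ = lincomb (α ∷ b ∷ β ∷ []) (λ α b β → 27 :· :1 :× 2 :· β := b ⊢
        ⊢ (6 :· α) :^ 3 :- 27 :· b := 216 :· α :^ 3 :- 54 :· β) (2·half b)
      κ≉0 : κ-of i a′ ≉ 0#
      κ≉0 eq = nonsingular⇒κ≉0 (nonsingular-shortForm S (EllipticCurve.nonsingular E)) (trans (sym κ≈) eq)
      -- A cube root would yield a second root of ψ in 𝔽_q.
      κ-not-cube : ∀ d → ¬ (d ^ 3 ≈ κ-of i a′)
      κ-not-cube d d³≈ = second-root (cube⇒root (trans d³≈ κ≈))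
        where
        second-root : ¬ (∃[ X′ ] division₃ Aˢ Bˢ X′ ≈ 0# × X′ ≉ X₀)
        second-root (X′ , ψ′≈0 , X′≉X₀) = X′≉X₀ (trans (proj₂ unique-root X′ ψ′≈0) (proj₁ model))
      index : Index
      index = makeIndex i a′ κ≉0 κ-not-cube
      scaled : ScaledToIndex Aˢ Bˢ index
      scaled = v , v≉0 ,
        trans A≈ (trans (lincomb (t ∷ v ∷ α ∷ β ∷ []) (λ t v α β →
          ⊢ :modelA (t :* v :^ 2) α β := v :^ 4 :* :modelA t α β)) (*-congˡ (sym (A-model refl (sym (2·half b)))))) ,
        trans B≈ (trans (lincomb (t ∷ v ∷ α ∷ β ∷ []) (λ t v α β →
          ⊢ :modelB (t :* v :^ 2) α β := v :^ 6 :* :modelB t α β)) (*-congˡ (sym (B-model refl (sym (2·half b))))))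
    fromCoset : ∀ X → IsUniqueRoot X → ∀ s → s ≉ 0# → cubic Aˢ Bˢ X ≈ t * s ^ 2 →
                ∃[ p ] element-of p ≈ 2 · s * t ⁻¹ → ∃[ j ] ScaledToIndex Aˢ Bˢ j
    fromCoset X unique-root s s≉0 f≈ ((i , j) , coset) =
      index X unique-root s s≉0 f≈ i j coset , scaled X unique-root s s≉0 f≈ i j coset
    fromSquare : ∀ X → IsUniqueRoot X → (∃[ s ] s ≉ 0# × cubic Aˢ Bˢ X ≈ t * s ^ 2) → ∃[ j ] ScaledToIndex Aˢ Bˢ j
    fromSquare X unique-root (s , s≉0 , f≈) =
      fromCoset X unique-root s s≉0 f≈ (decompose (*-nonzero (2·≉0 s≉0) (⁻¹-nonzero t≉0)))
    fromRoot : ∃[ X ] IsUniqueRoot X × IsQuadraticNonResidue fld (cubic Aˢ Bˢ X) → ∃[ j ] ScaledToIndex Aˢ Bˢ j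
    fromRoot (X , unique-root , f-nonresidue) = fromSquare X unique-root (nonresidue⇒t*square f-nonresidue)

  isFamilyOfRepresentatives : IsFamilyOfRepresentatives P
  isFamilyOfRepresentatives =
      curve∈P
    , (λ E E∈P → map₂ (λ {j} → scaled⇒isomorphic E (short E) j) (classify E E∈P (short E)))
    , (λ j k → mk⇔ (λ iso → scaled⇒parameters j k (isomorphic⇒scaled j k iso))
                   (λ (i≡ , a³≈) → scaled⇒isomorphic (curve j) (family-shortForm (i j) (a j)) k (parameters⇒scaled j k i≡ a³≈)))
    where
    short : ∀ E → ShortForm (EllipticCurve.equation E)
    short E = shortForm 2≉0 3≉0 (EllipticCurve.equation E)

  -- Enumeration and number of the classes.

  private
    cubeOf-nonzero : ∀ {d κ} → d ^ 3 ≈ κ → κ ≉ 0# → d ≉ 0#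
    cubeOf-nonzero {d} {κ} d³≈κ κ≉0 d≈0 = κ≉0 (lincomb (d ∷ κ ∷ []) (λ d κ →
      :- :1 :× d :^ 3 := κ ⊢ d :^ 2 :× d := :0 ⊢ ⊢ κ := :0) d³≈κ d≈0)

    noncube : Fin 2 → Fin k → Carrier
    noncube l j = element-of (suc l , j)

    noncube-not-cube : ∀ l j {x} → x ≉ 0# → ¬ (noncube l j * x ^ 3 ≈ 1#)
    noncube-not-cube l j {x} x≉0 eq = contradiction
      (cosets-independent {suc l} {zero} (*-nonzero (root≉0 j) x≉0) 1≉0
        (lincomb (b₀ ^ toℕ (suc l) ∷ root j ∷ x ∷ []) (λ b r x →
          :1 :× b :* r :^ 3 :* x :^ 3 := :1 ⊢ ⊢ b :* (r :* x) :^ 3 := :1 :* :1 :^ 3) eq)) λ ()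

    noncube-1≉0 : ∀ l j → noncube l j - 1# ≉ 0#
    noncube-1≉0 l j eq = noncube-not-cube l j 1≉0 (lincomb (noncube l j ∷ []) (λ s →
      :1 :× s :- :1 := :0 ⊢ ⊢ s :* :1 :^ 3 := :1) eq)

  -- For a = 0 one has a³ - 27b = (-3)³ b, a noncube for b = b₀ and b = b₀².
  zeroIndex : ∀ l → ∃[ J ] i J ≡ suc l × a J ≈ 0#
  zeroIndex l = makeIndex (suc l) 0# κ≉0 not-cube , ≡.refl , refl
    where
    b = b₀ ^ toℕ (suc l)
    κ≉0 : κ-of (suc l) 0# ≉ 0#
    κ≉0 eq = 3·≉0 (3·≉0 (3·≉0 (^-nonzero (toℕ (suc l)) b₀≉0))) (lincomb (b ∷ []) (λ b →
      :- :1 :× :0 :^ 3 :- 27 :· b := :0 ⊢ ⊢ 3 :· 3 :· 3 :· b := :0) eq)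
    -3≉0 : - (3 · 1#) ≉ 0#
    -3≉0 eq = 3≉0 (lincomb {0} [] (:- :1 :× :- (3 :· :1) := :0 ⊢ ⊢ 3 :· :1 := :0) eq)
    not-cube : ∀ d → ¬ (d ^ 3 ≈ κ-of (suc l) 0#)
    not-cube d d³≈κ = contradiction (cosets-independent {suc l} {zero} -3≉0 (cubeOf-nonzero d³≈κ κ≉0)
      (lincomb (b ∷ d ∷ []) (λ b d → :- :1 :× d :^ 3 := :0 :^ 3 :- 27 :· b ⊢
        ⊢ b :* (:- (3 :· :1)) :^ 3 := :1 :* d :^ 3) d³≈κ)) λ ()

  -- For c = a³ and a given ratio s = c / (c − 27b), the pair (b , c) is
  -- determined up to a common factor, which is fixed by the choice of b.
  ratioIndex : ∀ l j → ∃[ J ] a J ≉ 0# × noncube l j * κ-of (i J) (a J) ≈ a J ^ 3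
  -- Solving s = c / (c - 27b) gives b / c = (s - 1) / (27 s). With c = z⁻³ the left side is b z³,
  -- so the cube class of the right side provides b and z, and a = z⁻¹.
  ratioIndex l j = fromCoset (decompose (*-nonzero (noncube-1≉0 l j) (⁻¹-nonzero 27s≉0)))
    where
    s h : Carrier
    s = noncube l j
    h = (27 · s) ⁻¹
    27s≉0 : 27 · s ≉ 0#
    27s≉0 eq = 3·≉0 (3·≉0 (3·≉0 (element-of≉0 (suc l , j)))) (lincomb (s ∷ []) (λ s →
      :1 :× 27 :· s := :0 ⊢ ⊢ 3 :· 3 :· 3 :· s := :0) eq)
    module _ (i′ : Fin 3) (j′ : Fin k) (coset : b₀ ^ toℕ i′ * root j′ ^ 3 ≈ (s - 1#) * h) where
      b z a′ κ : Carrier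
      b  = b₀ ^ toℕ i′
      z  = root j′
      a′ = z ⁻¹
      κ  = κ-of i′ a′
      za≈1 : z * a′ ≈ 1#
      za≈1 = ⁻¹-inverseʳ (root≉0 j′)
      sκz³≈1 : s * (κ * z ^ 3) ≈ 1#
      sκz³≈1 = lincomb (s ∷ h ∷ b ∷ z ∷ a′ ∷ []) (λ s h b z a →
        s :* ((z :* a) :^ 2 :+ z :* a :+ :1) :× z :* a := :1 ⊢
        :- (27 :· s) :× b :* z :^ 3 := (s :- :1) :* h ⊢
        :- (s :- :1) :× 27 :· s :* h := :1 ⊢
        ⊢ s :* ((a :^ 3 :- 27 :· b) :* z :^ 3) := :1) za≈1 coset (⁻¹-inverseʳ 27s≉0)
      κ≉0 : κ ≉ 0#
      κ≉0 κ≈0 = 1≉0 (lincomb (s ∷ κ ∷ z ∷ []) (λ s κ z →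
        :- :1 :× s :* (κ :* z :^ 3) := :1 ⊢ s :* z :^ 3 :× κ := :0 ⊢ ⊢ :1 := :0) sκz³≈1 κ≈0)
      not-cube : ∀ d → ¬ (d ^ 3 ≈ κ)
      -- As s κ z³ = 1, a cube κ would make s a cube.
      not-cube d d³≈κ = noncube-not-cube l j (*-nonzero (cubeOf-nonzero d³≈κ κ≉0) (root≉0 j′))
        (lincomb (s ∷ κ ∷ z ∷ d ∷ []) (λ s κ z d →
          :1 :× s :* (κ :* z :^ 3) := :1 ⊢ s :* z :^ 3 :× d :^ 3 := κ ⊢
          ⊢ s :* (d :* z) :^ 3 := :1) sκz³≈1 d³≈κ)
      ratio : s * κ ≈ a′ ^ 3
      ratio = lincomb (s ∷ κ ∷ z ∷ a′ ∷ []) (λ s κ z a →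
        :- (s :* κ :* ((z :* a) :^ 2 :+ z :* a :+ :1)) :× z :* a := :1 ⊢
        a :^ 3 :× s :* (κ :* z :^ 3) := :1 ⊢
        ⊢ s :* κ := a :^ 3) za≈1 sκz³≈1
    fromCoset : ∃[ p ] element-of p ≈ (s - 1#) * h → ∃[ J ] a J ≉ 0# × s * κ-of (i J) (a J) ≈ a J ^ 3
    fromCoset ((i′ , j′) , coset) = makeIndex i′ (a′ i′ j′ coset) (κ≉0 i′ j′ coset) (not-cube i′ j′ coset)
      , ⁻¹-nonzero (root≉0 j′) , ratio i′ j′ coset

  -- The slot `zero` belongs to a = 0 and the others to the noncubes b₀^(l+1) y³, with y running
  -- over the `k` representatives.
  classIndex : Fin 2 × Fin (suc k) → Index
  classIndex (l , zero)  = proj₁ (zeroIndex l)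
  classIndex (l , suc j) = proj₁ (ratioIndex l j)

  private
    κ-cong : ∀ {i i′ a a′} → i ≡ i′ → a ^ 3 ≈ a′ ^ 3 → κ-of i a ≈ κ-of i′ a′
    κ-cong ≡.refl a³≈ = +-congʳ a³≈

    mixed : ∀ l l′ j → ¬ (a (classIndex (l , zero)) ^ 3 ≈ a (classIndex (l′ , suc j)) ^ 3)
    mixed l l′ j a³≈ = ^-nonzero 3 (proj₁ (proj₂ (ratioIndex l′ j))) (lincomb (a₀ ∷ a₁ ∷ []) (λ a₀ a₁ →
      :- :1 :× a₀ :^ 3 := a₁ :^ 3 ⊢ a₀ :^ 2 :× a₀ := :0 ⊢ ⊢ a₁ :^ 3 := :0) a³≈ (proj₂ (proj₂ (zeroIndex l))))
      where
      a₀ = a (classIndex (l , zero))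
      a₁ = a (classIndex (l′ , suc j))

  -- For a ≠ 0 the noncube s = a³ / κ is recovered from i and a³; for a = 0 the exponent i alone
  -- names the slot.
  classIndex-injective : ∀ p p′ → i (classIndex p) ≡ i (classIndex p′) →
                         a (classIndex p) ^ 3 ≈ a (classIndex p′) ^ 3 → p ≡ p′
  classIndex-injective (l , zero) (l′ , zero) i≡ _ = ≡.cong (_, zero) (suc-injective
    (≡.trans (≡.sym (proj₁ (proj₂ (zeroIndex l)))) (≡.trans i≡ (proj₁ (proj₂ (zeroIndex l′))))))
  classIndex-injective (l , zero) (l′ , suc j) _ a³≈ = contradiction a³≈ (mixed l l′ j)
  classIndex-injective (l , suc j) (l′ , zero) _ a³≈ = contradiction (sym a³≈) (mixed l′ l j)
  classIndex-injective (l , suc j) (l′ , suc j′) i≡ a³≈ = conclude (element-of-injective s≈s′)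
    where
    J  = classIndex (l , suc j)
    J′ = classIndex (l′ , suc j′)
    s≈s′ : noncube l j ≈ noncube l′ j′
    s≈s′ = *-cancelˡ-nonzero (κ-index≉0 J) (lincomb
      (noncube l j ∷ noncube l′ j′ ∷ κ-of (i J) (a J) ∷ κ-of (i J′) (a J′) ∷ a J ^ 3 ∷ a J′ ^ 3 ∷ [])
      (λ s s′ κ κ′ c c′ →
        :1 :× s :* κ := c ⊢ :- :1 :× s′ :* κ′ := c′ ⊢ :1 :× c := c′ ⊢ :- s′ :× κ := κ′ ⊢
        ⊢ κ :* s := κ :* s′)
      (proj₂ (proj₂ (ratioIndex l j))) (proj₂ (proj₂ (ratioIndex l′ j′))) a³≈ (κ-cong i≡ a³≈))
    conclude : ∀ {l l′ : Fin 2} {j j′ : Fin k} → _≡_ {A = Fin 3 × Fin k} (suc l , j) (suc l′ , j′) →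
               _≡_ {A = Fin 2 × Fin (suc k)} (l , suc j) (l′ , suc j′)
    conclude ≡.refl = ≡.refl

  classIndex-surjective : ∀ J → ∃[ p ] i J ≡ i (classIndex p) × a J ^ 3 ≈ a (classIndex p) ^ 3
  classIndex-surjective J = split (a J ≈? 0#)
    where
    b κ : Carrier
    b = b₀ ^ toℕ (i J)
    κ = κ-of (i J) (a J)
    onZero : a J ≈ 0# → ∀ i′ → i J ≡ i′ → ∃[ p ] i J ≡ i (classIndex p) × a J ^ 3 ≈ a (classIndex p) ^ 3
    -- With a = 0 and b = 1 the value -27 = (-3)³ is a cube.
    onZero a≈0 zero i≡ = contradiction (lincomb (b ∷ a J ∷ []) (λ b a →
      27 :· :1 :× b := :1 ⊢ :- (a :^ 2) :× a := :0 ⊢ ⊢ (:- (3 :· :1)) :^ 3 := a :^ 3 :- 27 :· b)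
      (reflexive (≡.cong (λ i → b₀ ^ toℕ i) i≡)) a≈0) (κ-index-not-cube J (- (3 · 1#)))
    onZero a≈0 (suc l) i≡ = (l , zero) , ≡.trans i≡ (≡.sym (proj₁ (proj₂ (zeroIndex l)))) ,
      lincomb (a J ∷ a₀ ∷ []) (λ a a₀ → a :^ 2 :× a := :0 ⊢ :- (a₀ :^ 2) :× a₀ := :0 ⊢ ⊢ a :^ 3 := a₀ :^ 3)
        a≈0 (proj₂ (proj₂ (zeroIndex l)))
      where a₀ = a (classIndex (l , zero))
    onNonzero : a J ≉ 0# → ∃[ p ] element-of p ≈ a J ^ 3 * κ ⁻¹ →
                ∃[ p ] i J ≡ i (classIndex p) × a J ^ 3 ≈ a (classIndex p) ^ 3
    -- If a³ / κ is the cube r³, then κ = (a / r)³ is a cube as well.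
    onNonzero a≉0 ((zero , j) , coset) = contradiction (lincomb
      (a J ∷ κ ∷ κ ⁻¹ ∷ root j ∷ root j ⁻¹ ∷ []) (λ a κ κ⁻¹ r r⁻¹ →
        :- (a :^ 3 :* r⁻¹ :^ 3) :× κ :* κ⁻¹ := :1 ⊢
        :- (κ :* r⁻¹ :^ 3) :× :1 :* r :^ 3 := a :^ 3 :* κ⁻¹ ⊢
        κ :* ((r :* r⁻¹) :^ 2 :+ r :* r⁻¹ :+ :1) :× r :* r⁻¹ := :1 ⊢
        ⊢ (a :* r⁻¹) :^ 3 := κ) (⁻¹-inverseʳ (κ-index≉0 J)) coset (⁻¹-inverseʳ (root≉0 j)))
      (κ-index-not-cube J (a J * root j ⁻¹))
    onNonzero a≉0 ((suc l , j) , coset) = (l , suc j) , i≡ ,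
      *-cancelˡ-nonzero (^-nonzero (toℕ (i J)) b₀≉0) (sym (trans cross (*-congʳ (reflexive (≡.cong (λ i → b₀ ^ toℕ i) (≡.sym i≡))))))
      where
      J′ = classIndex (l , suc j)
      s = noncube l j
      b′ = b₀ ^ toℕ (i J′)
      sκ≈a³ : s * κ ≈ a J ^ 3
      sκ≈a³ = lincomb (s ∷ κ ∷ κ ⁻¹ ∷ a J ∷ []) (λ s κ κ⁻¹ a →
        κ :× s := a :^ 3 :* κ⁻¹ ⊢ a :^ 3 :× κ :* κ⁻¹ := :1 ⊢ ⊢ s :* κ := a :^ 3) coset (⁻¹-inverseʳ (κ-index≉0 J))
      -- Both pairs (b , a³) have the same ratio s, hence are proportional; comparing cube classes
      -- then gives equal exponents.
      cross : b * a J′ ^ 3 ≈ b′ * a J ^ 3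
      cross = *-cancelˡ-nonzero (noncube-1≉0 l j) (lincomb (s ∷ b ∷ b′ ∷ a J ∷ a J′ ∷ []) (λ s b b′ a a′ →
        b :× s :* (a′ :^ 3 :- 27 :· b′) := a′ :^ 3 ⊢ :- b′ :× s :* (a :^ 3 :- 27 :· b) := a :^ 3 ⊢
        ⊢ (s :- :1) :* (b :* a′ :^ 3) := (s :- :1) :* (b′ :* a :^ 3)) (proj₂ (proj₂ (ratioIndex l j))) sκ≈a³)
      i≡ : i J ≡ i J′
      i≡ = cosets-independent {i J} {i J′} (proj₁ (proj₂ (ratioIndex l j))) a≉0 cross
    split : Dec (a J ≈ 0#) → ∃[ p ] i J ≡ i (classIndex p) × a J ^ 3 ≈ a (classIndex p) ^ 3
    split (yes a≈0) = onZero a≈0 (i J) ≡.refl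
    split (no  a≉0) = onNonzero a≉0 (decompose (*-nonzero (^-nonzero 3 a≉0) (⁻¹-nonzero (κ-index≉0 J))))

  hasNumberOfClasses : HasNumberOfClasses fld P (2 ℕ.* suc k)
  hasNumberOfClasses = (λ n → curve (index n)) , (λ n → curve∈P (index n)) , distinct , covers
    where
    index : Fin (2 ℕ.* suc k) → Index
    index n = classIndex (remQuot (suc k) n)
    distinct : ∀ m n → Isomorphic fld (curve (index m)) (curve (index n)) → m ≡ n
    distinct m n iso = ≡.trans (≡.sym (combine-remQuot {2} (suc k) m)) (≡.trans
      (≡.cong (λ p → combine (proj₁ p) (proj₂ p)) (classIndex-injective (remQuot (suc k) m) (remQuot (suc k) n)
        (proj₁ same) (proj₂ same)))
      (combine-remQuot {2} (suc k) n))
      where same = scaled⇒parameters (index m) (index n) (isomorphic⇒scaled (index m) (index n) iso)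
    covers : ∀ E → E ∈ P → ∃[ n ] Isomorphic fld E (curve (index n))
    covers E E∈P = combine (proj₁ p) (proj₂ p) ,
      scaled⇒isomorphic E S (index (combine (proj₁ p) (proj₂ p))) (≡.subst
        (λ p → ScaledToIndex (ShortForm.A S) (ShortForm.B S) (classIndex p))
        (≡.sym (remQuot-combine (proj₁ p) (proj₂ p)))
        (Scaled-trans (proj₂ classified) (parameters⇒scaled (proj₁ classified) (classIndex p)
          (proj₁ (proj₂ surjected)) (proj₂ (proj₂ surjected)))))
      where
      S = shortForm 2≉0 3≉0 (EllipticCurve.equation E)
      classified = classify E E∈P S
      surjected = classIndex-surjective (proj₁ classified)
      p = proj₁ surjected

  -- From q = 3k + 1 one gets 2q + 4 = 3 · 2 (k + 1), so the division by 3 is exact.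
  numberOfClasses : (2 ℕ.* size ℕ.+ 4) ℕ./ 3 ≡ 2 ℕ.* suc k
  numberOfClasses = ≡.trans (≡.cong (ℕ._/ 3) (≡.trans (≡.cong (λ n → 2 ℕ.* n ℕ.+ 4) size≡) (regroup k)))
                            (ℕ.m*n/n≡m (2 ℕ.* suc k) 3)
    where
    regroup : ∀ k → 2 ℕ.* suc (3 ℕ.* k) ℕ.+ 4 ≡ 2 ℕ.* suc k ℕ.* 3
    regroup = solve-∀

open import Data.Nat using (_+_; _*_)
open import Data.Nat.DivMod using (_/_; _%_)
open FiniteField using (fld; size)

proposition11 : ∀ {c ℓ₁ ℓ₂ c′ ℓ₁′ ℓ₂′ d m₁ m₂}
    (𝔽 : FiniteField c ℓ₁ ℓ₂)
    (𝔽̄ : AlgebraicClosure (fld 𝔽) c′ ℓ₁′ ℓ₂′)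
    (C : HeytingField d m₁ m₂)
    (χ : CubicCharacter (fld 𝔽) C)
    (ρ : HeytingField.Carrier C)
    (b₀ t : FiniteField.Carrier 𝔽) →
    size 𝔽 % 3 ≡ 1 →
    IsPrimitiveCubeRoot C ρ →
    HeytingField._≈_ C (CubicCharacter.χ χ b₀) ρ →
    IsQuadraticNonResidue (fld 𝔽) t →
    HasNumberOfClasses (fld 𝔽) (OnlyOneRationalSubgroupOfOrder3 𝔽 𝔽̄) ((2 * size 𝔽 + 4) / 3)
    × Family.IsFamilyOfRepresentatives (fld 𝔽) C χ b₀ t (OnlyOneRationalSubgroupOfOrder3 𝔽 𝔽̄)
proposition11 𝔽 𝔽̄ C χ ρ b₀ t _ ρ-primitive χb₀≈ρ nonresidue =
  ≡.subst (HasNumberOfClasses (fld 𝔽) (OnlyOneRationalSubgroupOfOrder3 𝔽 𝔽̄)) (≡.sym numberOfClasses) hasNumberOfClasses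
  , isFamilyOfRepresentatives
  where open Classification 𝔽 𝔽̄ C χ ρ-primitive χb₀≈ρ nonresidue
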